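{- Let $T$ be a tournament. Then $T$ is $(-1)$-critical if and only if $T$ is isomorphic to one of the tournaments $E_{2n+1}^{2k+1}$, $F_{2n+1}^{2k+1}$, $(F_{2n+1}^{2k+1})^*$, $G_{2n+1}^{2k+1}$, $(G_{2n+1}^{2k+1})^*$, $H_{2n+1}^{2k+1}$ for some integers $n\ge 3$ and $1\le k\le n-2$. Moreover, in each of these tournaments the vertex $2k+1$ is the unique non-critical vertex.
   Context: A tournament $T=(S,A)$ consists of a finite set $S$ and a set $A$ of ordered pairs of distinct elements of $S$ such that for all distinct $x,y\in S$ exactly one of $(x,y),(y,x)$ lies in $A$; write $x\to y$ for $(x,y)\in A$. For $X\subseteq S$, $T(X)$ is the induced subtournament on $X$, $T-X=T(S\setminus X)$ and $T-x=T(S\setminus\{x\})$. The dual of $T$ is $T^*=(S,\{(x,y):(y,x)\in A\})$. A subset $I\subseteq S$ is an interval of $T$ if for all $a,b\in I$ and $x\in S\setminus I$, $(a,x)\in A$ iff $(b,x)\in A$. The sets $\emptyset$, $\{x\}$ ($x\in S$) and $S$ are the trivial intervals; $T$ is indecomposable if all its intervals are trivial, and decomposable otherwise. A vertex $x$ of an indecomposable tournament $T$ is critical if $T-x$ is decomposable. An indecomposable tournament with at least $5$ vertices is $(-1)$-critical if exactly one of its vertices is non-critical. For an integer $p\ge1$, the tournaments $U_{2p+1}$ and $V_{2p+1}$ on $\{0,\dots,2p\}$ are: in $U_{2p+1}$, for $i<j$, $i\to j$ if $i$ or $j$ is odd, and $j\to i$ if $i$ and $j$ are both even; in $V_{2p+1}$,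 $i\to j$ for $0\le i<j\le 2p-1$, and for $0\le i\le 2p-1$, $2p\to i$ if $i$ is even and $i\to 2p$ if $i$ is odd. For integers $n\ge 3$ and $1\le k\le n-2$, the tournaments $E_{2n+1}^{2k+1},F_{2n+1}^{2k+1},G_{2n+1}^{2k+1},H_{2n+1}^{2k+1}$ are defined on $\{0,\dots,2n\}$; put $P=\{0,\dots,2k\}$ and $Q=\{2k+2,\dots,2n\}$. In each of them, every vertex of $P$ dominates $2k+1$ and $2k+1$ dominates every vertex of $Q$. Further: (E) $E_{2n+1}^{2k+1}$: on $P$, $i\to j$ iff $i<j$; on $Q$, $i\to j$ iff $i<j$; for $x\in Q$, $y\in P$: $x\to y$ if $x$ and $y$ are both even, and $y\to x$ otherwise. (F) $F_{2n+1}^{2k+1}$: on $P$ the arcs are those of $U_{2k+1}$; on $Q$ and between $Q$ and $P$ exactly as in $E_{2n+1}^{2k+1}$. (G) $G_{2n+1}^{2k+1}$: on $P$ the arcs are those of $U_{2k+1}$; on $Q$: $i\to j$ for $2k+2\le i<j\le 2n-1$, and for $j\in\{2k+2,\dots,2n-1\}$, $2n\to j$ if $j$ is even and $j\to 2n$ if $j$ is odd; for $x\in Q$, $y\in P$: $x\to y$ if $x=2n$ and $y$ is even, and $y\to x$ otherwise. (H) $H_{2n+1}^{2k+1}$: on $P$ the arcs are those of $V_{2k+1}$; on $Q$ exactly as in $G_{2n+1}^{2k+1}$; for $x\in Q$, $y\in P$: $x\to y$ if $x=2n$ and $y=2k$, and $y\to x$ otherwise. -}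

module Defs where

open import Data.Bool using (Bool; true; false; not; _∧_; _∨_; if_then_else_)
open import Data.Nat using (ℕ; zero; suc; _+_; _*_; _≤_; _%_; _≡ᵇ_; _<ᵇ_)
open import Data.Fin using (Fin; toℕ)
open import Data.Fin.Subset using (Subset; _∈_; _∉_; _⊆_; ⁅_⁆; ⊤; _-_)
  renaming (⊥ to ∅)
open import Data.Product using (Σ; ∃; _×_; _,_)
open import Data.Sum using (_⊎_)
open import Relation.Nullary using (¬_)
open import Relation.Binary.PropositionalEquality using (_≡_; _≢_)
open import Function.Bundles using (_↔_; Inverse)

-- Tournaments on the vertex set Fin m.
-- arc x y ≡ true  means  (x , y) ∈ A, i.e. x → y.

Arcs : ℕ → Set
Arcs m = Fin m → Fin m → Bool

IsTournament : ∀ {m} → Arcs m → Set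
IsTournament {m} T =
  (∀ (x : Fin m) → T x x ≡ false) ×
  (∀ (x y : Fin m) → x ≢ y → T y x ≡ not (T x y))

dual : ∀ {m} → Arcs m → Arcs m
dual T x y = T y x

_≅_ : ∀ {m m'} → Arcs m → Arcs m' → Set
_≅_ {m} {m'} T T' =
  Σ (Fin m ↔ Fin m') λ f →
    ∀ x y → T x y ≡ T' (Inverse.to f x) (Inverse.to f y)

IsIntervalIn : ∀ {m} → Arcs m → Subset m → Subset m → Set
IsIntervalIn {m} T X I =
  I ⊆ X ×
  (∀ (a b x : Fin m) → a ∈ I → b ∈ I → x ∈ X → x ∉ I → T a x ≡ T b x)

TrivialIn : ∀ {m} → Subset m → Subset m → Set
TrivialIn {m} X I = (I ≡ ∅) ⊎ (Σ (Fin m) λ x → x ∈ X × I ≡ ⁅ x ⁆) ⊎ (I ≡ X)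

IndecomposableOn : ∀ {m} → Arcs m → Subset m → Set
IndecomposableOn {m} T X = ∀ (I : Subset m) → IsIntervalIn T X I → TrivialIn X I

DecomposableOn : ∀ {m} → Arcs m → Subset m → Set
DecomposableOn T X = ¬ IndecomposableOn T X

Indecomposable : ∀ {m} → Arcs m → Set
Indecomposable T = IndecomposableOn T ⊤

Critical : ∀ {m} → Arcs m → Fin m → Set
Critical T x = DecomposableOn T (⊤ - x)

NonCritical : ∀ {m} → Arcs m → Fin m → Set
NonCritical T x = ¬ Critical T x

MinusOneCritical : ∀ {m} → Arcs m → Set
MinusOneCritical {m} T =
  5 ≤ m × Indecomposable T ×
  Σ (Fin m) λ x → NonCritical T x × (∀ y → NonCritical T y → y ≡ x)

even : ℕ → Bool
even i = (i % 2) ≡ᵇ 0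

odd : ℕ → Bool
odd i = not (even i)

ltArc : ℕ → ℕ → Bool
ltArc i j = i <ᵇ j

uArc : ℕ → ℕ → Bool
uArc i j = if i <ᵇ j then (odd i ∨ odd j) else (even i ∧ even j)

-- V-type arcs with top vertex t (V_{2p+1} is vArc (2p)):
-- i→j for i<j<t; t→j iff j even; i→t iff i odd.
vArc : ℕ → ℕ → ℕ → Bool
vArc t i j =
  if i ≡ᵇ t then even j
  else if j ≡ᵇ t then odd i
  else i <ᵇ j

-- Generic gluing with middle vertex c = 2k+1, P = {0..2k}, Q = {2k+2..2n}:
-- pArc on P, qArc on Q, qp x y for x ∈ Q, y ∈ P (x → y), P → c → Q.
glue : ℕ → (ℕ → ℕ → Bool) → (ℕ → ℕ → Bool) → (ℕ → ℕ → Bool) → ℕ → ℕ → Bool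
glue c pArc qArc qp i j =
  if i ≡ᵇ j then false
  else if i ≡ᵇ c then c <ᵇ j
  else if j ≡ᵇ c then i <ᵇ c
  else if i <ᵇ c then (if j <ᵇ c then pArc i j else not (qp j i))
  else (if j <ᵇ c then qp i j else qArc i j)

lift : ∀ {m} → (ℕ → ℕ → Bool) → Arcs m
lift f x y = f (toℕ x) (toℕ y)

E F G H : (n k : ℕ) → Arcs (suc (2 * n))
E n k = lift (glue (suc (2 * k)) ltArc ltArc (λ x y → even x ∧ even y))
F n k = lift (glue (suc (2 * k)) uArc  ltArc (λ x y → even x ∧ even y))
G n k = lift (glue (suc (2 * k)) uArc  (vArc (2 * n))
                   (λ x y → (x ≡ᵇ 2 * n) ∧ even y))
H n k = lift (glue (suc (2 * k)) (vArc (2 * k)) (vArc (2 * n))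
                   (λ x y → (x ≡ᵇ 2 * n) ∧ (y ≡ᵇ 2 * k)))

OneOfSix : (n k : ℕ) → Arcs (suc (2 * n)) → Set
OneOfSix n k X =
  (X ≡ E n k) ⊎ (X ≡ F n k) ⊎ (X ≡ dual (F n k)) ⊎
  (X ≡ G n k) ⊎ (X ≡ dual (G n k)) ⊎ (X ≡ H n k)

Admissible : ℕ → ℕ → Set
Admissible n k = 3 ≤ n × 1 ≤ k × k + 2 ≤ n

{-# OPTIONS --safe #-}
-- Let T be (-1)-critical with non-critical vertex c.  The indecomposable sets of vertices that contain a given
-- 3-cycle through c grow by two vertices at a time, because a one-vertex extension would lead, by parity, to a
-- non-critical vertex other than c.  It follows that every vertex x outside the 3-cycle has a neighbour y ≠ c in
-- the indecomposability graph, i.e. T − {x, y} is indecomposable.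
--
-- If x, y are adjacent in this graph, then, apart from x, either y dominates everything or nothing, or y has a
-- unique twin z, and z is again a neighbour of x unless z = c.  So the graph without c consists of paths; the vertices of
-- a path with the same parity are alike from the outside, which determines all arcs of a path up to a few bits.  One end
-- of each path is attached to c and the other end has a dominating or a dominated vertex next to it.  There is
-- exactly one path of each of these two signs.  According to the parity of its length, a path is a whole side P or Q
-- of the tournament with arcs as in a linear order or in U_{2k+1}, or it forms, together with one vertex outside
-- the graph, a side shaped like V_{2k+1}.  The combinations that do not occur in the list have a decomposable T − c.
--
-- Conversely the listed tournaments are built from a 3-cycle through c, and without c from six vertices, by adding
-- two consecutive vertices of a side at a time.
module Submission where

open import Defs
open import Data.Bool using (Bool; true; false; not; _∧_; _∨_; _xor_; if_then_else_)
open import Data.Bool.Properties using (not-involutive; ¬-not; not-¬; ∧-comm) renaming (_≟_ to _≟ᵇ_)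
open import Data.Empty using (⊥; ⊥-elim)
open import Data.Fin using (Fin; zero; suc; toℕ; fromℕ<)
import Data.Fin.Properties as Fin
open import Data.Fin.Permutation using (↔⇒≡)
open import Data.Fin.Properties using (any?; all?; pigeonhole; toℕ<n; toℕ-fromℕ<; toℕ-injective)
open import Data.Fin.Subset using (Subset; ⁅_⁆; _∈_; _∉_; _-_) renaming (⊤ to whole)
open import Data.Fin.Subset.Properties
  using (_∈?_; ∈⊤; ∉⊥; Empty-unique; ⊆-antisym; x∈⁅y⁆⇒x≡y; x∈⁅x⁆; x∈p∧x∉q⇒x∈p─q)
open import Data.Nat
  using (ℕ; zero; suc; pred; _+_; _*_; _∸_; _≤_; _<_; _≤?_; z≤n; s≤s; z<s; _<ᵇ_; _≡ᵇ_)
open import Data.Nat.Properties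
  using (≤-refl; ≤-trans; ≤-reflexive; ≤-pred; n≤1+n; m≤n+m; m≤m+n; m≤n⇒m<n∨m≡n; <⇒≤; <⇒≢; ≰⇒>; ≤∧≢⇒<; <-irrefl;
         <-cmp; suc-injective; +-suc; +-identityʳ; +-comm; +-assoc; +-cancelˡ-≡; +-monoʳ-≤; *-suc; *-distribˡ-+;
         *-monoʳ-≤; m∸n≤m; n∸n≡0; m∸[m∸n]≡n; m+n∸m≡n; m+[n∸m]≡n; m∸n+n≡m; ∸-monoˡ-≤; ∸-monoʳ-<; m⊓n≤n; m≤n⇒m⊓n≡m;
         anyUpTo?)
  renaming (_≟_ to _≟ⁿ_)
open import Data.Product using (Σ; ∃; ∃₂; _×_; _,_; proj₁; proj₂)
open import Data.Sum using (_⊎_; inj₁; inj₂)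
open import Data.Unit using (⊤; tt)
open import Data.Vec using (Vec; []; _∷_; lookup; tabulate; there)
open import Data.Vec.Properties using ([]=⇒lookup; lookup⇒[]=; lookup∘tabulate)
open import Function.Bundles using (Inverse; _⇔_; mk⇔; mk↔ₛ′)
open import Relation.Binary using (DecidableEquality)
open import Relation.Binary.Definitions using (tri<; tri≈; tri>)
open import Relation.Binary.PropositionalEquality
  using (_≡_; _≢_; refl; sym; trans; cong; cong₂; subst; subst₂; ≢-sym)
open import Relation.Nullary using (¬_; Dec; yes; no; does)
open import Relation.Nullary.Decidable
  using (map′; ¬?; isYes; dec-true; dec-false; _×-dec_; _⊎-dec_; _→-dec_)

-- The parity argument needs `c` inside the growing set. Adding pairs stops at all vertices or at
-- all but one vertex `x`; in the second case `T − x` is indecomposable, which is absurd only for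
-- `x ≢ c`. Starting from a 3-cycle through `c` guarantees this. A neighbour of a vertex need not
-- survive the addition of a pair; `exchange` then lets one of the new vertices take its place.
--
-- Where the structure is derived, the indecomposability of `T − c` enters only as a source of
-- contradictions: an unwanted configuration produces two twins in `T − c`, or a vertex of `T − c`
-- that dominates all the others or none of them.
--
-- Exchanging the two sides `P` and `Q` reverses every arc. So the families E and H are closed under
-- duality, and only F and G are listed together with their duals. For the same reason growth and
-- criticality are proved for `P` alone.

true≢false : true ≢ false
true≢false ()

clash : ∀ {b} → b ≡ true → b ≡ false → ⊥
clash refl ()

-- Indecomposability relative to a predicate

record Tour {V : Set} (T : V → V → Bool) : Set where
  field
    _≟_  : DecidableEquality V
    irr  : ∀ x → T x x ≡ false
    anti : ∀ {x y} → x ≢ y → T y x ≡ not (T x y)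

b≢notb : ∀ {b} → b ≢ not b
b≢notb = not-¬ refl

-- Stated as a refutation, so that it is stable under double negation and no subsets have to be
-- compared. `I` is defined on all of `V`, but only its values on `X` matter; this lets `X` vary
-- freely.
Indec : {V : Set} → (V → V → Bool) → (V → Set) → Set
Indec {V} T X = (I : V → Bool) →
  (∀ {a b x} → X a → X b → X x → I a ≡ true → I b ≡ true → I x ≡ false → T a x ≡ T b x) →
  ∀ {p q r} → p ≢ q → X p → X q → X r → I p ≡ true → I q ≡ true → I r ≡ false → ⊥

Indec-resp : {V : Set} {T : V → V → Bool} {X X' : V → Set} →
  (∀ {z} → X z → X' z) → (∀ {z} → X' z → X z) → Indec T X → Indec T X'
Indec-resp f g ind I iv p≢q Xp Xq Xr = ind I (λ a b x → iv (f a) (f b) (f x)) p≢q (g Xp) (g Xq) (g Xr)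

-- Intervals pull back along `σ`, and preimages of distinct elements are distinct, so a surjection
-- that preserves arcs is enough.
Indec-map : {V W : Set} {T : V → V → Bool} {U : W → W → Bool} {X : V → Set} {X' : W → Set}
  (σ : V → W) → (∀ {a} → X a → X' (σ a)) → (∀ {b} → X' b → Σ V λ a → X a × σ a ≡ b) →
  (∀ {a b} → X a → X b → U (σ a) (σ b) ≡ T a b) → Indec T X → Indec U X'
Indec-map σ im sur arc ind I iv {p} {q} {r} p≢q Xp Xq Xr Ip Iq Ir
  with sur Xp | sur Xq | sur Xr
... | p' , Xp' , refl | q' , Xq' , refl | r' , Xr' , refl =
  ind (λ v → I (σ v))
    (λ Xa Xb Xx Ia Ib Ix → trans (sym (arc Xa Xx)) (trans (iv (im Xa) (im Xb) (im Xx) Ia Ib Ix) (arc Xb Xx)))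
    (λ e → p≢q (cong σ e)) Xp' Xq' Xr' Ip Iq Ir

infixl 5 _⊹_
_⊹_ : {V : Set} → (V → Set) → V → V → Set
(Y ⊹ v) z = Y z ⊎ z ≡ v

record Three {V : Set} (Y : V → Set) : Set where
  constructor three
  field
    {a b c} : V
    Ya : Y a
    Yb : Y b
    Yc : Y c
    a≢b : a ≢ b
    a≢c : a ≢ c
    b≢c : b ≢ c

Three-mono : {V : Set} {Y Z : V → Set} → (∀ {v} → Y v → Z v) → Three Y → Three Z
Three-mono f (three a b c p q r) = three (f a) (f b) (f c) p q r

-- The two ways in which a vertex `v` outside an indecomposable `Y` can fail to extend it: `Y` is an
-- interval of `Y ⊹ v`, or `v` forms an interval with one vertex `u` of `Y`.
data Kind (V : Set) : Set where
  global : Kind V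
  twin   : V → Kind V

twin-injective : {V : Set} {u v : V} → twin u ≡ twin v → u ≡ v
twin-injective refl = refl

module Core {V : Set} {T : V → V → Bool} (tour : Tour T) where
  open Tour tour

  flip : ∀ {a b x} → a ≢ x → b ≢ x → T a x ≡ T b x → T x a ≡ T x b
  flip a≢x b≢x e = trans (anti a≢x) (trans (cong not e) (sym (anti b≢x)))

  unflip : ∀ {a b x} → a ≢ x → b ≢ x → T x a ≡ T x b → T a x ≡ T b x
  unflip a≢x b≢x e = trans (anti (≢-sym a≢x)) (trans (cong not e) (sym (anti (≢-sym b≢x))))

  opp : ∀ {x y b} → x ≢ y → T x y ≡ b → T y x ≡ not b
  opp x≢y e = trans (anti x≢y) (cong not e)

  opp′ : ∀ {x y b} → x ≢ y → T x y ≡ not b → T y x ≡ b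
  opp′ x≢y e = trans (opp x≢y e) (not-involutive _)

  nontrivial⊥ : ∀ {X} → Indec T X → (P : V → Set) → (∀ v → Dec (P v)) →
    (∀ {a b x} → X a → X b → X x → P a → P b → ¬ P x → T a x ≡ T b x) →
    ∀ {p q r} → p ≢ q → X p → X q → X r → P p → P q → ¬ P r → ⊥
  nontrivial⊥ {X} ind P P? iv {p} {q} {r} p≢q Xp Xq Xr Pp Pq ¬Pr =
    ind (λ v → does (P? v)) (λ {a} {b} {x} Xa Xb Xx ea eb ex → iv Xa Xb Xx (from a ea) (from b eb) (from¬ x ex))
      p≢q Xp Xq Xr (dec-true (P? p) Pp) (dec-true (P? q) Pq) (dec-false (P? r) ¬Pr)
    where
    from : ∀ v → does (P? v) ≡ true → P v
    from v e with P? v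
    ... | yes Pv = Pv
    from¬ : ∀ v → does (P? v) ≡ false → ¬ P v
    from¬ v e with P? v
    ... | no ¬Pv = ¬Pv

  pair? : ∀ y z v → Dec (v ≡ y ⊎ v ≡ z)
  pair? y z v with v ≟ y | v ≟ z
  ... | yes e | _ = yes (inj₁ e)
  ... | no _ | yes e = yes (inj₂ e)
  ... | no n | no n' = no λ { (inj₁ e) → n e ; (inj₂ e) → n' e }

  twins⊥ : ∀ {X} → Indec T X → ∀ {y z r} → y ≢ z → X y → X z → X r → r ≢ y → r ≢ z →
    (∀ {w} → X w → w ≢ y → w ≢ z → T y w ≡ T z w) → ⊥
  twins⊥ {X} ind {y} {z} y≢z Xy Xz Xr r≢y r≢z tw =
    nontrivial⊥ ind (λ v → v ≡ y ⊎ v ≡ z) (pair? y z) iv y≢z Xy Xz Xr (inj₁ refl) (inj₂ refl)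
      λ { (inj₁ e) → r≢y e ; (inj₂ e) → r≢z e }
    where
    eq : ∀ {a x} → X x → a ≡ y ⊎ a ≡ z → ¬ (x ≡ y ⊎ x ≡ z) → T a x ≡ T y x
    eq Xx (inj₁ refl) nx = refl
    eq Xx (inj₂ refl) nx = sym (tw Xx (λ e → nx (inj₁ e)) (λ e → nx (inj₂ e)))
    iv : ∀ {a b x} → X a → X b → X x → a ≡ y ⊎ a ≡ z → b ≡ y ⊎ b ≡ z → ¬ (x ≡ y ⊎ x ≡ z) → T a x ≡ T b x
    iv _ _ Xx ea eb nx = trans (eq Xx ea nx) (sym (eq Xx eb nx))

  not? : ∀ y v → Dec (v ≢ y)
  not? y v with v ≟ y
  ... | yes e = no λ n → n e
  ... | no n = yes n

  constant⊥ : ∀ {X} → Indec T X → ∀ {y p q} → X y → X p → X q → p ≢ q → p ≢ y → q ≢ y →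
    (∀ {w w'} → X w → X w' → w ≢ y → w' ≢ y → T y w ≡ T y w') → ⊥
  constant⊥ {X} ind {y} Xy Xp Xq p≢q p≢y q≢y con =
    nontrivial⊥ ind (λ v → v ≢ y) (not? y) iv p≢q Xp Xq Xy p≢y q≢y (λ n → n refl)
    where
    iv : ∀ {a b x} → X a → X b → X x → a ≢ y → b ≢ y → ¬ (x ≢ y) → T a x ≡ T b x
    iv {x = x} Xa Xb Xx a≢y b≢y nn with x ≟ y
    ... | yes refl = unflip a≢y b≢y (con Xa Xb a≢y b≢y)
    ... | no n = ⊥-elim (nn n)

  Has : (V → Set) → V → Kind V → Set
  Has Y v global   = ∀ {y y'} → Y y → Y y' → T v y ≡ T v y'
  Has Y v (twin u) = Y u × (∀ {y} → Y y → y ≢ u → T v y ≡ T u y)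

  others : ∀ {Y} → Three Y → ∀ u → ∃₂ λ p q → Y p × Y q × p ≢ q × p ≢ u × q ≢ u
  others (three {a} {b} {c} Ya Yb Yc a≢b a≢c b≢c) u with a ≟ u | b ≟ u
  ... | yes refl | _ = b , c , Yb , Yc , b≢c , ≢-sym a≢b , ≢-sym a≢c
  ... | no n | yes refl = a , c , Ya , Yc , a≢c , n , ≢-sym b≢c
  ... | no n | no n' = a , b , Ya , Yb , a≢b , n , n'

  third : ∀ {Y} → Three Y → ∀ u u' → ∃ λ p → Y p × p ≢ u × p ≢ u'
  third t u u' with others t u
  ... | p , q , Yp , Yq , p≢q , p≢u , q≢u with p ≟ u'
  ... | yes refl = q , Yq , q≢u , ≢-sym p≢q
  ... | no n = p , Yp , p≢u , n

  typed→¬Indec : ∀ {Y v} → Three Y → ¬ Y v → ∀ t → Has Y v t → ¬ Indec T (Y ⊹ v)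
  typed→¬Indec {Y} {v} t3 ¬Yv global g ind' with others t3 v
  ... | p , q , Yp , Yq , p≢q , p≢v , q≢v =
    constant⊥ ind' (inj₂ refl) (inj₁ Yp) (inj₁ Yq) p≢q p≢v q≢v
      λ { (inj₁ Yw) (inj₁ Yw') _ _ → g Yw Yw'
        ; (inj₂ e) _ n _ → ⊥-elim (n e)
        ; _ (inj₂ e) _ n → ⊥-elim (n e) }
  typed→¬Indec {Y} {v} t3 ¬Yv (twin u) (Yu , tw) ind' with third t3 u v
  ... | r , Yr , r≢u , r≢v =
    twins⊥ ind' (λ e → ¬Yv (subst Y (sym e) Yu)) (inj₂ refl) (inj₁ Yu) (inj₁ Yr) r≢v r≢u
      λ { (inj₁ Yw) n n' → tw Yw n' ; (inj₂ e) n n' → ⊥-elim (n e) }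

  module _ {Y : V → Set} {v w : V} (t3 : Three Y) (¬Yv : ¬ Y v) (¬Yw : ¬ Y w) (v≢w : v ≢ w) where

    private
      Z : V → Set
      Z = Y ⊹ v ⊹ w

      Zv : Z v
      Zv = inj₁ (inj₂ refl)

      Zw : Z w
      Zw = inj₂ refl

      v≢Y : ∀ {y} → Y y → v ≢ y
      v≢Y Yy refl = ¬Yv Yy

      w≢Y : ∀ {y} → Y y → w ≢ y
      w≢Y Yy refl = ¬Yw Yy

    -- Two global vertices leave `Y` an interval; two twins of `u` form an interval together with
    -- `u`.
    same-kind→¬Indec : ∀ t → Has Y v t → Has Y w t → ¬ Indec T Z
    same-kind→¬Indec global g g' ind' with others t3 v
    ... | p , q , Yp , Yq , p≢q , _ , _ =
      nontrivial⊥ ind' (λ z → z ≢ v × z ≢ w) P? iv p≢q (inj₁ (inj₁ Yp)) (inj₁ (inj₁ Yq)) Zv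
        ((≢-sym (v≢Y Yp)) , ≢-sym (w≢Y Yp)) ((≢-sym (v≢Y Yq)) , ≢-sym (w≢Y Yq)) (λ n → proj₁ n refl)
      where
      P? : ∀ z → Dec (z ≢ v × z ≢ w)
      P? z with z ≟ v | z ≟ w
      ... | yes e | _ = no λ n → proj₁ n e
      ... | no _ | yes e = no λ n → proj₂ n e
      ... | no n | no n' = yes (n , n')
      inY : ∀ {z} → Z z → z ≢ v × z ≢ w → Y z
      inY (inj₁ (inj₁ Yz)) _ = Yz
      inY (inj₁ (inj₂ e)) (n , _) = ⊥-elim (n e)
      inY (inj₂ e) (_ , n) = ⊥-elim (n e)
      iv : ∀ {a b x} → Z a → Z b → Z x → a ≢ v × a ≢ w → b ≢ v × b ≢ w → ¬ (x ≢ v × x ≢ w) → T a x ≡ T b x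
      iv Za Zb (inj₁ (inj₁ Yx)) Pa Pb nx = ⊥-elim (nx (≢-sym (v≢Y Yx) , ≢-sym (w≢Y Yx)))
      iv Za Zb (inj₁ (inj₂ refl)) Pa Pb nx = unflip (proj₁ Pa) (proj₁ Pb) (g (inY Za Pa) (inY Zb Pb))
      iv Za Zb (inj₂ refl) Pa Pb nx = unflip (proj₂ Pa) (proj₂ Pb) (g' (inY Za Pa) (inY Zb Pb))
    same-kind→¬Indec (twin u) (Yu , tw) (_ , tw') ind' with others t3 u
    ... | r , _ , Yr , _ , _ , r≢u , _ =
      nontrivial⊥ ind' P P? iv v≢w Zv Zw (inj₁ (inj₁ Yr)) (inj₂ (inj₁ refl)) (inj₂ (inj₂ refl))
        λ { (inj₁ e) → r≢u e ; (inj₂ (inj₁ e)) → v≢Y Yr (sym e) ; (inj₂ (inj₂ e)) → w≢Y Yr (sym e) }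
      where
      P : V → Set
      P z = z ≡ u ⊎ (z ≡ v ⊎ z ≡ w)
      P? : ∀ z → Dec (P z)
      P? z with z ≟ u | pair? v w z
      ... | yes e | _ = yes (inj₁ e)
      ... | no _ | yes e = yes (inj₂ e)
      ... | no n | no n' = no λ { (inj₁ e) → n e ; (inj₂ e) → n' e }
      eq : ∀ {a x} → Z x → P a → ¬ P x → T a x ≡ T u x
      eq _ (inj₁ refl) nx = refl
      eq (inj₁ (inj₁ Yx)) (inj₂ (inj₁ refl)) nx = tw Yx (λ e → nx (inj₁ e))
      eq (inj₁ (inj₁ Yx)) (inj₂ (inj₂ refl)) nx = tw' Yx (λ e → nx (inj₁ e))
      eq (inj₁ (inj₂ e)) (inj₂ _) nx = ⊥-elim (nx (inj₂ (inj₁ e)))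
      eq (inj₂ e) (inj₂ _) nx = ⊥-elim (nx (inj₂ (inj₂ e)))
      iv : ∀ {a b x} → Z a → Z b → Z x → P a → P b → ¬ P x → T a x ≡ T b x
      iv Za Zb Zx Pa Pb nx = trans (eq Zx Pa nx) (sym (eq Zx Pb nx))

  module Over {Y : V → Set} (ind : Indec T Y) (t3 : Three Y) where

    -- Such a `u` would see the rest of `Y` as uniformly as `v` does, so `Y` without `u` would be an
    -- interval of `Y`.
    global-twin⊥ : ∀ {v u} → Has Y v global → ¬ Has Y v (twin u)
    global-twin⊥ {v} {u} g (Yu , tw) with others t3 u
    ... | p , q , Yp , Yq , p≢q , p≢u , q≢u =
      constant⊥ ind Yu Yp Yq p≢q p≢u q≢u
        (λ Yw Yw' n n' → trans (sym (tw Yw n)) (trans (g Yw Yw') (tw Yw' n')))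

    kind-unique : ∀ {v} t t' → Has Y v t → Has Y v t' → t ≡ t'
    kind-unique global global _ _ = refl
    kind-unique global (twin u) g h = ⊥-elim (global-twin⊥ g h)
    kind-unique (twin u) global h g = ⊥-elim (global-twin⊥ g h)
    kind-unique (twin u) (twin u') (Yu , tw) (Yu' , tw') with u ≟ u'
    ... | yes refl = refl
    ... | no u≢u' with third t3 u u'
    ... | r , Yr , r≢u , r≢u' = ⊥-elim (twins⊥ ind u≢u' Yu Yu' Yr r≢u r≢u'
            λ Yw n n' → trans (sym (tw Yw n)) (tw' Yw n'))

    -- An interval of a larger set meets `Y` in nothing, in one vertex or in all of `Y`. If it
    -- contains `Y`, the vertices left out are global; if it contains just `p` from `Y`, its outside
    -- members are twins of `p`.
    module Interval {Z : V → Set} (Y⊆Z : ∀ {z} → Y z → Z z) {I : V → Bool}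
      (iv : ∀ {a b x} → Z a → Z b → Z x → I a ≡ true → I b ≡ true → I x ≡ false → T a x ≡ T b x) where

      full : ∀ {p q} → p ≢ q → Y p → Y q → I p ≡ true → I q ≡ true → ∀ {y} → Y y → I y ≡ true
      full p≢q Yp Yq Ip Iq {y} Yy with I y in e
      ... | true = refl
      ... | false = ⊥-elim (ind I (λ a b x → iv (Y⊆Z a) (Y⊆Z b) (Y⊆Z x)) p≢q Yp Yq Yy Ip Iq e)

      full→global : ∀ {v} → ¬ Y v → Z v → I v ≡ false → (∀ {y} → Y y → I y ≡ true) → Has Y v global
      full→global {v} ¬Yv Zv Iv all Yy Yy' = flip (λ e → ¬Yv (subst Y e Yy)) (λ e → ¬Yv (subst Y e Yy'))
        (iv (Y⊆Z Yy) (Y⊆Z Yy') Zv (all Yy) (all Yy') Iv)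

      single→twin : ∀ {v p} → Z v → Y p → I v ≡ true → I p ≡ true →
        (∀ {y} → Y y → y ≢ p → I y ≡ false) → Has Y v (twin p)
      single→twin Zv Yp Iv Ip out = Yp , λ Yy n → iv Zv (Y⊆Z Yp) (Y⊆Z Yy) Iv Ip (out Yy n)

    untyped→Indec : ∀ {v} → ¬ Y v → (∀ t → ¬ Has Y v t) → Indec T (Y ⊹ v)
    untyped→Indec {v} ¬Yv unt I iv {p} {q} {r} p≢q Zp Zq Zr Ip Iq Ir = go Zp Zq Zr
      where
      open Interval {Z = Y ⊹ v} inj₁ {I} iv
      inside : ∀ {p q} → p ≢ q → Y p → Y q → I p ≡ true → I q ≡ true → ⊥
      inside n Yp Yq Ip Iq with I v in e
      ... | false = unt global (full→global ¬Yv (inj₂ refl) e (full n Yp Yq Ip Iq))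
      ... | true = rest Zr
        where
        rest : (Y ⊹ v) r → ⊥
        rest (inj₁ Yr) = clash (full n Yp Yq Ip Iq Yr) Ir
        rest (inj₂ refl) = clash e Ir
      cross : ∀ {p} → Y p → I p ≡ true → I v ≡ true → ⊥
      cross {p} Yp Ip Iv = unt (twin p) (single→twin (inj₂ refl) Yp Iv Ip out)
        where
        out : ∀ {y} → Y y → y ≢ p → I y ≡ false
        out {y} Yy n with I y in e
        ... | false = refl
        ... | true = ⊥-elim (inside (≢-sym n) Yp Yy Ip e)
      go : (Y ⊹ v) p → (Y ⊹ v) q → (Y ⊹ v) r → ⊥
      go (inj₁ Yp) (inj₁ Yq) _ = inside p≢q Yp Yq Ip Iq
      go (inj₁ Yp) (inj₂ refl) _ = cross Yp Ip Iq
      go (inj₂ refl) (inj₁ Yq) _ = cross Yq Iq Ip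
      go (inj₂ refl) (inj₂ refl) _ = p≢q refl

    module _ {v w : V} (¬Yv : ¬ Y v) (¬Yw : ¬ Y w) (v≢w : v ≢ w) where

      private
        Z : V → Set
        Z = Y ⊹ v ⊹ w

        Zv : Z v
        Zv = inj₁ (inj₂ refl)

        Zw : Z w
        Zw = inj₂ refl

        v≢Y : ∀ {y} → Y y → v ≢ y
        v≢Y Yy refl = ¬Yv Yy

        w≢Y : ∀ {y} → Y y → w ≢ y
        w≢Y Yy refl = ¬Yw Yy

      module Grow {I : V → Bool}
        (iv : ∀ {a b x} → Z a → Z b → Z x → I a ≡ true → I b ≡ true → I x ≡ false → T a x ≡ T b x) where
        open Interval {Z = Z} (λ y → inj₁ (inj₁ y)) {I} iv public

        Y→Z : ∀ {y} → Y y → Z y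
        Y→Z y = inj₁ (inj₁ y)

        Meet : (V → Set) → (V → Set) → Set
        Meet A B = ∀ {p q} → p ≢ q → A p → B q → I p ≡ true → I q ≡ true → ⊥

        module Inside (inside : Meet Y Y) where

          out : ∀ {p} → Y p → I p ≡ true → ∀ {y} → Y y → y ≢ p → I y ≡ false
          out Yp Ip {y} Yy n with I y in e
          ... | false = refl
          ... | true = ⊥-elim (inside (≢-sym n) Yp Yy Ip e)

          cases : (∀ {p} → Y p → I p ≡ true → I v ≡ true → ⊥) → (∀ {p} → Y p → I p ≡ true → I w ≡ true → ⊥) →
            (I v ≡ true → I w ≡ true → ⊥) → Meet Z Z
          cases cv cw vw n (inj₁ (inj₁ Yp)) (inj₁ (inj₁ Yq)) Ip Iq = inside n Yp Yq Ip Iq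
          cases cv cw vw n (inj₁ (inj₁ Yp)) (inj₁ (inj₂ refl)) Ip Iq = cv Yp Ip Iq
          cases cv cw vw n (inj₁ (inj₁ Yp)) (inj₂ refl) Ip Iq = cw Yp Ip Iq
          cases cv cw vw n (inj₁ (inj₂ refl)) (inj₁ (inj₁ Yq)) Ip Iq = cv Yq Iq Ip
          cases cv cw vw n (inj₁ (inj₂ refl)) (inj₁ (inj₂ refl)) Ip Iq = n refl
          cases cv cw vw n (inj₁ (inj₂ refl)) (inj₂ refl) Ip Iq = vw Ip Iq
          cases cv cw vw n (inj₂ refl) (inj₁ (inj₁ Yq)) Ip Iq = cw Yq Iq Ip
          cases cv cw vw n (inj₂ refl) (inj₁ (inj₂ refl)) Ip Iq = vw Iq Ip
          cases cv cw vw n (inj₂ refl) (inj₂ refl) Ip Iq = n refl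

      -- Whatever the position of a nontrivial interval relative to `Y`, `v` and `w`, it would
      -- either give `w` the kind `t` over `Y` or let `v` keep the kind `t` over `Y ⊹ w`.
      grow : ∀ t → Has Y v t → ¬ Has Y w t → ¬ Has (Y ⊹ w) v t → Indec T Z
      grow t hv ¬hw ¬hvw I iv {p} {q} {r} p≢q Zp Zq Zr Ip Iq Ir = cases crossv crossw both p≢q Zp Zq Ip Iq
        where
        open Grow {I} iv
        inside : Meet Y Y
        inside n Yp Yq Ip Iq with I v in ev | I w in ew
        ... | false | false with kind-unique t global hv (full→global ¬Yv Zv ev (full n Yp Yq Ip Iq))
        ...   | refl = ¬hw (full→global ¬Yw Zw ew (full n Yp Yq Ip Iq))
        inside n Yp Yq Ip Iq | false | true with kind-unique t global hv (full→global ¬Yv Zv ev (full n Yp Yq Ip Iq))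
        ...   | refl = ¬hvw h
          where
          allI : ∀ {y} → (Y ⊹ w) y → I y ≡ true × v ≢ y × Z y
          allI (inj₁ Yy) = full n Yp Yq Ip Iq Yy , v≢Y Yy , Y→Z Yy
          allI (inj₂ refl) = ew , v≢w , Zw
          h : Has (Y ⊹ w) v global
          h Yy Yy' with allI Yy | allI Yy'
          ... | i , d , z | i' , d' , z' = flip (≢-sym d) (≢-sym d') (iv z z' Zv i i' ev)
        inside n Yp Yq Ip Iq | true | false = sub t hv ¬hw ¬hvw
          where
          wY : ∀ {y} → Y y → T w y ≡ T w v
          wY Yy = flip (≢-sym (w≢Y Yy)) v≢w (iv (Y→Z Yy) Zv Zw (full n Yp Yq Ip Iq Yy) ev ew)
          sub : ∀ t → Has Y v t → ¬ Has Y w t → ¬ Has (Y ⊹ w) v t → ⊥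
          sub global _ ¬hw _ = ¬hw (λ Yy Yy' → trans (wY Yy) (sym (wY Yy')))
          sub (twin u) (Yu , tw) _ ¬hvw = ¬hvw (inj₁ Yu , λ
            { (inj₁ Yy) n' → tw Yy n'
            ; (inj₂ refl) _ → sym (unflip (≢-sym (w≢Y Yu)) v≢w (wY Yu)) })
        inside n Yp Yq Ip Iq | true | true = rest Zr
          where
          rest : Z r → ⊥
          rest (inj₁ (inj₁ Yr)) = clash (full n Yp Yq Ip Iq Yr) Ir
          rest (inj₁ (inj₂ refl)) = clash ev Ir
          rest (inj₂ refl) = clash ew Ir
        open Inside inside
        crossv : ∀ {p} → Y p → I p ≡ true → I v ≡ true → ⊥
        crossv {p} Yp Ip Iv with kind-unique t (twin p) hv (single→twin Zv Yp Iv Ip (out Yp Ip))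
        ... | refl with I w in ew
        ...   | true = ¬hw (single→twin Zw Yp ew Ip (out Yp Ip))
        ...   | false = ¬hvw (inj₁ Yp , λ { (inj₁ Yy) n → proj₂ hv Yy n ; (inj₂ refl) _ → iv Zv (Y→Z Yp) Zw Iv Ip ew })
        crossw : ∀ {p} → Y p → I p ≡ true → I w ≡ true → ⊥
        crossw {p} Yp Ip Iw with I v in ev
        ... | true = crossv Yp Ip ev
        ... | false = sub t hv ¬hw ¬hvw
          where
          hwp : Has Y w (twin p)
          hwp = single→twin Zw Yp Iw Ip (out Yp Ip)
          vp : T v w ≡ T v p
          vp = flip (≢-sym v≢w) (≢-sym (v≢Y Yp)) (iv Zw (Y→Z Yp) Zv Iw Ip ev)
          sub : ∀ t → Has Y v t → ¬ Has Y w t → ¬ Has (Y ⊹ w) v t → ⊥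
          sub global g _ ¬hvw = ¬hvw λ
            { (inj₁ Yy) (inj₁ Yy') → g Yy Yy' ; (inj₁ Yy) (inj₂ refl) → trans (g Yy Yp) (sym vp)
            ; (inj₂ refl) (inj₁ Yy) → trans vp (g Yp Yy) ; (inj₂ refl) (inj₂ refl) → refl }
          sub (twin u) (Yu , tw) ¬hw ¬hvw with u ≟ p
          ... | yes refl = ¬hw hwp
          ... | no u≢p = ¬hvw (inj₁ Yu , λ
                { (inj₁ Yy) n → tw Yy n
                ; (inj₂ refl) _ → trans vp (trans (tw Yp (≢-sym u≢p))
                    (flip (≢-sym u≢p) (w≢Y Yu) (sym (proj₂ hwp Yu u≢p)))) })
        both : I v ≡ true → I w ≡ true → ⊥
        both Iv Iw = sub t hv ¬hw
          where
          eq : ∀ {y} → Y y → T w y ≡ T v y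
          eq {y} Yy with I y in e
          ... | true = ⊥-elim (crossv Yy e Iv)
          ... | false = iv Zw Zv (Y→Z Yy) Iw Iv e
          sub : ∀ t → Has Y v t → ¬ Has Y w t → ⊥
          sub global g ¬hw = ¬hw λ Yy Yy' → trans (eq Yy) (trans (g Yy Yy') (sym (eq Yy')))
          sub (twin u) (Yu , tw) ¬hw = ¬hw (Yu , λ Yy n → trans (eq Yy) (tw Yy n))

      -- A nontrivial interval other than the pair `v`, `w` would give one of the two vertices a
      -- kind; the last hypothesis excludes the pair.
      grow-untyped : (∀ t → ¬ Has Y v t) → (∀ t → ¬ Has Y w t) →
        ¬ (∀ {y} → Y y → T v y ≡ T w y) → Indec T Z
      grow-untyped ¬hv ¬hw ¬tw I iv {p} {q} {r} p≢q Zp Zq Zr Ip Iq Ir = cases crossv crossw both p≢q Zp Zq Ip Iq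
        where
        open Grow {I} iv
        inside : Meet Y Y
        inside n Yp Yq Ip Iq with I v in ev | I w in ew
        ... | false | _ = ¬hv global (full→global ¬Yv Zv ev (full n Yp Yq Ip Iq))
        ... | true | false = ¬hw global (full→global ¬Yw Zw ew (full n Yp Yq Ip Iq))
        ... | true | true = rest Zr
          where
          rest : Z r → ⊥
          rest (inj₁ (inj₁ Yr)) = clash (full n Yp Yq Ip Iq Yr) Ir
          rest (inj₁ (inj₂ refl)) = clash ev Ir
          rest (inj₂ refl) = clash ew Ir
        open Inside inside
        crossv : ∀ {p} → Y p → I p ≡ true → I v ≡ true → ⊥
        crossv {p} Yp Ip Iv = ¬hv (twin p) (single→twin Zv Yp Iv Ip (out Yp Ip))
        crossw : ∀ {p} → Y p → I p ≡ true → I w ≡ true → ⊥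
        crossw {p} Yp Ip Iw = ¬hw (twin p) (single→twin Zw Yp Iw Ip (out Yp Ip))
        both : I v ≡ true → I w ≡ true → ⊥
        both Iv Iw = ¬tw eq
          where
          eq : ∀ {y} → Y y → T v y ≡ T w y
          eq {y} Yy with I y in e
          ... | true = ⊥-elim (crossv Yy e Iv)
          ... | false = iv Zv Zw (Y→Z Yy) Iv Iw e

  -- The map that sends `z` to `y` and fixes `W` is an isomorphism.
  swap : ∀ {W y z} → ¬ W y → ¬ W z →
    (∀ {w} → W w → T y w ≡ T z w) → Indec T (W ⊹ z) → Indec T (W ⊹ y)
  swap {W} {y} {z} ¬Wy ¬Wz tw ind = Indec-map σ im sur arc ind
    where
    σ : V → V
    σ v with v ≟ z
    ... | yes _ = y
    ... | no _ = v
    σz : σ z ≡ y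
    σz with z ≟ z
    ... | yes _ = refl
    ... | no n = ⊥-elim (n refl)
    σW : ∀ {v} → W v → σ v ≡ v
    σW {v} Wv with v ≟ z
    ... | yes refl = ⊥-elim (¬Wz Wv)
    ... | no _ = refl
    im : ∀ {a} → (W ⊹ z) a → (W ⊹ y) (σ a)
    im (inj₁ Wa) = inj₁ (subst W (sym (σW Wa)) Wa)
    im (inj₂ refl) = inj₂ σz
    sur : ∀ {b} → (W ⊹ y) b → Σ V λ a → (W ⊹ z) a × σ a ≡ b
    sur {b} (inj₁ Wb) = b , inj₁ Wb , σW Wb
    sur (inj₂ refl) = z , inj₂ refl , σz
    arc : ∀ {a b} → (W ⊹ z) a → (W ⊹ z) b → T (σ a) (σ b) ≡ T a b
    arc (inj₁ Wa) (inj₁ Wb) rewrite σW Wa | σW Wb = refl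
    arc (inj₁ Wa) (inj₂ refl) rewrite σW Wa | σz =
      flip (λ { refl → ¬Wy Wa }) (λ { refl → ¬Wz Wa }) (tw Wa)
    arc (inj₂ refl) (inj₁ Wb) rewrite σW Wb | σz = tw Wb
    arc (inj₂ refl) (inj₂ refl) rewrite σz = trans (irr y) (sym (irr z))

  -- Each vertex of a 3-cycle separates the other two; `β` is the direction of traversal.
  triangle : ∀ {β a u z} → u ≢ a → z ≢ a → u ≢ z → T u a ≡ β → T a z ≡ β → T z u ≡ β →
    Indec T ((λ v → v ≡ a) ⊹ u ⊹ z)
  triangle {β} {a} {u} {z} u≢a z≢a u≢z ua az zu I iv {p} {q} {r} p≢q Xp Xq Xr Ip Iq Ir = go Xp Xq Xr
    where
    X : V → Set
    X = (λ v → v ≡ a) ⊹ u ⊹ z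
    sep : ∀ {p q r} → X p → X q → X r → I p ≡ true → I q ≡ true → I r ≡ false → T p r ≡ β → T r q ≡ β → q ≢ r → ⊥
    sep Xp Xq Xr Ip Iq Ir e e' n = b≢notb (trans (sym e) (trans (iv Xp Xq Xr Ip Iq Ir) (opp (≢-sym n) e')))
    go : X p → X q → X r → ⊥
    go (inj₁ (inj₁ refl)) (inj₁ (inj₁ refl)) _ = p≢q refl
    go (inj₁ (inj₂ refl)) (inj₁ (inj₂ refl)) _ = p≢q refl
    go (inj₂ refl) (inj₂ refl) _ = p≢q refl
    go (inj₁ (inj₁ refl)) _ (inj₁ (inj₁ refl)) = clash Ip Ir
    go (inj₁ (inj₂ refl)) _ (inj₁ (inj₂ refl)) = clash Ip Ir
    go (inj₂ refl) _ (inj₂ refl) = clash Ip Ir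
    go _ (inj₁ (inj₁ refl)) (inj₁ (inj₁ refl)) = clash Iq Ir
    go _ (inj₁ (inj₂ refl)) (inj₁ (inj₂ refl)) = clash Iq Ir
    go _ (inj₂ refl) (inj₂ refl) = clash Iq Ir
    go (inj₁ (inj₁ refl)) (inj₁ (inj₂ refl)) (inj₂ refl) = sep Xp Xq Xr Ip Iq Ir az zu u≢z
    go (inj₁ (inj₂ refl)) (inj₁ (inj₁ refl)) (inj₂ refl) = sep Xq Xp Xr Iq Ip Ir az zu u≢z
    go (inj₁ (inj₁ refl)) (inj₂ refl) (inj₁ (inj₂ refl)) = sep Xq Xp Xr Iq Ip Ir zu ua (≢-sym u≢a)
    go (inj₂ refl) (inj₁ (inj₁ refl)) (inj₁ (inj₂ refl)) = sep Xp Xq Xr Ip Iq Ir zu ua (≢-sym u≢a)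
    go (inj₁ (inj₂ refl)) (inj₂ refl) (inj₁ (inj₁ refl)) = sep Xp Xq Xr Ip Iq Ir ua az z≢a
    go (inj₂ refl) (inj₁ (inj₂ refl)) (inj₁ (inj₁ refl)) = sep Xq Xp Xr Iq Ip Ir ua az z≢a

-- Counting, parity and elementary facts on Booleans and numbers.

count : ∀ {n} {P : Fin n → Set} → (∀ x → Dec (P x)) → ℕ
count {zero} P? = 0
count {suc n} P? with P? zero
... | yes _ = suc (count (λ x → P? (suc x)))
... | no _ = count (λ x → P? (suc x))

count-cong : ∀ {n} {P Q : Fin n → Set} (P? : ∀ x → Dec (P x)) (Q? : ∀ x → Dec (Q x)) →
  (∀ {x} → P x → Q x) → (∀ {x} → Q x → P x) → count P? ≡ count Q?
count-cong {zero} P? Q? f g = refl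
count-cong {suc n} P? Q? f g with P? zero | Q? zero
... | yes _ | yes _ = cong suc (count-cong (λ x → P? (suc x)) (λ x → Q? (suc x)) f g)
... | yes p | no ¬q = ⊥-elim (¬q (f p))
... | no ¬p | yes q = ⊥-elim (¬p (g q))
... | no _ | no _ = count-cong (λ x → P? (suc x)) (λ x → Q? (suc x)) f g

count-remove : ∀ {n} {P Q : Fin n → Set} (P? : ∀ x → Dec (P x)) (Q? : ∀ x → Dec (Q x)) y → P y →
  (∀ {x} → Q x → P x × x ≢ y) → (∀ {x} → P x → x ≢ y → Q x) → count P? ≡ suc (count Q?)
count-remove {suc n} P? Q? zero Py f g with P? zero | Q? zero
... | no ¬p | _ = ⊥-elim (¬p Py)
... | yes _ | yes q = ⊥-elim (proj₂ (f q) refl)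
... | yes _ | no _ = cong suc (count-cong (λ x → P? (suc x)) (λ x → Q? (suc x)) (λ p → g p (λ ())) (λ q → proj₁ (f q)))
count-remove {suc n} P? Q? (suc y) Py f g with P? zero | Q? zero
  | count-remove (λ x → P? (suc x)) (λ x → Q? (suc x)) y Py
      (λ q → proj₁ (f q) , λ e → proj₂ (f q) (cong suc e)) (λ p n → g p (λ e → n (Fin.suc-injective e)))
... | yes p | yes q | e = cong suc e
... | yes p | no ¬q | e = ⊥-elim (¬q (g p (λ ())))
... | no ¬p | yes q | e = ⊥-elim (¬p (proj₁ (f q)))
... | no _ | no _ | e = e

count-witness : ∀ {n k} {P : Fin n → Set} (P? : ∀ x → Dec (P x)) → count P? ≡ suc k → ∃ P
count-witness {suc n} P? e with P? zero
... | yes p = zero , p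
... | no _ with count-witness (λ x → P? (suc x)) e
...   | x , p = suc x , p

count-none : ∀ {n} {P : Fin n → Set} (P? : ∀ x → Dec (P x)) → count P? ≡ 0 → ∀ x → ¬ P x
count-none P? e x p with count-remove P? (λ z → P? z ×-dec ¬? (Fin._≟_ z x)) x p (λ q → q) _,_
... | e' with trans (sym e) e'
...   | ()

data Even : ℕ → Set where
  even-zero : Even 0
  even-step : ∀ {n} → Even n → Even (suc (suc n))

even-suc⊥ : ∀ {n} → Even n → ¬ Even (suc n)
even-suc⊥ (even-step e) (even-step e') = even-suc⊥ e e'

All : {V : Set} → V → Set
All _ = ⊤

ev : ℕ → Bool
ev zero = true
ev (suc zero) = false
ev (suc (suc n)) = ev n

ev-suc : ∀ n → ev (suc n) ≡ not (ev n)
ev-suc zero = refl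
ev-suc (suc zero) = refl
ev-suc (suc (suc n)) = ev-suc n

dbl : ℕ → ℕ
dbl zero = zero
dbl (suc d) = suc (suc (dbl d))

ev-dbl+ : ∀ d i → ev (dbl d + i) ≡ ev i
ev-dbl+ zero i = refl
ev-dbl+ (suc d) i = ev-dbl+ d i

data Gap (i : ℕ) : ℕ → Set where
  odd-gap  : ∀ d → Gap i (suc (dbl d + i))
  even-gap : ∀ d → Gap i (suc (suc (dbl d + i)))

gap : ∀ {i j} → i < j → Gap i j
gap {i} {suc j} i<j with m≤n⇒m<n∨m≡n (≤-pred i<j)
... | inj₂ refl = odd-gap 0
... | inj₁ i<j' with gap i<j'
... | odd-gap d = even-gap d
... | even-gap d = odd-gap (suc d)

∸-pred : ∀ {i n} → i < n → n ∸ i ≡ suc (n ∸ suc i)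
∸-pred {zero} {suc n} _ = refl
∸-pred {suc i} {suc n} (s≤s lt) = ∸-pred lt

infixr 5 _◂_
_◂_ : {V : Set} → V → (ℕ → V) → ℕ → V
(v ◂ f) zero = v
(v ◂ f) (suc i) = f i

≡b∨≡not : ∀ a b → a ≡ b ⊎ a ≡ not b
≡b∨≡not true true = inj₁ refl
≡b∨≡not true false = inj₂ refl
≡b∨≡not false true = inj₂ refl
≡b∨≡not false false = inj₁ refl

if-same : ∀ {A : Set} b {x y : A} {z : A} → x ≡ z → y ≡ z → (if b then x else y) ≡ z
if-same true p _ = p
if-same false _ q = q

ev-not : ∀ n → ev n ≡ not (ev (suc n))
ev-not n = trans (sym (not-involutive (ev n))) (cong not (sym (ev-suc n)))

<ᵇ-true : ∀ {i j} → i < j → (i <ᵇ j) ≡ true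
<ᵇ-true {zero} {suc j} _ = refl
<ᵇ-true {suc i} {suc j} (s≤s lt) = <ᵇ-true lt

<ᵇ-false : ∀ {i j} → j ≤ i → (i <ᵇ j) ≡ false
<ᵇ-false {zero} {zero} _ = refl
<ᵇ-false {suc i} {zero} _ = refl
<ᵇ-false {suc i} {suc j} (s≤s le) = <ᵇ-false le

≡ᵇ-refl : ∀ i → (i ≡ᵇ i) ≡ true
≡ᵇ-refl zero = refl
≡ᵇ-refl (suc i) = ≡ᵇ-refl i

≡ᵇ-false : ∀ {i j} → i ≢ j → (i ≡ᵇ j) ≡ false
≡ᵇ-false {zero} {zero} n = ⊥-elim (n refl)
≡ᵇ-false {zero} {suc j} n = refl
≡ᵇ-false {suc i} {zero} n = refl
≡ᵇ-false {suc i} {suc j} n = ≡ᵇ-false (λ e → n (cong suc e))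

-- The listed tournaments

-- The vertices of the two sides of the paper's tournaments, numbered from the middle vertex outwards,
-- except that in the V-shaped sides the number 0 is given to the exceptional vertex
-- (2k in V_{2k+1}, and 2n in the Q-part of G and H).
data Node : Set where
  inP : ℕ → Node
  mid : Node
  inQ : ℕ → Node

-- Sides ordered linearly, like U_{2k+1}, or like V_{2k+1}.
data Shape : Set where
  O U V : Shape

-- Written for `P`, where number `i` carries the label `2k − i`: parities are kept because `2k` is
-- even, and the order is reversed, hence `j <ᵇ i`.
sideArc : Shape → ℕ → ℕ → Bool
sideArc O i j = j <ᵇ i
sideArc U i j = if j <ᵇ i then not (ev i ∧ ev j) else ev i ∧ ev j
sideArc V zero j = ev j
sideArc V (suc i) zero = not (ev (suc i))
sideArc V (suc i) (suc j) = j <ᵇ i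

special : Shape → ℕ → Bool
special O i = ev i
special U i = ev i
special V i = i ≡ᵇ 0

loopless : (ℕ → ℕ → Bool) → ℕ → ℕ → Bool
loopless r i j = if i ≡ᵇ j then false else r i j

-- On `Q` the labels increase with the numbers, so `sideArc` is transposed there. This makes the
-- exchange of the two sides a duality, see `swap-arc`.
nodeArc : Shape → Shape → Node → Node → Bool
nodeArc τ σ (inP i) (inP j) = loopless (sideArc τ) i j
nodeArc τ σ (inP i) mid     = true
nodeArc τ σ (inP i) (inQ j) = not (special τ i ∧ special σ j)
nodeArc τ σ mid     (inP j) = false
nodeArc τ σ mid     mid     = false
nodeArc τ σ mid     (inQ j) = true
nodeArc τ σ (inQ i) (inP j) = special τ j ∧ special σ i
nodeArc τ σ (inQ i) mid     = false
nodeArc τ σ (inQ i) (inQ j) = loopless (λ i j → sideArc σ j i) i j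

loopless-irr : ∀ r i → loopless r i i ≡ false
loopless-irr r i rewrite ≡ᵇ-refl i = refl

loopless-≢ : ∀ r {i j} → i ≢ j → loopless r i j ≡ r i j
loopless-≢ r n rewrite ≡ᵇ-false n = refl

sideArc-anti : ∀ τ {i j} → i ≢ j → sideArc τ j i ≡ not (sideArc τ i j)
sideArc-anti O {i} {j} n with <-cmp i j
... | tri< lt _ _ rewrite <ᵇ-true lt | <ᵇ-false (≤-trans (n≤1+n i) lt) = refl
... | tri≈ _ e _ = ⊥-elim (n e)
... | tri> _ _ lt rewrite <ᵇ-true lt | <ᵇ-false (≤-trans (n≤1+n j) lt) = refl
sideArc-anti U {i} {j} n with <-cmp i j
... | tri< lt _ _ rewrite <ᵇ-true lt | <ᵇ-false (≤-trans (n≤1+n i) lt) = cong not (∧-comm (ev j) (ev i))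
... | tri≈ _ e _ = ⊥-elim (n e)
... | tri> _ _ lt rewrite <ᵇ-true lt | <ᵇ-false (≤-trans (n≤1+n j) lt) = trans (∧-comm (ev j) (ev i)) (sym (not-involutive _))
sideArc-anti V {zero} {zero} n = ⊥-elim (n refl)
sideArc-anti V {zero} {suc j} n = refl
sideArc-anti V {suc i} {zero} n = sym (not-involutive (ev (suc i)))
sideArc-anti V {suc i} {suc j} n = sideArc-anti O (λ e → n (cong suc e))

node-tour : ∀ τ σ → Tour (nodeArc τ σ)
node-tour τ σ = record { _≟_ = _≟ᴺ_ ; irr = irr ; anti = anti }
  where
  _≟ᴺ_ : (x y : Node) → Dec (x ≡ y)
  inP i ≟ᴺ inP j = map′ (cong inP) (λ { refl → refl }) (i ≟ⁿ j)
  inP i ≟ᴺ mid = no λ ()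
  inP i ≟ᴺ inQ j = no λ ()
  mid ≟ᴺ inP j = no λ ()
  mid ≟ᴺ mid = yes refl
  mid ≟ᴺ inQ j = no λ ()
  inQ i ≟ᴺ inP j = no λ ()
  inQ i ≟ᴺ mid = no λ ()
  inQ i ≟ᴺ inQ j = map′ (cong inQ) (λ { refl → refl }) (i ≟ⁿ j)
  irr : ∀ x → nodeArc τ σ x x ≡ false
  irr (inP i) = loopless-irr (sideArc τ) i
  irr mid = refl
  irr (inQ i) = loopless-irr (λ i j → sideArc σ j i) i
  anti : ∀ {x y} → x ≢ y → nodeArc τ σ y x ≡ not (nodeArc τ σ x y)
  anti {inP i} {inP j} n = trans (loopless-≢ (sideArc τ) (λ e → n (cong inP (sym e))))
    (trans (sideArc-anti τ (λ e → n (cong inP e))) (cong not (sym (loopless-≢ (sideArc τ) (λ e → n (cong inP e))))))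
  anti {inP i} {mid} n = refl
  anti {inP i} {inQ j} n = sym (not-involutive _)
  anti {mid} {inP j} n = refl
  anti {mid} {mid} n = ⊥-elim (n refl)
  anti {mid} {inQ j} n = refl
  anti {inQ i} {inP j} n = refl
  anti {inQ i} {mid} n = refl
  anti {inQ i} {inQ j} n = trans (loopless-≢ (λ i j → sideArc σ j i) (λ e → n (cong inQ (sym e))))
    (trans (sideArc-anti σ (λ e → n (cong inQ (sym e)))) (cong not (sym (loopless-≢ (λ i j → sideArc σ j i) (λ e → n (cong inQ e))))))

-- `K` is `⊤` or `⊥` and keeps or removes the middle vertex, so that `T` and `T − c` can go through
-- the same induction.
Region : Set → ℕ → ℕ → Node → Set
Region K p q (inP i) = i ≤ p
Region K p q mid     = K
Region K p q (inQ j) = j ≤ q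

-- In effect an isomorphism: `h` is injective on the region because of `arcs`, see `h-injective`.
-- The bounds `dbl (suc k)` and `dbl (suc k')` give each side an odd number of vertices, at least
-- three.
record Model {m : ℕ} (T : Fin m → Fin m → Bool) (τ σ : Shape) (k k' : ℕ) (c : Fin m) : Set where
  field
    h     : Node → Fin m
    h-mid : h mid ≡ c
    arcs  : ∀ {x y} → Region ⊤ (dbl (suc k)) (dbl (suc k')) x → Region ⊤ (dbl (suc k)) (dbl (suc k')) y →
            T (h x) (h y) ≡ nodeArc τ σ x y
    cover : ∀ v → ∃ λ x → Region ⊤ (dbl (suc k)) (dbl (suc k')) x × h x ≡ v

-- The sign of an arm is the only difference between a tournament and its dual, so the two are treated together.
orient : {V : Set} → Bool → (V → V → Bool) → V → V → Bool
orient true T = T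
orient false T x y = T y x

-- The value in `T` of an arc between distinct vertices whose value in `orient b T` is `a` is
-- `sgn b a`.
sgn : Bool → Bool → Bool
sgn b true = b
sgn b false = not b

orient-tour : {V : Set} {T : V → V → Bool} (b : Bool) → Tour T → Tour (orient b T)
orient-tour true t = t
orient-tour false t = record { _≟_ = Tour._≟_ t ; irr = Tour.irr t ; anti = λ n → Tour.anti t (≢-sym n) }

orient-sgn : {V : Set} {T : V → V → Bool} → Tour T → ∀ b a {u v} → u ≢ v → T u v ≡ sgn b a → orient b T u v ≡ a
orient-sgn t true true n e = e
orient-sgn t true false n e = e
orient-sgn t false true n e = trans (Tour.anti t n) (cong not e)
orient-sgn t false false n e = trans (Tour.anti t n) (cong not e)

module _ {m : ℕ} {T : Fin m → Fin m → Bool} (tour : Tour T) (b : Bool) (τ σ : Shape) {c : Fin m} (k k' : ℕ)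
  (hP hQ : ℕ → Fin m)
  (PP : ∀ {i j} → j < i → i ≤ dbl (suc k) → hP i ≢ hP j × T (hP j) (hP i) ≡ sgn (not b) (sideArc τ i j))
  (QQ : ∀ {i j} → j < i → i ≤ dbl (suc k') → hQ i ≢ hQ j × T (hQ j) (hQ i) ≡ sgn b (sideArc σ i j))
  (Pc : ∀ {i} → i ≤ dbl (suc k) → hP i ≢ c × T (hP i) c ≡ b)
  (cQ : ∀ {j} → j ≤ dbl (suc k') → hQ j ≢ c × T c (hQ j) ≡ b)
  (PQ : ∀ {i j} → i ≤ dbl (suc k) → j ≤ dbl (suc k') → hP i ≢ hQ j × T (hP i) (hQ j) ≡ sgn b (not (special τ i ∧ special σ j)))
  (cov : ∀ v → v ≢ c → (∃ λ i → i ≤ dbl (suc k) × hP i ≡ v) ⊎ (∃ λ j → j ≤ dbl (suc k') × hQ j ≡ v))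
  where

  private
    R = orient b T
    tourR : Tour R
    tourR = orient-tour b tour
    open Tour tourR
    h : Node → Fin m
    h (inP i) = hP i
    h mid = c
    h (inQ j) = hQ j

    sgn-opp : ∀ b a → not (sgn (not b) a) ≡ sgn b a
    sgn-opp b true = not-involutive b
    sgn-opp b false = cong not (not-involutive b)

    PP′ : ∀ {i j} → j < i → i ≤ dbl (suc k) → R (hP i) (hP j) ≡ sideArc τ i j
    PP′ {i} {j} lt le with PP lt le
    ... | n , e = orient-sgn tour b _ n (trans (Tour.anti tour (≢-sym n)) (trans (cong not e) (sgn-opp b (sideArc τ i j))))

    ar : ∀ {x y} → Region ⊤ (dbl (suc k)) (dbl (suc k')) x → Region ⊤ (dbl (suc k)) (dbl (suc k')) y →
            R (h x) (h y) ≡ nodeArc τ σ x y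
    ar {inP i} {inP j} vi vj with <-cmp i j
    ... | tri≈ _ refl _ = trans (irr _) (sym (loopless-irr (sideArc τ) i))
    ... | tri> _ n lt = trans (PP′ lt vi) (sym (loopless-≢ (sideArc τ) n))
    ... | tri< lt n _ = trans (anti (proj₁ (PP lt vj))) (trans (cong not (PP′ lt vj))
            (trans (sym (sideArc-anti τ (≢-sym n))) (sym (loopless-≢ (sideArc τ) n))))
    ar {inP i} {mid} vi _ = orient-sgn tour b true (proj₁ (Pc vi)) (proj₂ (Pc vi))
    ar {inP i} {inQ j} vi vj = orient-sgn tour b _ (proj₁ (PQ vi vj)) (proj₂ (PQ vi vj))
    ar {mid} {inP j} _ vj = trans (anti (proj₁ (Pc vj))) (cong not (orient-sgn tour b true (proj₁ (Pc vj)) (proj₂ (Pc vj))))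
    ar {mid} {mid} _ _ = irr c
    ar {mid} {inQ j} _ vj = orient-sgn tour b true (≢-sym (proj₁ (cQ vj))) (proj₂ (cQ vj))
    ar {inQ i} {inP j} vi vj = trans (anti (proj₁ (PQ vj vi)))
      (trans (cong not (orient-sgn tour b _ (proj₁ (PQ vj vi)) (proj₂ (PQ vj vi)))) (not-involutive _))
    ar {inQ i} {mid} vi _ = trans (anti (≢-sym (proj₁ (cQ vi)))) (cong not (orient-sgn tour b true (≢-sym (proj₁ (cQ vi))) (proj₂ (cQ vi))))
    ar {inQ i} {inQ j} vi vj with <-cmp i j
    ... | tri≈ _ refl _ = trans (irr _) (sym (loopless-irr (λ i j → sideArc σ j i) i))
    ... | tri< lt n _ = trans (orient-sgn tour b _ (≢-sym (proj₁ (QQ lt vj))) (proj₂ (QQ lt vj))) (sym (loopless-≢ (λ i j → sideArc σ j i) n))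
    ... | tri> _ n lt = trans (anti (≢-sym (proj₁ (QQ lt vi)))) (trans (cong not (orient-sgn tour b _ (≢-sym (proj₁ (QQ lt vi))) (proj₂ (QQ lt vi))))
            (trans (sym (sideArc-anti σ n)) (sym (loopless-≢ (λ i j → sideArc σ j i) n))))

    co : ∀ v → ∃ λ x → Region ⊤ (dbl (suc k)) (dbl (suc k')) x × h x ≡ v
    co v with Tour._≟_ tour v c
    ... | yes e = mid , tt , sym e
    ... | no n with cov v n
    ...   | inj₁ (i , le , e) = inP i , le , e
    ...   | inj₂ (j , le , e) = inQ j , le , e

  mk-model : Model R τ σ k k' c
  mk-model = record { h = h ; h-mid = refl ; arcs = λ {x} {y} → ar {x} {y} ; cover = co }

ev-true⇒dbl : ∀ n → ev n ≡ true → ∃ λ k → n ≡ dbl k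
ev-true⇒dbl zero _ = 0 , refl
ev-true⇒dbl (suc (suc n)) e with ev-true⇒dbl n e
... | k , refl = suc k , refl

flat : Bool → Shape
flat true = O
flat false = U

special-flat : ∀ t i → special (flat t) i ≡ ev i
special-flat true i = refl
special-flat false i = refl

suc≡dbl : ∀ n → ev (suc n) ≡ true → ∃ λ k → suc n ≡ dbl (suc k)
suc≡dbl n e with ev-true⇒dbl (suc n) e
... | suc k , eq = k , eq

sucsuc≡dbl : ∀ n → ev (suc n) ≡ false → ∃ λ k → suc (suc n) ≡ dbl (suc k)
sucsuc≡dbl n e with ev-true⇒dbl n (trans (ev-not n) (cong not e))
... | k , eq = k , cong (λ n → suc (suc n)) eq

ev-suc-true : ∀ {i} → ev i ≡ false → ev (suc i) ≡ true
ev-suc-true {i} e = trans (ev-suc i) (cong not e)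

ev-suc-false : ∀ {i} → ev i ≡ true → ev (suc i) ≡ false
ev-suc-false {i} e = trans (ev-suc i) (cong not e)

SomeModel : ∀ {m} → (Fin m → Fin m → Bool) → Shape → Shape → Fin m → Set
SomeModel T τ σ c = ∃₂ λ k k' → Model T τ σ k k' c

-- Only the mixed pairs carry an orientation: for two sides of the same shape, passing to the dual
-- merely interchanges `k` and `k'`.
Fits : ∀ {m} → (Fin m → Fin m → Bool) → Fin m → Set
Fits T c = SomeModel T O O c ⊎ (SomeModel T V V c ⊎
  ∃ λ b → SomeModel (orient b T) U O c ⊎ SomeModel (orient b T) U V c)

-- The structure of (-1)-critical tournaments

record MinusOne {m : ℕ} (T : Fin m → Fin m → Bool) (c : Fin m) : Set where
  field
    tour : Tour T
    5≤m  : 5 ≤ m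
    indT : Indec T All
    indc : Indec T (_≢ c)
    crit : ∀ {x} → x ≢ c → ¬ Indec T (_≢ x)

module Critical-structure {m : ℕ} {T : Fin m → Fin m → Bool} {c : Fin m} (H : MinusOne T c) where
  open MinusOne H
  open Tour tour
  open Core tour

  -- Deciding kinds, and extension of indecomposable sets by pairs.

  _∪?_ : ∀ {Y : Fin m → Set} → (∀ v → Dec (Y v)) → ∀ x → ∀ v → Dec ((Y ⊹ x) v)
  (Y? ∪? x) v = Y? v ⊎-dec (v ≟ x)

  has? : ∀ {Y} → (∀ v → Dec (Y v)) → ∀ v t → Dec (Has Y v t)
  has? Y? v global = map′ (λ h {y} {y'} → h y y') (λ h y y' → h {y} {y'})
    (all? λ y → all? λ y' → Y? y →-dec (Y? y' →-dec (T v y ≟ᵇ T v y')))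
  has? Y? v (twin u) = Y? u ×-dec map′ (λ h {y} → h y) (λ h y → h {y})
    (all? λ y → Y? y →-dec ((¬? (y ≟ u)) →-dec (T v y ≟ᵇ T u y)))

  anyKind? : {P : Kind (Fin m) → Set} → (∀ t → Dec (P t)) → Dec (∃ P)
  anyKind? P? with P? global | any? (λ u → P? (twin u))
  ... | yes p | _ = yes (global , p)
  ... | no _ | yes (u , p) = yes (twin u , p)
  ... | no n | no n' = no λ { (global , p) → n p ; (twin u , p) → n' (u , p) }

  _≟ᵏ_ : (t t' : Kind (Fin m)) → Dec (t ≡ t')
  global ≟ᵏ global = yes refl
  global ≟ᵏ twin _ = no λ ()
  twin _ ≟ᵏ global = no λ ()
  twin u ≟ᵏ twin v = map′ (cong twin) twin-injective (u ≟ v)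

  module _ {Y : Fin m → Set} (Y? : ∀ v → Dec (Y v)) (ind : Indec T Y) (t3 : Three Y) where
    open Over ind t3

    private
      Grows : Fin m → Fin m → Set
      Grows v w = ¬ Y v × ¬ Y w × v ≢ w ×
        ((∃ λ t → Has Y v t × ¬ Has Y w t × ¬ Has (Y ⊹ w) v t) ⊎
         (¬ (∃ (Has Y v)) × ¬ (∃ (Has Y w)) × ¬ (∀ y → Y y → T v y ≡ T w y)))

      grows? : ∀ v w → Dec (Grows v w)
      grows? v w = ¬? (Y? v) ×-dec ¬? (Y? w) ×-dec ¬? (v ≟ w) ×-dec
        (anyKind? (λ t → has? Y? v t ×-dec ¬? (has? Y? w t) ×-dec ¬? (has? (Y? ∪? w) v t))
         ⊎-dec (¬? (anyKind? (has? Y? v)) ×-dec ¬? (anyKind? (has? Y? w)) ×-dec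
                ¬? (all? λ y → Y? y →-dec (T v y ≟ᵇ T w y))))

      use : ∀ {v w} → Grows v w → Indec T (Y ⊹ v ⊹ w)
      use (¬Yv , ¬Yw , v≢w , inj₁ (t , h , nh , nh')) = grow ¬Yv ¬Yw v≢w t h nh nh'
      use (¬Yv , ¬Yw , v≢w , inj₂ (nv , nw , nt)) =
        grow-untyped ¬Yv ¬Yw v≢w (λ t h → nv (t , h)) (λ t h → nw (t , h)) (λ tw → nt (λ y → tw))

    -- Ehrenfeucht and Rozenberg.  If no pair extends Y, the outside vertices of one kind (together with u
    -- for twins of u) form an interval of T, or the complement of one.
    extend : Indec T All → ∀ {v w} → ¬ Y v → ¬ Y w → v ≢ w →
      ∃₂ λ x y → ¬ Y x × ¬ Y y × x ≢ y × Indec T (Y ⊹ x ⊹ y)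
    extend indT {v₀} {w₀} ¬Yv₀ ¬Yw₀ v₀≢w₀ with any? (λ v → any? (grows? v))
    ... | yes (v , w , g@(¬Yv , ¬Yw , n , _)) = v , w , ¬Yv , ¬Yw , n , use g
    ... | no none = ⊥-elim contra
      where
      open Three t3 renaming (a to y₁)
      -- Since `grow` must fail for `v` and `x`, a vertex keeps its kind when a vertex not of that
      -- kind joins `Y`.
      default : ∀ {v x} t → ¬ Y v → ¬ Y x → v ≢ x → Has Y v t → ¬ Has Y x t → Has (Y ⊹ x) v t
      default {v} {x} t ¬Yv ¬Yx n h nh with has? (Y? ∪? x) v t
      ... | yes h' = h'
      ... | no nh' = ⊥-elim (none (v , x , ¬Yv , ¬Yx , n , inj₁ (t , h , nh , nh')))

      typed⊥ : ∀ {v} t → ¬ Y v → Has Y v t → ⊥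
      typed⊥ {v} global ¬Yv hv with others t3 v
      ... | p , q , Yp , Yq , p≢q , _ , _ =
        nontrivial⊥ indT P (λ z → ¬? (¬? (Y? z) ×-dec has? Y? z global)) (λ {a} {b} {x} _ _ _ → iv {a} {b} {x})
          p≢q tt tt tt (λ n → proj₁ n Yp) (λ n → proj₁ n Yq) (λ n → n (¬Yv , hv))
        where
        P : Fin m → Set
        P z = ¬ (¬ Y z × Has Y z global)
        eq : ∀ {a x} → P a → ¬ Y x → Has Y x global → a ≢ x × T x a ≡ T x y₁
        eq {a} {x} Pa ¬Yx hx with Y? a
        ... | yes Ya = (λ { refl → ¬Yx Ya }) , hx Ya (Three.Ya t3)
        ... | no ¬Ya = a≢x , default global ¬Yx ¬Ya (≢-sym a≢x) hx (λ ha → Pa (¬Ya , ha)) (inj₂ refl) (inj₁ (Three.Ya t3))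
          where
          a≢x : a ≢ x
          a≢x refl = Pa (¬Ya , hx)
        iv : ∀ {a b x} → P a → P b → ¬ P x → T a x ≡ T b x
        iv {a} {b} {x} Pa Pb nPx with Y? x | has? Y? x global
        ... | yes Yx | _ = ⊥-elim (nPx (λ n → proj₁ n Yx))
        ... | no _ | no n = ⊥-elim (nPx (λ n' → n (proj₂ n')))
        ... | no ¬Yx | yes hx with eq Pa ¬Yx hx | eq Pb ¬Yx hx
        ...   | a≢x , e | b≢x , e' = unflip a≢x b≢x (trans e (sym e'))
      typed⊥ {v} (twin u) ¬Yv hv@(Yu , _) with others t3 u
      ... | r , _ , Yr , _ , _ , r≢u , _ =
        nontrivial⊥ indT P (λ z → (z ≟ u) ⊎-dec (¬? (Y? z) ×-dec has? Y? z (twin u)))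
          (λ _ _ _ Pa Pb nPx → trans (eq Pa nPx) (sym (eq Pb nPx)))
          (λ { refl → ¬Yv Yu }) tt tt tt (inj₁ refl) (inj₂ (¬Yv , hv))
          λ { (inj₁ e) → r≢u e ; (inj₂ n) → proj₁ n Yr }
        where
        P : Fin m → Set
        P z = z ≡ u ⊎ (¬ Y z × Has Y z (twin u))
        eq : ∀ {a x} → P a → ¬ P x → T a x ≡ T u x
        eq (inj₁ refl) _ = refl
        eq {a} {x} (inj₂ (¬Ya , ha)) nPx with Y? x
        ... | yes Yx = proj₂ ha Yx (λ e → nPx (inj₁ e))
        ... | no ¬Yx = proj₂ (default (twin u) ¬Ya ¬Yx (λ { refl → nPx (inj₂ (¬Ya , ha)) }) ha (λ hx → nPx (inj₂ (¬Yx , hx))))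
                         (inj₂ refl) (λ e → nPx (inj₁ e))

      contra : ⊥
      contra with any? (λ v → ¬? (Y? v) ×-dec anyKind? (has? Y? v))
      ... | yes (v , ¬Yv , t , h) = typed⊥ t ¬Yv h
      -- All outside vertices are untyped, and `grow-untyped` must fail for any two of them. So they
      -- are alike over `Y`, and the complement of `Y` is an interval.
      ... | no untyped = nontrivial⊥ indT (λ z → ¬ Y z) (λ z → ¬? (Y? z)) iv v₀≢w₀ tt tt tt ¬Yv₀ ¬Yw₀ (λ n → n (Three.Ya t3))
        where
        iv : ∀ {a b x} → ⊤ → ⊤ → ⊤ → ¬ Y a → ¬ Y b → ¬ ¬ Y x → T a x ≡ T b x
        iv {a} {b} {x} _ _ _ ¬Ya ¬Yb nnYx with a ≟ b | Y? x
        ... | yes refl | _ = refl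
        ... | no _ | no ¬Yx = ⊥-elim (nnYx ¬Yx)
        ... | no a≢b | yes Yx with all? (λ y → Y? y →-dec (T a y ≟ᵇ T b y))
        ...   | yes tw = tw x Yx
        ...   | no ntw = ⊥-elim (none (a , b , ¬Ya , ¬Yb , a≢b ,
                  inj₂ ((λ h → untyped (a , ¬Ya , h)) , (λ h → untyped (b , ¬Yb , h)) , ntw)))

  -- Parity of the number of vertices outside an indecomposable set.

  private
    missing : ∀ {Y : Fin m → Set} → (∀ v → Dec (Y v)) → ℕ
    missing Y? = count (λ v → ¬? (Y? v))

    missing-suc : ∀ {Y : Fin m → Set} (Y? : ∀ v → Dec (Y v)) {x} → ¬ Y x → missing Y? ≡ suc (missing (Y? ∪? x))
    missing-suc Y? {x} ¬Yx = count-remove (λ z → ¬? (Y? z)) (λ z → ¬? ((Y? ∪? x) z)) x ¬Yx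
      (λ n → (λ y → n (inj₁ y)) , (λ e → n (inj₂ e))) (λ { ny nx (inj₁ y) → ny y ; ny nx (inj₂ e) → nx e })

    missing-suc₂ : ∀ {Y : Fin m → Set} (Y? : ∀ v → Dec (Y v)) {x y} → ¬ Y x → ¬ Y y → x ≢ y →
      missing Y? ≡ suc (suc (missing ((Y? ∪? x) ∪? y)))
    missing-suc₂ Y? {x} ¬Yx ¬Yy x≢y = trans (missing-suc Y? ¬Yx)
      (cong suc (missing-suc (Y? ∪? x) λ { (inj₁ h) → ¬Yy h ; (inj₂ e) → x≢y (sym e) }))

    missing-last : ∀ {Y : Fin m → Set} (Y? : ∀ v → Dec (Y v)) {x} → ¬ Y x → missing Y? ≡ 1 → ∀ v → (Y ⊹ x) v
    missing-last Y? {x} ¬Yx e v with (Y? ∪? x) v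
    ... | yes h = h
    ... | no n = ⊥-elim (count-none (λ v → ¬? ((Y? ∪? x) v)) (suc-injective (trans (sym (missing-suc Y? ¬Yx)) e)) v n)

    -- Adding pairs by extend ends with all vertices or with all but one, and the second contradicts criticality.
    even-outside : ∀ n {Y} (Y? : ∀ v → Dec (Y v)) → Indec T Y → Three Y → Y c → missing Y? ≡ n → Even n
    even-outside zero _ _ _ _ _ = even-zero
    even-outside (suc n) {Y} Y? ind t3 Yc e with count-witness (λ v → ¬? (Y? v)) e
    even-outside (suc zero) {Y} Y? ind t3 Yc e | x , ¬Yx =
      ⊥-elim (crit (λ { refl → ¬Yx Yc }) (Indec-resp (λ { Yz refl → ¬Yx Yz }) rest ind))
      where
      rest : ∀ {z} → z ≢ x → Y z
      rest {z} z≢x with missing-last Y? ¬Yx e z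
      ... | inj₁ Yz = Yz
      ... | inj₂ e' = ⊥-elim (z≢x e')
    even-outside (suc (suc n)) {Y} Y? ind t3 Yc e | x , ¬Yx
      with count-witness (λ v → ¬? ((Y? ∪? x) v)) (suc-injective (trans (sym (missing-suc Y? ¬Yx)) e))
    ... | x' , n' with extend Y? ind t3 indT ¬Yx (λ Yx' → n' (inj₁ Yx')) (λ e → n' (inj₂ (sym e)))
    ... | v , w , ¬Yv , ¬Yw , v≢w , ind' =
      even-step (even-outside n ((Y? ∪? v) ∪? w) ind' (Three-mono (λ y → inj₁ (inj₁ y)) t3) (inj₁ (inj₁ Yc))
        (suc-injective (suc-injective (trans (sym (missing-suc₂ Y? ¬Yv ¬Yw v≢w)) e))))

  -- Both `Y` and `Y ⊹ v` would leave an even number of vertices outside.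
  no-extension : ∀ {Y v} → (∀ v → Dec (Y v)) → Indec T Y → Three Y → Y c → ¬ Y v → ¬ Indec T (Y ⊹ v)
  no-extension {Y} {v} Y? ind t3 Yc ¬Yv ind' =
    even-suc⊥ (even-outside _ (Y? ∪? v) ind' (Three-mono inj₁ t3) (inj₁ Yc) refl)
      (subst Even (missing-suc Y? ¬Yv) (even-outside _ Y? ind t3 Yc refl))

  -- An untyped vertex would extend `Y` by one vertex, against the parity.
  kind : ∀ {Y v} → (∀ v → Dec (Y v)) → Indec T Y → Three Y → Y c → ¬ Y v → ∃ (Has Y v)
  kind {Y} {v} Y? ind t3 Yc ¬Yv with anyKind? (has? Y? v)
  ... | yes h = h
  ... | no n = ⊥-elim (no-extension Y? ind t3 Yc ¬Yv (Over.untyped→Indec ind t3 ¬Yv (λ t h → n (t , h))))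

  -- Exchange of vertices between consecutive pairs.

  Has-merge : ∀ {Y X v w} t → Y c → X c → X w → Has Y v t → Has X v t → Has (Y ⊹ w) v t
  Has-merge global Yc Xc Xw h h' = λ
    { (inj₁ y) (inj₁ y') → h y y' ; (inj₁ y) (inj₂ refl) → trans (h y Yc) (h' Xc Xw)
    ; (inj₂ refl) (inj₁ y') → trans (h' Xw Xc) (h Yc y') ; (inj₂ refl) (inj₂ refl) → refl }
  Has-merge (twin u) Yc Xc Xw (Yu , h) (_ , h') = inj₁ Yu , λ { (inj₁ y) n → h y n ; (inj₂ refl) n → h' Xw n }

  Has-cong : ∀ {Y v w} t → (∀ {y} → Y y → T v y ≡ T w y) → Has Y v t → Has Y w t
  Has-cong global e h y y' = trans (sym (e y)) (trans (h y y') (e y'))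
  Has-cong (twin u) e (Yu , h) = Yu , λ y n → trans (sym (e y)) (h y n)

  -- A kind restricts to the smaller set unless the twin is one of the two added vertices.
  classify : ∀ {Y x y v} t → Has (Y ⊹ x ⊹ y) v t → t ≡ twin x ⊎ (t ≡ twin y ⊎ Has Y v t)
  classify global h = inj₂ (inj₂ λ y y' → h (inj₁ (inj₁ y)) (inj₁ (inj₁ y')))
  classify (twin u) (inj₁ (inj₁ Yu) , h) = inj₂ (inj₂ (Yu , λ y n → h (inj₁ (inj₁ y)) n))
  classify (twin u) (inj₁ (inj₂ refl) , h) = inj₁ refl
  classify (twin u) (inj₂ refl , h) = inj₂ (inj₁ refl)

  module _ {Y : Fin m → Set} (Y? : ∀ v → Dec (Y v)) (ind : Indec T Y) (t3 : Three Y) (Yc : Y c)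
    {x y : Fin m} (¬Yx : ¬ Y x) (¬Yy : ¬ Y y) (x≢y : x ≢ y) (ind₂ : Indec T (Y ⊹ x ⊹ y)) where
    open Over ind t3

    private
      Y₂ : Fin m → Set
      Y₂ = Y ⊹ x ⊹ y

      inY₂ : ∀ {z} → Y z → Y₂ z
      inY₂ Yz = inj₁ (inj₁ Yz)

      swap-last : ∀ {W : Fin m → Set} {p q z} → (W ⊹ p ⊹ q) z → (W ⊹ q ⊹ p) z
      swap-last (inj₁ (inj₁ w)) = inj₁ (inj₁ w)
      swap-last (inj₁ (inj₂ e)) = inj₂ e
      swap-last (inj₂ e) = inj₁ (inj₂ e)

      reorder : ∀ (W : Fin m → Set) p q → Indec T (W ⊹ p ⊹ q) → Indec T (W ⊹ q ⊹ p)
      reorder W p q = Indec-resp (swap-last {W}) (swap-last {W})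

    module _ {v w : Fin m} (¬v : ¬ Y₂ v) (¬w : ¬ Y₂ w) (v≢w : v ≢ w) (ind₄ : Indec T (Y₂ ⊹ v ⊹ w)) where

      private
        -- Kind `t` over both `Y₂` and a set with `c` and `w` would, by comparison at `c` or at the
        -- common twin, be kind `t` over `Y₂ ⊹ w`. Then `v` could not extend that set, against
        -- `ind₄`.
        ¬merge : ∀ {X} t → Has Y₂ v t → X c → X w → ¬ Has X v t
        ¬merge t h Xc Xw h' = typed→¬Indec (Three-mono (λ y → inj₁ (inY₂ y)) t3)
          (λ { (inj₁ z) → ¬v z ; (inj₂ e) → v≢w e }) t (Has-merge t (inY₂ Yc) Xc Xw h h')
          (reorder Y₂ v w ind₄)

        ¬same : ∀ t → Has Y₂ v t → ¬ Has Y₂ w t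
        ¬same t h h' = same-kind→¬Indec (Three-mono inY₂ t3) ¬v ¬w v≢w t h h' ind₄

      grow-default : ∀ t → Has Y₂ v t → Has Y v t → ¬ Has Y w t → Indec T (Y ⊹ v ⊹ w)
      grow-default t h₂ h nh = grow (λ e → ¬v (inY₂ e)) (λ e → ¬w (inY₂ e)) v≢w t h nh
        (¬merge t h₂ (inj₁ Yc) (inj₂ refl))

      grow-both : ∀ t t' → Has Y₂ v t → Has Y v t → Has Y₂ w t' → Has Y w t' → Indec T (Y ⊹ v ⊹ w)
      grow-both t t' h₂ h h₂' h' = grow-default t h₂ h λ hw → differ (kind-unique t' t h' hw)
        where
        differ : t' ≢ t
        differ refl = ¬same t h₂ h₂'

      -- If `w` had the kind `t` over `Y`, so would `y`, which looks like `w` from there. Put `w` in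
      -- place of `y` and consider the kind of `v` over the resulting `Y₃`. A kind inherited from
      -- `Y` is `t` and contradicts `ind₄`. A twin of `x` makes `x` and `y` of the same kind over
      -- `Y`, and a twin of `w` gives `y` the kind `t` over `Y ⊹ x`; both contradict `ind₂`.
      grow-twin : ∀ t → Has Y₂ v t → Has Y v t → Has Y₂ w (twin y) → Indec T (Y ⊹ v ⊹ w)
      grow-twin t h₂ h (_ , tw) = grow-default t h₂ h λ hw → contra (Has-cong t w~y hw)
        where
        w~y : ∀ {z} → Y z → T w z ≡ T y z
        w~y Yz = tw (inY₂ Yz) λ { refl → ¬Yy Yz }
        Y₃ : Fin m → Set
        Y₃ = Y ⊹ x ⊹ w
        ¬Y+x-y : ¬ (Y ⊹ x) y
        ¬Y+x-y (inj₁ e) = ¬Yy e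
        ¬Y+x-y (inj₂ e) = x≢y (sym e)
        ind₃ : Indec T Y₃
        ind₃ = swap (λ e → ¬w (inj₁ e)) ¬Y+x-y (λ e → tw (inj₁ e) λ { refl → ¬Y+x-y e }) ind₂
        ¬Y₃v : ¬ Y₃ v
        ¬Y₃v (inj₁ e) = ¬v (inj₁ e)
        ¬Y₃v (inj₂ e) = v≢w e
        hx : ∀ t → Has Y₂ v t → Has Y v t → Has (Y ⊹ x) v t
        hx global g _ = λ z z' → g (inj₁ z) (inj₁ z')
        hx (twin u) (_ , g) (Yu , _) = inj₁ Yu , λ z n → g (inj₁ z) n
        contra : Has Y y t → ⊥
        contra hy with kind ((Y? ∪? x) ∪? w) ind₃ (Three-mono (λ e → inj₁ (inj₁ e)) t3) (inj₁ (inj₁ Yc)) ¬Y₃v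
        ... | r , hr with classify r hr
        ...   | inj₂ (inj₂ hr') with kind-unique r t hr' h
        ...     | refl = ¬merge t h₂ (inj₁ (inj₁ Yc)) (inj₂ refl) hr
        contra hy | r , (_ , e) | inj₁ refl =
          same-kind→¬Indec t3 ¬Yx ¬Yy x≢y t (Has-cong t (λ Yz → e (inj₁ (inj₁ Yz)) λ { refl → ¬Yx Yz }) h) hy ind₂
        contra hy | r , (_ , e) | inj₂ (inj₁ refl) =
          typed→¬Indec (Three-mono inj₁ t3) ¬Y+x-y t
            (Has-cong t (λ z → trans (e (inj₁ z) λ { refl → ¬w (inj₁ z) }) (tw (inj₁ z) λ { refl → ¬Y+x-y z })) (hx t h₂ h)) ind₂

    swap-x : ∀ {v} → ¬ Y₂ v → Has Y₂ v (twin x) → Indec T (Y ⊹ y ⊹ v)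
    swap-x ¬v (_ , e) = swap (λ z → ¬v (m1 z)) ¬x (λ z → e (m1 z) λ { refl → ¬x z }) (reorder Y x y ind₂)
      where
      m1 : ∀ {z} → (Y ⊹ y) z → Y₂ z
      m1 (inj₁ e) = inY₂ e
      m1 (inj₂ e) = inj₂ e
      ¬x : ¬ (Y ⊹ y) x
      ¬x (inj₁ e) = ¬Yx e
      ¬x (inj₂ e) = x≢y e

    -- A twin of `x` over `Y₂` can stand in for `x`. Otherwise the kind of `v` or of `w` restricts
    -- to `Y`, and `grow` adds this pair to `Y`. All three outcomes avoid `x`; this is what allows
    -- `x` to find a new neighbour when `v` and `w` are added.
    exchange : ∀ {v w} → ¬ Y₂ v → ¬ Y₂ w → v ≢ w → Indec T (Y₂ ⊹ v ⊹ w) →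
      Indec T (Y ⊹ y ⊹ v) ⊎ (Indec T (Y ⊹ y ⊹ w) ⊎ Indec T (Y ⊹ v ⊹ w))
    exchange {v} {w} ¬v ¬w v≢w ind₄
      with kind ((Y? ∪? x) ∪? y) ind₂ (Three-mono inY₂ t3) (inY₂ Yc) ¬v
         | kind ((Y? ∪? x) ∪? y) ind₂ (Three-mono inY₂ t3) (inY₂ Yc) ¬w
    ... | t , h | t' , h' with classify t h | classify t' h'
    ...   | inj₁ refl | _ = inj₁ (swap-x ¬v h)
    ...   | inj₂ _ | inj₁ refl = inj₂ (inj₁ (swap-x ¬w h'))
    ...   | inj₂ (inj₁ refl) | inj₂ (inj₁ refl) =
      ⊥-elim (same-kind→¬Indec (Three-mono inY₂ t3) ¬v ¬w v≢w (twin y) h h' ind₄)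
    ...   | inj₂ (inj₂ g) | inj₂ (inj₂ g') = inj₂ (inj₂ (grow-both ¬v ¬w v≢w ind₄ t t' h g h' g'))
    ...   | inj₂ (inj₂ g) | inj₂ (inj₁ refl) = inj₂ (inj₂ (grow-twin ¬v ¬w v≢w ind₄ t h g h'))
    ...   | inj₂ (inj₁ refl) | inj₂ (inj₂ g') = inj₂ (inj₂ (reorder Y w v
              (grow-twin ¬w ¬v (≢-sym v≢w) (reorder Y₂ v w ind₄) t' h' g' h)))

  fresh : ∀ x y z w → ∃ λ (r : Fin m) → r ≢ x × r ≢ y × r ≢ z × r ≢ w
  fresh x y z w with any? (λ r → ¬? (r ≟ x) ×-dec ¬? (r ≟ y) ×-dec ¬? (r ≟ z) ×-dec ¬? (r ≟ w))
  ... | yes r = r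
  ... | no none = ⊥-elim collision
    where
    table : Fin 4 → Fin m
    table zero = x
    table (suc zero) = y
    table (suc (suc zero)) = z
    table (suc (suc (suc zero))) = w
    find : ∀ r → ∃ λ k → r ≡ table k
    find r with r ≟ x | r ≟ y | r ≟ z | r ≟ w
    ... | yes e | _ | _ | _ = zero , e
    ... | no _ | yes e | _ | _ = suc zero , e
    ... | no _ | no _ | yes e | _ = suc (suc zero) , e
    ... | no _ | no _ | no _ | yes e = suc (suc (suc zero)) , e
    ... | no a | no b | no c | no d = ⊥-elim (none (r , a , b , c , d))
    collision : ⊥
    collision with pigeonhole 5≤m (λ r → proj₁ (find r))
    ... | i , j , i<j , e = Fin.<⇒≢ i<j
      (trans (proj₂ (find i)) (trans (cong table e) (sym (proj₂ (find j)))))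

  -- Local structure of the indecomposability graph.

  Without : Fin m → Fin m → Fin m → Set
  Without x y z = z ≢ x × z ≢ y

  without? : ∀ x y z → Dec (Without x y z)
  without? x y z = ¬? (z ≟ x) ×-dec ¬? (z ≟ y)

  three-without : ∀ x y → Three (Without x y)
  three-without x y with fresh x y x y
  ... | p , p1 , p2 , _ with fresh x y p p
  ... | q , q1 , q2 , q3 , _ with fresh x y p q
  ... | r , r1 , r2 , r3 , r4 = three (p1 , p2) (q1 , q2) (r1 , r2) (≢-sym q3) (≢-sym r3) (≢-sym r4)

  -- The indecomposability graph of T, without the vertex c.
  record Edge (x y : Fin m) : Set where
    constructor edge
    field
      x≢c : x ≢ c
      y≢c : y ≢ c
      x≢y : x ≢ y
      ind : Indec T (Without x y)

  edge-sym : ∀ {x y} → Edge x y → Edge y x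
  edge-sym (edge a b n i) = edge b a (≢-sym n) (Indec-resp (λ (p , q) → q , p) (λ (p , q) → q , p) i)

  record Tw (x y z : Fin m) : Set where
    constructor twins
    field
      x≢y : x ≢ y
      x≢z : x ≢ z
      y≢z : y ≢ z
      tw  : ∀ {w} → w ≢ x → w ≢ y → w ≢ z → T y w ≡ T z w

  tw-sym : ∀ {x y z} → Tw x y z → Tw x z y
  tw-sym (twins a b n t) = twins b a (≢-sym n) (λ p q r → sym (t p r q))

  Ext : Bool → Fin m → Fin m → Set
  Ext b x y = ∀ {w} → w ≢ x → w ≢ y → T y w ≡ b

  data Step (x y : Fin m) : Set where
    ext : ∀ b → Ext b x y → Step x y
    tw  : ∀ z → Tw x y z → Step x y

  -- The complement of `x` and `y` is indecomposable and contains `c`, so `y` has a kind over it.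
  step : ∀ {x y} → Edge x y → Step x y
  step {x} {y} (edge x≢c y≢c x≢y i)
    with kind (without? x y) i (three-without x y) (≢-sym x≢c , ≢-sym y≢c) (λ n → proj₂ n refl)
  ... | global , h = ext (T y c) λ w≢x w≢y → h (w≢x , w≢y) (≢-sym x≢c , ≢-sym y≢c)
  ... | twin z , (z≢x , z≢y) , h = tw z (twins x≢y (≢-sym z≢x) (≢-sym z≢y) (λ a b c → h (a , b) c))

  edge-tw : ∀ {x y z} → Edge x y → Tw x y z → z ≢ c → Edge x z
  edge-tw {x} {y} {z} (edge x≢c y≢c x≢y i) (twins _ x≢z y≢z t) z≢c = edge x≢c z≢c x≢z
    (Indec-resp to from (swap {W} {y} {z} (λ n → proj₁ (proj₂ n) refl) (λ n → proj₂ (proj₂ n) refl)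
      (λ (a , b , c) → t a b c) (Indec-resp to' from' i)))
    where
    W : Fin m → Set
    W w = w ≢ x × w ≢ y × w ≢ z
    to : ∀ {w} → (W ⊹ y) w → Without x z w
    to (inj₁ (a , b , c)) = a , c
    to (inj₂ refl) = ≢-sym x≢y , y≢z
    from : ∀ {w} → Without x z w → (W ⊹ y) w
    from {w} (a , c) with w ≟ y
    ... | yes e = inj₂ e
    ... | no b = inj₁ (a , b , c)
    from' : ∀ {w} → (W ⊹ z) w → Without x y w
    from' (inj₁ (a , b , c)) = a , b
    from' (inj₂ refl) = ≢-sym x≢z , ≢-sym y≢z
    to' : ∀ {w} → Without x y w → (W ⊹ z) w
    to' {w} (a , b) with w ≟ z
    ... | yes e = inj₂ e
    ... | no c = inj₁ (a , b , c)

  -- Otherwise both twins survive the removal of `x` and `w`. Hence twins apart from `x` account for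
  -- all neighbours of `x`.
  edge-no-twins : ∀ {x w z z'} → Edge x w → Tw x z z' → z ≢ w → z' ≢ w → ⊥
  edge-no-twins {x} {w} {z} {z'} e (twins x≢z x≢z' z≢z' t) z≢w z'≢w with fresh x w z z'
  ... | r , r1 , r2 , r3 , r4 = twins⊥ (Edge.ind e) z≢z' (≢-sym x≢z , z≢w) (≢-sym x≢z' , z'≢w) (r1 , r2) r3 r4
    λ (a , b) → t a

  edge-no-ext : ∀ {x w v} b → Edge x w → v ≢ x → v ≢ w → (∀ {u} → u ≢ x → u ≢ w → u ≢ v → T v u ≡ b) → ⊥
  edge-no-ext {x} {w} {v} b e v≢x v≢w con with fresh x w v v
  ... | p , p1 , p2 , p3 , _ with fresh x w v p
  ... | q , q1 , q2 , q3 , q4 = constant⊥ (Edge.ind e) (v≢x , v≢w) (p1 , p2) (q1 , q2) (≢-sym q4) p3 q3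
    λ (a , b) (a' , b') n n' → trans (con a b n) (sym (con a' b' n'))

  tw-separated : ∀ {x y z} → Tw x y z → T y x ≢ T z x
  tw-separated {x} {y} {z} (twins x≢y x≢z y≢z t) e =
    twins⊥ indT y≢z tt tt tt x≢y x≢z λ {w} _ w≢y w≢z → at w≢y w≢z
    where
    at : ∀ {w} → w ≢ y → w ≢ z → T y w ≡ T z w
    at {w} w≢y w≢z with w ≟ x
    ... | yes refl = e
    ... | no n = t n w≢y w≢z

  not-ext : ∀ {x y b} → Ext b x y → x ≢ y → T y x ≢ b
  not-ext {x} {y} {b} h x≢y e with fresh x y x y
  ... | p , p1 , p2 , _ = constant⊥ indT {y} {x} {p} tt tt tt (≢-sym p1) x≢y p2
    λ _ _ n n' → trans (at n) (sym (at n'))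
    where
    at : ∀ {w} → w ≢ y → T y w ≡ b
    at {w} n with w ≟ x
    ... | yes refl = e
    ... | no n' = h n' n

  ext-back : ∀ {x y b} → Ext b x y → x ≢ y → T x y ≡ b
  ext-back {x} {y} {b} h n = trans (anti (≢-sym n)) (sym (¬-not (λ e → not-ext h n (sym e))))

  -- Sequences in which second neighbours are twins.

  On : (ℕ → Fin m) → ℕ → Fin m → Set
  On x L v = ∃ λ i → i ≤ L × x i ≡ v

  on? : ∀ x L v → Dec (On x L v)
  on? x L v = map′ (λ (i , i<L , e) → i , ≤-pred i<L , e) (λ (i , i≤L , e) → i , s≤s i≤L , e)
    (anyUpTo? (λ i → x i ≟ v) (suc L))

  -- From outside, only the parity of an index counts. Inside, all arcs are governed by three bits:
  -- one for indices of different parity and one for each parity.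
  module Zigzag {x : ℕ → Fin m} {L : ℕ}
    (tws : ∀ i → suc (suc i) ≤ L → Tw (x (suc i)) (x i) (x (suc (suc i))))
    (inj : ∀ {i j} → i < j → j ≤ L → x i ≢ x j) where

    agree : ∀ d i {z} → dbl d + i ≤ L → (∀ k → i ≤ k → k ≤ dbl d + i → z ≢ x k) → T (x i) z ≡ T (x (dbl d + i)) z
    agree zero i _ _ = refl
    agree (suc d) i le fr = trans
      (agree d i (<⇒≤ (<⇒≤ le)) (λ k a b → fr k a (≤-trans b (≤-trans (n≤1+n _) (n≤1+n _)))))
      (Tw.tw (tws (dbl d + i) le) (fr _ (≤-trans (m≤n+m i (dbl d)) (n≤1+n _)) (n≤1+n _))
        (fr _ (m≤n+m i (dbl d)) (≤-trans (n≤1+n _) (n≤1+n _)))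
        (fr _ (≤-trans (m≤n+m i (dbl d)) (≤-trans (n≤1+n _) (n≤1+n _))) ≤-refl))

    outside : ∀ {z} → ¬ On x L z → ∀ i → i ≤ L → T (x i) z ≡ (if ev i then T (x 0) z else T (x 1) z)
    outside nz zero _ = refl
    outside nz (suc zero) _ = refl
    outside {z} nz (suc (suc i)) le = trans
      (sym (agree 1 i le (λ k a b e → nz (k , ≤-trans b le , sym e))))
      (outside nz i (<⇒≤ (<⇒≤ le)))

    -- The vertex between two twins separates them, so consecutive arcs of the sequence point the
    -- same way.
    adjacent : ∀ i → suc i ≤ L → T (x i) (x (suc i)) ≡ T (x 0) (x 1)
    adjacent zero _ = refl
    adjacent (suc i) le = trans (trans (anti (≢-sym (inj ≤-refl le)))
      (sym (¬-not (tw-separated (tws i le))))) (adjacent i (<⇒≤ le))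

    bit : Bool → Bool → Bool
    bit true  true  = T (x 0) (x 2)
    bit false false = T (x 1) (x 3)
    bit _     _     = T (x 0) (x 1)

    bit-opp : ∀ b → bit b (not b) ≡ T (x 0) (x 1)
    bit-opp true = refl
    bit-opp false = refl

    arc-odd : ∀ d i → suc (dbl d + i) ≤ L → T (x i) (x (suc (dbl d + i))) ≡ T (x 0) (x 1)
    arc-odd d i le = trans (flip (≢-sym (inj (s≤s (m≤n+m i (dbl d))) le)) (≢-sym (inj ≤-refl (≤-trans (s≤s (m≤n+m i (dbl d))) le)))
      (sym (subst (λ j → T (x (suc i)) (x i) ≡ T (x j) (x i)) (+-suc (dbl d) i)
        (agree d (suc i) (subst (_≤ L) (sym (+-suc (dbl d) i)) le)
          (λ k a b → inj a (≤-trans b (subst (_≤ L) (sym (+-suc (dbl d) i)) le)))))))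
      (adjacent i (≤-trans (s≤s (m≤n+m i (dbl d))) le))

    arc-even : ∀ d i → suc (suc (dbl d + i)) ≤ L → T (x i) (x (suc (suc (dbl d + i)))) ≡ T (x i) (x (suc (suc i)))
    arc-even d i le = flip (≢-sym (inj (s≤s (≤-trans (m≤n+m i (dbl d)) (n≤1+n _))) le))
      (≢-sym (inj (s≤s (n≤1+n i)) (≤-trans (s≤s (s≤s (m≤n+m i (dbl d)))) le)))
      (sym (subst (λ j → T (x (suc (suc i))) (x i) ≡ T (x j) (x i)) eq
        (agree d (suc (suc i)) (subst (_≤ L) (sym eq) le)
          (λ k a b → inj (≤-trans (n≤1+n _) a) (≤-trans b (subst (_≤ L) (sym eq) le))))))
      where
      eq : dbl d + suc (suc i) ≡ suc (suc (dbl d + i))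
      eq = trans (+-suc (dbl d) (suc i)) (cong suc (+-suc (dbl d) i))

    -- The arcs from `x i` to `x (i + 2)` and from `x (i + 2)` to `x (i + 4)` both have the value of
    -- the arc from `x i` to `x (i + 4)`.
    arc-two : ∀ i → suc (suc i) ≤ L → T (x i) (x (suc (suc i))) ≡ bit (ev i) (ev i)
    arc-two zero _ = refl
    arc-two (suc zero) _ = refl
    arc-two (suc (suc i)) le = trans (sym (trans (sym (arc-even 1 i le))
      (agree 1 i (<⇒≤ (<⇒≤ le)) (λ k a b → ≢-sym (inj (s≤s (≤-trans b (n≤1+n _))) le)))))
      (arc-two i (<⇒≤ (<⇒≤ le)))

    arc : ∀ {i j} → i < j → j ≤ L → T (x i) (x j) ≡ bit (ev i) (ev j)
    arc {i} i<j j≤L with gap i<j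
    ... | odd-gap d rewrite ev-suc (dbl d + i) | ev-dbl+ d i | bit-opp (ev i) = arc-odd d i j≤L
    ... | even-gap d rewrite ev-dbl+ d i = trans (arc-even d i j≤L) (arc-two i (≤-trans (s≤s (s≤s (m≤n+m i (dbl d)))) j≤L))

  -- Paths of the graph have no repeated vertices.

  record Path (f : ℕ → Fin m) (n : ℕ) : Set where
    constructor path
    field
      edges : ∀ i → i ≤ n → Edge (f i) (f (suc i))
      tws   : ∀ i → i < n → Tw (f (suc i)) (f i) (f (suc (suc i)))

  path-tail : ∀ {f n} → Path f (suc n) → Path (λ i → f (suc i)) n
  path-tail (path e t) = path (λ i le → e (suc i) (s≤s le)) (λ i lt → t (suc i) (s≤s lt))

  path-≢c : ∀ {f n} → Path f n → ∀ i → i ≤ suc n → f i ≢ c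
  path-≢c p zero _ = Edge.x≢c (Path.edges p 0 z≤n)
  path-≢c p (suc i) (s≤s le) = Edge.y≢c (Path.edges p i le)

  path-injective : ∀ n {f} → Path f n → ∀ {i j} → i < j → j ≤ suc n → f i ≢ f j
  -- Suppose `f 0 ≡ f j`. If `j` is even, `f j` agrees with `f 2` on `f 1`, although `f 1` separates
  -- `f 0` from `f 2`. If `j` is odd, `f j` has the neighbours `f 1` and `f (j − 1)`. The
  -- continuation of the path or `step` rules out one of them, unless they are twins apart from
  -- `f j`; in that case the cycle is an interval.
  path-head : ∀ n {f} → Path f (suc n) → ∀ {j} → Gap 1 j → j ≤ suc (suc n) → f 0 ≢ f j

  path-injective zero p {zero} {suc zero} _ _ = Edge.x≢y (Path.edges p 0 z≤n)
  path-injective zero p {suc i} {suc zero} (s≤s ()) _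
  path-injective zero p {i} {suc (suc j)} _ (s≤s ())
  path-injective (suc n) p {zero} {suc zero} i<j le = Edge.x≢y (Path.edges p 0 z≤n)
  path-injective (suc n) p {zero} {suc (suc j)} i<j le = path-head n p (gap (s≤s z<s)) le
  path-injective (suc n) p {suc i} {suc j} (s≤s i<j) (s≤s le) = path-injective n (path-tail p) i<j le

  path-head n {f} p (odd-gap d) le e = tw-separated (Path.tws p 0 z<s)
    (trans (cong (λ v → T v (f 1)) e) (sym (agree d 1 (≤-pred le) (λ k a b → tail-inj a (≤-trans b (≤-pred le))))))
    where
    tail-inj : ∀ {i j} → i < j → j ≤ suc n → f (suc i) ≢ f (suc j)
    tail-inj = path-injective n (path-tail p)
    open Zigzag {λ i → f (suc i)} {suc n} (λ i lt → Path.tws (path-tail p) i (≤-pred lt)) tail-inj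
  path-head n {f} p (even-gap d) le e = contra
    where
    k : ℕ
    k = dbl d + 1
    1≤k : 1 ≤ k
    1≤k = m≤n+m 1 (dbl d)
    tail-inj : ∀ {i j} → i < j → j ≤ suc n → f (suc i) ≢ f (suc j)
    tail-inj = path-injective n (path-tail p)
    open Zigzag {λ i → f (suc i)} {suc n} (λ i lt → Path.tws (path-tail p) i (≤-pred lt)) tail-inj
    j₁ : Edge (f (suc (suc k))) (f 1)
    j₁ = subst (λ v → Edge v (f 1)) e (Path.edges p 0 z≤n)
    jk : Edge (f (suc (suc k))) (f (suc k))
    jk = edge-sym (Path.edges p (suc k) (≤-pred le))
    k≢1 : f 1 ≢ f (suc k)
    k≢1 = tail-inj 1≤k (≤-trans (n≤1+n k) (≤-pred le))
    -- An odd cycle f 1, …, f (k + 2) in which all vertices look alike from the outside.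
    cycle : Tw (f (suc (suc k))) (f 1) (f (suc k)) → ⊥
    cycle (twins _ _ _ t) = nontrivial⊥ indT P P? (λ _ _ _ Pa Pb nPx → trans (eq Pa nPx) (sym (eq Pb nPx)))
      (tail-inj z<s z<s) tt tt tt (0 , z≤n , refl) (1 , z<s , refl)
      λ (i , i≤ , e) → path-≢c p (suc i) (s≤s (≤-trans i≤ (≤-pred le))) e
      where
      P : Fin m → Set
      P = On (λ i → f (suc i)) (suc k)
      P? : ∀ v → Dec (P v)
      P? = on? (λ i → f (suc i)) (suc k)
      open Zigzag {λ i → f (suc i)} {suc k} (λ i lt → Path.tws (path-tail p) i (≤-trans (≤-pred lt) (≤-pred (≤-pred le))))
        (λ i<j j≤ → tail-inj i<j (≤-trans j≤ (≤-pred le))) renaming (outside to outsideₖ)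
      -- The twins `f 1` and `f (k + 1)` belong to different parity classes, which therefore look
      -- alike.
      second : ∀ {w} → ¬ P w → T (f 2) w ≡ T (f 1) w
      second {w} nw = sym (trans (t (ne (suc k) ≤-refl) (ne 0 z≤n) (ne k (n≤1+n k)))
        (trans (outsideₖ nw k (n≤1+n k)) (cong (λ b → if b then T (f 1) w else T (f 2) w) (ev-dbl+ d 1))))
        where
        ne : ∀ i → i ≤ suc k → w ≢ f (suc i)
        ne i le e = nw (i , le , sym e)
      eq : ∀ {a w} → P a → ¬ P w → T a w ≡ T (f 1) w
      eq (i , i≤ , refl) nw with ev i in ei | outsideₖ nw i i≤
      ... | true | h = h
      ... | false | h = trans h (second nw)
    contra : ⊥
    contra with m≤n⇒m<n∨m≡n le
    ... | inj₁ lt = edge-no-twins j₁ (Path.tws p (suc k) (≤-pred lt)) (≢-sym k≢1)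
                      (≢-sym (tail-inj z<s (≤-pred lt)))
    ... | inj₂ _ with step j₁
    ...   | ext b h = edge-no-ext b jk (≢-sym (Edge.x≢y j₁)) k≢1 λ a _ b → h a b
    ...   | tw z t with z ≟ f (suc k)
    ...     | yes refl = cycle t
    ...     | no z≢ = edge-no-twins jk t k≢1 z≢

  -- A 3-cycle through c, traversed forwards or backwards according to β.
  record Cyc (β : Bool) (u z : Fin m) : Set where
    constructor cyc
    field
      u≢c : u ≢ c
      z≢c : z ≢ c
      u≢z : u ≢ z
      uc  : T u c ≡ β
      cz  : T c z ≡ β
      zu  : T z u ≡ β

  cyc-flip : ∀ {β u z} → Cyc β u z → Cyc (not β) z u
  cyc-flip (cyc u≢c z≢c u≢z uc cz zu) =
    cyc z≢c u≢c (≢-sym u≢z) (opp (≢-sym z≢c) cz) (opp u≢c uc) (opp (≢-sym u≢z) zu)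

  abstract
    -- Without a 3-cycle through `c`, every vertex dominating `c` would dominate every vertex that
    -- `c` dominates, so each of the two sets would be an interval. Of three vertices other than
    -- `c`, two lie in the same set.
    cyc-exists : ∀ β → ∃₂ (Cyc β)
    cyc-exists β with find
      where
      isCyc? : ∀ u z → Dec (u ≢ c × z ≢ c × T u c ≡ true × T c z ≡ true × T z u ≡ true)
      isCyc? u z = ¬? (u ≟ c) ×-dec ¬? (z ≟ c) ×-dec (T u c ≟ᵇ true) ×-dec (T c z ≟ᵇ true) ×-dec (T z u ≟ᵇ true)
      find : ∃₂ (Cyc true)
      find with any? (λ u → any? (isCyc? u))
      ... | yes (u , z , u≢c , z≢c , uc , cz , zu) = u , z , cyc u≢c z≢c (λ { refl → clash zu (irr u) }) uc cz zu
      ... | no none = ⊥-elim (split (three-without c c))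
        where
        Side : Bool → Fin m → Set
        Side b v = v ≢ c × T v c ≡ b
        side? : ∀ b v → Dec (Side b v)
        side? b v = ¬? (v ≟ c) ×-dec (T v c ≟ᵇ b)
        eq : ∀ b {a x} → Side b a → ¬ Side b x → T a x ≡ b
        eq b {a} {x} (a≢c , ac) nx with x ≟ c
        ... | yes refl = ac
        ... | no x≢c with ≡b∨≡not (T x c) b
        ...   | inj₁ e = ⊥-elim (nx (x≢c , e))
        ...   | inj₂ e with ≡b∨≡not (T a x) b
        ...     | inj₁ e' = e'
        eq true {a} {x} (a≢c , ac) nx | no x≢c | inj₂ e | inj₂ e' =
          ⊥-elim (none (a , x , a≢c , x≢c , ac , opp x≢c e , opp (λ { refl → clash ac e }) e'))
        eq false {a} {x} (a≢c , ac) nx | no x≢c | inj₂ e | inj₂ e' =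
          ⊥-elim (none (x , a , x≢c , a≢c , e , opp a≢c ac , e'))
        two : ∀ b {p q} → p ≢ q → Side b p → Side b q → ⊥
        two b n sp sq = nontrivial⊥ indT (Side b) (side? b)
          (λ _ _ _ sa sb nx → trans (eq b sa nx) (sym (eq b sb nx))) n tt tt tt sp sq (λ s → proj₁ s refl)
        split : Three (Without c c) → ⊥
        split (three {p} {q} {r} (p≢ , _) (q≢ , _) (r≢ , _) p≢q p≢r q≢r) with T p c in ep | T q c in eq' | T r c in er
        ... | true | true | _ = two true p≢q (p≢ , ep) (q≢ , eq')
        ... | false | false | _ = two false p≢q (p≢ , ep) (q≢ , eq')
        ... | true | false | true = two true p≢r (p≢ , ep) (r≢ , er)
        ... | true | false | false = two false q≢r (q≢ , eq') (r≢ , er)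
        ... | false | true | true = two true q≢r (q≢ , eq') (r≢ , er)
        ... | false | true | false = two false p≢r (p≢ , ep) (r≢ , er)
    cyc-exists true | u , z , h = u , z , h
    cyc-exists false | u , z , h = z , u , cyc-flip h

  -- Neighbours of the vertices off a 3-cycle through `c`.

  module FromCycle {β : Bool} {u z : Fin m} (C : Cyc β u z) where
    open Cyc C

    X₀ : Fin m → Set
    X₀ = (λ v → v ≡ c) ⊹ u ⊹ z

    three₀ : Three X₀
    three₀ = three (inj₁ (inj₁ refl)) (inj₁ (inj₂ refl)) (inj₂ refl) (≢-sym u≢c) (≢-sym z≢c) u≢z

    X₀? : ∀ v → Dec (X₀ v)
    X₀? v = ((v ≟ c) ⊎-dec (v ≟ u)) ⊎-dec (v ≟ z)

    ind₀ : Indec T X₀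
    ind₀ = triangle u≢c z≢c u≢z uc cz zu

    -- The invariant of the climb from the 3-cycle to `T`: `nbr` is the desired conclusion for the
    -- subtournament on `Y`, with neighbours that avoid the whole cycle.
    record Reached (Y : Fin m → Set) : Set where
      field
        dec  : ∀ v → Dec (Y v)
        ind  : Indec T Y
        base : ∀ {v} → X₀ v → Y v
        nbr  : ∀ {v} → Y v → ¬ X₀ v → ∃ λ y → Y y × ¬ X₀ y × y ≢ v × Indec T (λ w → Y w × w ≢ v × w ≢ y)

    private
      reach-next : ∀ {Y x y} → Reached Y → ¬ Y x → ¬ Y y → x ≢ y → Indec T (Y ⊹ x ⊹ y) → Reached (Y ⊹ x ⊹ y)
      reach-next {Y} {x} {y} R ¬Yx ¬Yy x≢y ind₂ = record
        { dec = (dec ∪? x) ∪? y ; ind = ind₂ ; base = λ h → inj₁ (inj₁ (base h)) ; nbr = nbr′ }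
        where
        open Reached R
        nbr′ : ∀ {v} → (Y ⊹ x ⊹ y) v → ¬ X₀ v →
          ∃ λ w → (Y ⊹ x ⊹ y) w × ¬ X₀ w × w ≢ v × Indec T (λ s → (Y ⊹ x ⊹ y) s × s ≢ v × s ≢ w)
        nbr′ (inj₁ (inj₂ refl)) nv = y , inj₂ refl , (λ h → ¬Yy (base h)) , ≢-sym x≢y , Indec-resp
          (λ Ys → inj₁ (inj₁ Ys) , (λ { refl → ¬Yx Ys }) , λ { refl → ¬Yy Ys })
          (λ { (inj₁ (inj₁ Ys) , _) → Ys ; (inj₁ (inj₂ e) , n , _) → ⊥-elim (n e) ; (inj₂ e , _ , n) → ⊥-elim (n e) }) ind
        nbr′ (inj₂ refl) nv = x , inj₁ (inj₂ refl) , (λ h → ¬Yx (base h)) , x≢y , Indec-resp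
          (λ Ys → inj₁ (inj₁ Ys) , (λ { refl → ¬Yy Ys }) , λ { refl → ¬Yx Ys })
          (λ { (inj₁ (inj₁ Ys) , _) → Ys ; (inj₁ (inj₂ e) , _ , n) → ⊥-elim (n e) ; (inj₂ e , n , _) → ⊥-elim (n e) }) ind
        nbr′ {v} (inj₁ (inj₁ Yv)) nv with nbr Yv nv
        -- Each of the three sets offered by `exchange` omits `v` and exactly one other vertex of
        -- `Y ⊹ x ⊹ y`; that vertex is the new neighbour.
        ... | y₀ , Yy₀ , ny₀ , y₀≢v , indW = pick
                (exchange W? indW (Three-mono X₀→W three₀) (X₀→W (inj₁ (inj₁ refl)))
                  (λ n → proj₁ (proj₂ n) refl) (λ n → proj₂ (proj₂ n) refl) (≢-sym y₀≢v)
                  (Indec-resp Y→ →Y ind) (λ w → ¬Yx (→Y w)) (λ w → ¬Yy (→Y w)) x≢y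
                  (Indec-resp {X = Y ⊹ x ⊹ y} {X' = W ⊹ v ⊹ y₀ ⊹ x ⊹ y}
                    (λ { (inj₁ (inj₁ w)) → inj₁ (inj₁ (Y→ w)) ; (inj₁ (inj₂ e)) → inj₁ (inj₂ e) ; (inj₂ e) → inj₂ e })
                    (λ { (inj₁ (inj₁ w)) → inj₁ (inj₁ (→Y w)) ; (inj₁ (inj₂ e)) → inj₁ (inj₂ e) ; (inj₂ e) → inj₂ e }) ind₂))
          where
          W : Fin m → Set
          W w = Y w × w ≢ v × w ≢ y₀
          W? : ∀ w → Dec (W w)
          W? w = dec w ×-dec ¬? (w ≟ v) ×-dec ¬? (w ≟ y₀)
          X₀→W : ∀ {w} → X₀ w → W w
          X₀→W h = base h , (λ { refl → nv h }) , λ { refl → ny₀ h }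
          →Y : ∀ {w} → (W ⊹ v ⊹ y₀) w → Y w
          →Y (inj₁ (inj₁ (w , _))) = w
          →Y (inj₁ (inj₂ refl)) = Yv
          →Y (inj₂ refl) = Yy₀
          Y→ : ∀ {w} → Y w → (W ⊹ v ⊹ y₀) w
          Y→ {w} Yw with w ≟ v | w ≟ y₀
          ... | yes e | _ = inj₁ (inj₂ e)
          ... | no _ | yes e = inj₂ e
          ... | no a | no b = inj₁ (inj₁ (Yw , a , b))
          Y-x : ∀ {w} → Y w → w ≢ x
          Y-x Yw refl = ¬Yx Yw
          Y-y : ∀ {w} → Y w → w ≢ y
          Y-y Yw refl = ¬Yy Yw
          back : ∀ {w} → Y w → w ≢ v → (W ⊹ y₀) w
          back Yw n with Y→ Yw
          ... | inj₁ (inj₁ w) = inj₁ w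
          ... | inj₁ (inj₂ e) = ⊥-elim (n e)
          ... | inj₂ e = inj₂ e
          pick : Indec T (W ⊹ y₀ ⊹ x) ⊎ (Indec T (W ⊹ y₀ ⊹ y) ⊎ Indec T (W ⊹ x ⊹ y)) →
            ∃ λ w → (Y ⊹ x ⊹ y) w × ¬ X₀ w × w ≢ v × Indec T (λ s → (Y ⊹ x ⊹ y) s × s ≢ v × s ≢ w)
          pick (inj₁ i) = y , inj₂ refl , (λ h → ¬Yy (base h)) , ≢-sym (Y-y Yv) , Indec-resp
            (λ { (inj₁ (inj₁ (a , b , _))) → inj₁ (inj₁ a) , b , Y-y a
               ; (inj₁ (inj₂ refl)) → inj₁ (inj₁ Yy₀) , y₀≢v , Y-y Yy₀
               ; (inj₂ refl) → inj₁ (inj₂ refl) , ≢-sym (Y-x Yv) , x≢y })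
            (λ { (inj₁ (inj₁ a) , n , _) → inj₁ (back a n) ; (inj₁ (inj₂ e) , _) → inj₂ e ; (inj₂ e , _ , n) → ⊥-elim (n e) }) i
          pick (inj₂ (inj₁ i)) = x , inj₁ (inj₂ refl) , (λ h → ¬Yx (base h)) , ≢-sym (Y-x Yv) , Indec-resp
            (λ { (inj₁ (inj₁ (a , b , _))) → inj₁ (inj₁ a) , b , Y-x a
               ; (inj₁ (inj₂ refl)) → inj₁ (inj₁ Yy₀) , y₀≢v , Y-x Yy₀
               ; (inj₂ refl) → inj₂ refl , ≢-sym (Y-y Yv) , ≢-sym x≢y })
            (λ { (inj₁ (inj₁ a) , n , _) → inj₁ (back a n) ; (inj₁ (inj₂ e) , _ , n) → ⊥-elim (n e) ; (inj₂ e , _) → inj₂ e }) i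
          pick (inj₂ (inj₂ i)) = y₀ , inj₁ (inj₁ Yy₀) , ny₀ , y₀≢v , Indec-resp
            (λ { (inj₁ (inj₁ (a , b , c))) → inj₁ (inj₁ a) , b , c
               ; (inj₁ (inj₂ refl)) → inj₁ (inj₂ refl) , ≢-sym (Y-x Yv) , ≢-sym (Y-x Yy₀)
               ; (inj₂ refl) → inj₂ refl , ≢-sym (Y-y Yv) , ≢-sym (Y-y Yy₀) })
            (λ { (inj₁ (inj₁ a) , n , n') → inj₁ (inj₁ (a , n , n')) ; (inj₁ (inj₂ e) , _) → inj₁ (inj₂ e) ; (inj₂ e , _) → inj₂ e }) i

      finish : ∀ {Y} → Reached Y → (∀ v → Y v) → Reached All
      finish {Y} R all = record { dec = λ _ → yes tt ; ind = indT ; base = λ _ → tt ; nbr = nbr′ }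
        where
        open Reached R
        nbr′ : ∀ {v} → ⊤ → ¬ X₀ v → ∃ λ y → ⊤ × ¬ X₀ y × y ≢ v × Indec T (λ w → ⊤ × w ≢ v × w ≢ y)
        nbr′ {v} _ nv with nbr (all v) nv
        ... | y , _ , ny , n , i = y , tt , ny , n , Indec-resp (λ (_ , a) → tt , a) (λ (_ , a) → all _ , a) i

      climb : ∀ n {Y} (R : Reached Y) → missing (Reached.dec R) ≡ n → Reached All
      climb n {Y} R e with any? (λ v → ¬? (Reached.dec R v))
      ... | no none = finish R λ v → full v
        where
        full : ∀ v → Y v
        full v with Reached.dec R v
        ... | yes h = h
        ... | no h = ⊥-elim (none (v , h))
      climb zero R e | yes (x , ¬Yx) = ⊥-elim (count-none (λ v → ¬? (Reached.dec R v)) e x ¬Yx)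
      -- With a single vertex left, `T` itself would be a one-vertex extension of `Y`.
      climb (suc zero) {Y} R e | yes (x , ¬Yx) = ⊥-elim (no-extension dec ind (Three-mono base three₀) (base (inj₁ (inj₁ refl))) ¬Yx
          (Indec-resp (λ _ → missing-last dec ¬Yx e _) (λ _ → tt) indT))
        where open Reached R
      climb (suc (suc n)) {Y} R e | yes (x , ¬Yx)
        with count-witness (λ v → ¬? ((Reached.dec R ∪? x) v)) (suc-injective (trans (sym (missing-suc (Reached.dec R) ¬Yx)) e))
      ... | x' , n' with extend (Reached.dec R) (Reached.ind R) (Three-mono (Reached.base R) three₀) indT ¬Yx
                           (λ h → n' (inj₁ h)) (λ e → n' (inj₂ (sym e)))
      ... | p , q , ¬Yp , ¬Yq , p≢q , i = climb n (reach-next R ¬Yp ¬Yq p≢q i)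
              (suc-injective (suc-injective (trans (sym (missing-suc₂ (Reached.dec R) ¬Yp ¬Yq p≢q)) e)))

    abstract
      neighbour : ∀ {v} → v ≢ c → v ≢ u → v ≢ z → ∃ (Edge v)
      neighbour {v} v≢c v≢u v≢z with Reached.nbr (climb _ start refl) tt ¬X₀
        where
        start : Reached X₀
        start = record { dec = X₀? ; ind = ind₀ ; base = λ h → h ; nbr = λ h n → ⊥-elim (n h) }
        ¬X₀ : ¬ X₀ v
        ¬X₀ (inj₁ (inj₁ e)) = v≢c e
        ¬X₀ (inj₁ (inj₂ e)) = v≢u e
        ¬X₀ (inj₂ e) = v≢z e
      ... | y , _ , ny , y≢v , i = y , edge v≢c (λ e → ny (inj₁ (inj₁ e))) (≢-sym y≢v)
              (Indec-resp (λ (_ , a) → a) (λ a → tt , a) i)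

  -- Maximal paths and their two ends.

  End : Fin m → Fin m → Set
  End x y = (∃ λ b → Ext b x y) ⊎ Tw x y c

  reverse : ∀ {f n} → Path f n → Path (λ i → f (suc n ∸ i)) n
  reverse {f} {n} (path es ts) = path
    (λ i i≤n → subst (λ k → Edge (f k) (f (n ∸ i))) (sym (∸-pred (s≤s i≤n))) (edge-sym (es (n ∸ i) (m∸n≤m n i))))
    λ i i<n → shift (∸-pred i<n) (∸-pred (≤-trans i<n (n≤1+n n))) (tw-sym (ts (n ∸ suc i) (lt i<n)))
    where
    lt : ∀ {i} → i < n → n ∸ suc i < n
    lt {i} i<n = subst (_≤ n) (∸-pred i<n) (m∸n≤m n i)
    shift : ∀ {i} → n ∸ i ≡ suc (n ∸ suc i) → suc n ∸ i ≡ suc (n ∸ i) →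
      Tw (f (suc (n ∸ suc i))) (f (suc (suc (n ∸ suc i)))) (f (n ∸ suc i)) →
      Tw (f (n ∸ i)) (f (suc n ∸ i)) (f (n ∸ suc i))
    shift {i} e e' t = subst (λ k → Tw (f (n ∸ i)) (f k) (f (n ∸ suc i))) (sym e')
      (subst (λ k → Tw (f k) (f (suc k)) (f (n ∸ suc i))) (sym e) t)

  path-short : ∀ {f n} → Path f n → n < m
  path-short {f} {n} p with suc n ≤? m
  ... | yes le = le
  ... | no nle with pigeonhole {n = suc (suc n)} (≤-trans (≰⇒> nle) (n≤1+n _)) (λ i → f (toℕ i))
  ...   | i , j , i<j , e = ⊥-elim (path-injective n p i<j (≤-pred (toℕ<n j)) e)

  -- The path has no repeated vertices, so `m` bounds its length and `k` serves as fuel. Keeping the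
  -- last two vertices preserves what was reached at the far end when a reversed path is extended.
  extend-front : ∀ k {f n} → n + k ≡ m → Path f n → ∃₂ λ f' n' → Path f' n' × End (f' 0) (f' 1) ×
    f' n' ≡ f n × f' (suc n') ≡ f (suc n) × (∀ v → On f (suc n) v → On f' (suc n') v)
  extend-front zero {f} {n} e p = ⊥-elim (<-irrefl (trans (sym (+-identityʳ n)) e) (path-short p))
  extend-front (suc k) {f} {n} e p with step (Path.edges p 0 z≤n)
  ... | ext b h = f , n , p , inj₁ (b , h) , refl , refl , λ _ h → h
  ... | tw z t with z ≟ c
  ...   | yes refl = f , n , p , inj₂ t , refl , refl , λ _ h → h
  ...   | no z≢c with extend-front k (trans (sym (+-suc n k)) e) (path es ts)
    where
    es : ∀ i → i ≤ suc n → Edge ((z ◂ f) i) (f i)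
    es zero _ = edge-sym (edge-tw (Path.edges p 0 z≤n) t z≢c)
    es (suc i) (s≤s le) = Path.edges p i le
    ts : ∀ i → i < suc n → Tw (f i) ((z ◂ f) i) (f (suc i))
    ts zero _ = tw-sym t
    ts (suc i) (s≤s lt) = Path.tws p i lt
  ...     | f' , n' , p' , end , e₁ , e₂ , on = f' , n' , p' , end , e₁ , e₂ ,
              λ v (i , le , eq) → on v (suc i , s≤s le , eq)

  edge-path : ∀ {v w} → Edge v w → Path (v ◂ λ _ → w) 0
  edge-path e = path (λ { zero _ → e }) (λ _ ())

  maximal : ∀ {v w} → Edge v w → ∃₂ λ f n → Path f n × End (f 0) (f 1) × End (f (suc n)) (f n) × On f (suc n) v
  maximal {v} {w} e with extend-front m refl (edge-path e)
  ... | f , n , p , end , e₁ , e₂ , on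
    with extend-front (m ∸ n) (m+[n∸m]≡n (<⇒≤ (path-short p))) (reverse p)
  ... | f' , n' , p' , end' , e₁' , e₂' , on' = f' , n' , p' , end' ,
      subst₂ End (sym (trans e₂' (cong f (n∸n≡0 n)))) (sym (trans e₁' (cong f suc-n∸n))) end , on' v (rev (on v (0 , z≤n , refl)))
    where
    suc-n∸n : suc n ∸ n ≡ 1
    suc-n∸n = trans (∸-pred {n} {suc n} ≤-refl) (cong suc (n∸n≡0 n))
    rev : On f (suc n) v → On (λ i → f (suc n ∸ i)) (suc n) v
    rev (i , le , eq) = suc n ∸ i , m∸n≤m (suc n) i , trans (cong f (m∸[m∸n]≡n le)) eq

  module _ {f : ℕ → Fin m} {n : ℕ} (p : Path f n) where

    private
      x : ℕ → Fin m
      x = c ◂ f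

    x-inj : ∀ {i j} → i < j → j ≤ suc (suc n) → x i ≢ x j
    x-inj {zero} {suc j} _ (s≤s le) e = path-≢c p j le (sym e)
    x-inj {suc i} {suc j} (s≤s i<j) (s≤s le) e = path-injective n p i<j le e

    x-tws : Tw (f 0) (f 1) c → ∀ i → suc (suc i) ≤ suc (suc n) → Tw (x (suc i)) (x i) (x (suc (suc i)))
    x-tws t zero _ = tw-sym t
    x-tws t (suc i) (s≤s (s≤s le)) = Path.tws p i le

    -- If both ends of the path were attached to c, the path with c would be an interval,
    -- hence everything, and the two ends would be twins once c is removed.
    ends-cc⊥ : Tw (f 0) (f 1) c → Tw (f (suc n)) (f n) c → ⊥
    ends-cc⊥ t t' with ev n in en
    ends-cc⊥ t t' | false = contra n en refl
      where
      open Zigzag {x} {suc (suc n)} (x-tws t) x-inj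
      contra : ∀ k → ev k ≡ false → k ≡ n → ⊥
      contra (suc k) _ refl = b≢notb {T (x 0) (x 1)} (trans (sym (Tw.tw t'
          (x-inj {1} {suc (suc n)} (s≤s z<s) ≤-refl) (x-inj {1} {suc n} (s≤s z<s) (n≤1+n _))
          (path-≢c p 0 z≤n)))
        (opp (x-inj {1} {suc n} (s≤s z<s) (n≤1+n _))
          (trans (arc {1} {suc n} (s≤s z<s) (n≤1+n _)) (cong (bit false) (trans (ev-suc n) (cong not en))))))
    ends-cc⊥ t t' | true = go n refl
      where
      open Zigzag {x} {suc (suc n)} (x-tws t) x-inj
      e : Bool
      e = T (x 0) (x 1)
      en′ : ev (suc n) ≡ false
      en′ = trans (ev-suc n) (cong not en)
      cover : ∀ v → On x (suc (suc n)) v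
      cover v with on? x (suc (suc n)) v
      ... | yes h = h
      ... | no nv = ⊥-elim (nontrivial⊥ indT (On x (suc (suc n))) (on? x (suc (suc n)))
              (λ _ _ _ Pa Pb nw → trans (eq Pa nw) (sym (eq Pb nw))) (x-inj {0} {1} z<s z<s) tt tt tt
              (0 , z≤n , refl) (1 , z<s , refl) nv)
        where
        eq : ∀ {a w} → On x (suc (suc n)) a → ¬ On x (suc (suc n)) w → T a w ≡ T c w
        eq {w = w} (i , le , refl) nw = trans (outside nw i le) (if-same (ev i) refl
          (trans (trans (cong (λ b → if b then T (x 0) w else T (x 1) w) (sym en′)) (sym (outside nw (suc n) (n≤1+n _))))
            (Tw.tw t' (ne (suc (suc n)) ≤-refl) (ne (suc n) (n≤1+n _)) (ne 0 z≤n))))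
          where
          ne : ∀ i → i ≤ suc (suc n) → w ≢ x i
          ne i le e = nw (i , le , sym e)
      go : ∀ k → k ≡ n → ⊥
      go zero refl with fresh (x 0) (x 1) (x 2) (x 2)
      ... | r , r0 , r1 , r2 , _ with cover r
      ...   | 0 , _ , h = r0 (sym h)
      ...   | 1 , _ , h = r1 (sym h)
      ...   | 2 , _ , h = r2 (sym h)
      ...   | suc (suc (suc _)) , s≤s (s≤s ()) , h
      go (suc zero) refl = clash en refl
      go (suc (suc k)) refl = twins⊥ indc (x-inj {1} {suc (suc n)} (s≤s z<s) ≤-refl)
          (path-≢c p 0 z≤n) (path-≢c p (suc n) ≤-refl) (path-≢c p 1 z<s)
          (≢-sym (x-inj {1} {2} ≤-refl (s≤s z<s))) (x-inj {2} {suc (suc n)} (s≤s (s≤s z<s)) ≤-refl) same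
        where
        1< : 1 < suc n
        1< = s≤s z<s
        2< : 2 < suc n
        2< = s≤s (s≤s z<s)
        at : ∀ {w} → w ≢ x (suc (suc n)) → w ≢ x (suc n) → w ≢ c → T (x (suc n)) w ≡ T c w
        at = Tw.tw t'
        ff : bit false false ≡ not e
        ff = trans (sym (trans (arc 1< (n≤1+n _)) (cong (bit false) en′)))
          (trans (anti (≢-sym (x-inj 1< (n≤1+n _)))) (cong not (at (x-inj {1} {suc (suc n)} (s≤s z<s) ≤-refl) (x-inj 1< (n≤1+n _)) (path-≢c p 0 z≤n))))
        tt′ : bit true true ≡ not e
        tt′ = trans (sym (at (x-inj {2} {suc (suc n)} (s≤s (s≤s z<s)) ≤-refl) (x-inj 2< (n≤1+n _)) (path-≢c p 1 z<s)))
          (opp (x-inj 2< (n≤1+n _)) (trans (arc 2< (n≤1+n _)) (cong (bit true) en′)))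
        bits : ∀ b → bit false b ≡ not (bit b true)
        bits true = trans (sym (not-involutive e)) (cong not (sym tt′))
        bits false = ff
        same : ∀ {w} → w ≢ c → w ≢ x 1 → w ≢ x (suc (suc n)) → T (x 1) w ≡ T (x (suc (suc n))) w
        same {w} w≢c w≢1 w≢L with cover w
        ... | zero , _ , h = ⊥-elim (w≢c (sym h))
        ... | suc zero , _ , h = ⊥-elim (w≢1 (sym h))
        ... | suc (suc j) , le , refl = trans (arc (s≤s z<s) le) (trans (bits (ev j))
                (sym (opp (x-inj lt ≤-refl) (trans (arc lt ≤-refl) (cong (bit (ev j)) en)))))
          where
          lt : suc (suc j) < suc (suc n)
          lt = ≤∧≢⇒< le λ { refl → w≢L refl }

    -- Arcs along the path point the same way, so the two signs are opposite. For odd `n`, `f 1` and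
    -- `f n` have the same parity and would agree on `c`. For even `n`, the complement of the path
    -- is an interval; this is absurd for `n ≡ 0`, and otherwise leaves only `c` outside, so that
    -- `f 0` dominates everything or nothing in `T − c`.
    ends-ext⊥ : ∀ {b b'} → Ext b (f 0) (f 1) → Ext b' (f (suc n)) (f n) → ⊥
    ends-ext⊥ {b} {b'} h h' = go n refl
      where
      inj : ∀ {i j} → i < j → j ≤ suc n → f i ≢ f j
      inj = path-injective n p
      open Zigzag {f} {suc n} (λ i lt → Path.tws p i (≤-pred lt)) inj
      e≡b : T (f 0) (f 1) ≡ b
      e≡b = ext-back h (inj ≤-refl z<s)
      b'≡notb : b' ≡ not b
      b'≡notb with ≡b∨≡not b' b
      ... | inj₂ e = e
      ... | inj₁ e = ⊥-elim (not-ext h' (≢-sym (inj ≤-refl ≤-refl)) (trans (adjacent n ≤-refl) (trans e≡b (sym e))))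
      fin : ∀ i → i ≤ suc n → c ≢ f i
      fin i le = ≢-sym (path-≢c p i le)
      go : ∀ k → k ≡ n → ⊥
      go zero refl with three-without (f 0) (f 1)
      ... | three {u} {v} Wu Wv _ u≢v _ _ = nontrivial⊥ indT (Without (f 0) (f 1)) (without? (f 0) (f 1)) iv u≢v tt tt tt Wu Wv
              (λ W → proj₁ W refl)
        where
        iv : ∀ {a b x} → ⊤ → ⊤ → ⊤ → Without (f 0) (f 1) a → Without (f 0) (f 1) b → ¬ Without (f 0) (f 1) x → T a x ≡ T b x
        iv {x = x} _ _ _ (a0 , a1) (b0 , b1) nx with x ≟ f 0 | x ≟ f 1
        ... | yes refl | _ = unflip a0 b0 (trans (h' a1 a0) (sym (h' b1 b0)))
        ... | no _ | yes refl = unflip a1 b1 (trans (h a0 a1) (sym (h b0 b1)))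
        ... | no n0 | no n1 = ⊥-elim (nx (n0 , n1))
      go (suc k) refl with ev n in en
      ... | false = b≢notb {b} (trans (sym (h (fin 0 z≤n) (fin 1 z<s))) (trans c-agree (trans (h' (fin (suc n) ≤-refl) (fin n (n≤1+n n))) b'≡notb)))
        where
        c-agree : T (f 1) c ≡ T (f n) c
        c-agree = sym (trans (outside (λ (i , le , e) → path-≢c p i le e) n (n≤1+n n)) (cong (λ b → if b then T (f 0) c else T (f 1) c) en))
      ... | true = constant⊥ indc (path-≢c p 0 z≤n) (path-≢c p 1 z<s) (path-≢c p 2 (s≤s z<s))
              (inj {1} {2} ≤-refl (s≤s z<s)) (≢-sym (inj {0} {1} ≤-refl z<s)) (≢-sym (inj {0} {2} z<s (s≤s z<s)))
              λ {w} {w'} nc nc' n0 n0' → trans (at (cover w nc) n0) (sym (at (cover w' nc') n0'))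
        where
        0<n : 0 < n
        0<n = z<s
        cover : ∀ v → v ≢ c → On f (suc n) v
        cover v v≢c with on? f (suc n) v
        ... | yes o = o
        ... | no nv = ⊥-elim (nontrivial⊥ indT (λ v → ¬ On f (suc n) v) (λ v → ¬? (on? f (suc n) v)) iv v≢c tt tt tt nv
                (λ (i , le , e) → path-≢c p i le e) (λ o → o (0 , z≤n , refl)))
          where
          ne : ∀ {v} → ¬ On f (suc n) v → ∀ i → i ≤ suc n → v ≢ f i
          ne nv i le e = nv (i , le , sym e)
          eq : ∀ {v} i → i ≤ suc n → ¬ On f (suc n) v → T (f i) v ≡ (if ev i then b' else b)
          eq {v} i le nv = trans (outside nv i le) (cong₂ (λ p q → if ev i then p else q)
            (trans (trans (cong (λ b → if b then T (f 0) v else T (f 1) v) (sym en)) (sym (outside nv n (n≤1+n n))))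
              (h' (ne nv (suc n) ≤-refl) (ne nv n (n≤1+n n)))) (h (ne nv 0 z≤n) (ne nv 1 z<s)))
          iv : ∀ {a b x} → ⊤ → ⊤ → ⊤ → ¬ On f (suc n) a → ¬ On f (suc n) b → ¬ ¬ On f (suc n) x → T a x ≡ T b x
          iv {x = x} _ _ _ na nb nnx with on? f (suc n) x
          ... | no nx = ⊥-elim (nnx nx)
          ... | yes (i , le , refl) = unflip (ne na i le) (ne nb i le) (trans (eq i le na) (sym (eq i le nb)))
        at : ∀ {w} → On f (suc n) w → w ≢ f 0 → T (f 0) w ≡ b
        at (zero , _ , refl) n0 = ⊥-elim (n0 refl)
        at (suc i , le , refl) _ = trans (arc z<s le) (bits (ev (suc i)))
          where
          bits : ∀ q → bit true q ≡ b
          bits false = e≡b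
          bits true = trans (sym (trans (arc 0<n (n≤1+n n)) (cong (bit true) en)))
            (opp′ (≢-sym (inj 0<n (n≤1+n n))) (trans (h' (inj {0} {suc n} z<s ≤-refl) (inj 0<n (n≤1+n n))) b'≡notb))

  -- A maximal path x 1, …, x (n + 2) of the indecomposability graph, preceded by c = x 0, to which its first
  -- end is attached.  The sign b tells whether the vertex next to the tip dominates or is dominated.
  record Arm (b : Bool) (x : ℕ → Fin m) (n : ℕ) : Set where
    field
      x0    : x 0 ≡ c
      edges : ∀ i → i ≤ n → Edge (x (suc i)) (x (suc (suc i)))
      tws   : ∀ i → suc (suc i) ≤ suc (suc n) → Tw (x (suc i)) (x i) (x (suc (suc i)))
      inj   : ∀ {i j} → i < j → j ≤ suc (suc n) → x i ≢ x j
      tip   : Ext b (x (suc (suc n))) (x (suc n))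

  Mem : (ℕ → Fin m) → ℕ → Fin m → Set
  Mem x n = On (λ i → x (suc i)) (suc n)

  private
    arm : ∀ {f n b} → Path f n → Tw (f 0) (f 1) c → Ext b (f (suc n)) (f n) → Arm b (c ◂ f) n
    arm p t h = record { x0 = refl ; edges = Path.edges p ; tws = x-tws p t ; inj = x-inj p ; tip = h }

  abstract
    -- Two ends attached to `c`, or none, are impossible; if the attached end comes last, the path
    -- is reversed.
    arm-at : ∀ {v w} → Edge v w → ∃ λ b → ∃₂ λ x n → Arm b x n × Mem x n v
    arm-at {v} e with maximal e
    ... | f , n , p , inj₁ (_ , h) , inj₁ (_ , h') , _ = ⊥-elim (ends-ext⊥ p h h')
    ... | f , n , p , inj₂ t , inj₂ t' , _ = ⊥-elim (ends-cc⊥ p t t')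
    ... | f , n , p , inj₂ t , inj₁ (b , h) , on = b , c ◂ f , n , arm p t h , on
    ... | f , n , p , inj₁ (b , h) , inj₂ t , (i , le , e) = b , c ◂ (λ i → f (suc n ∸ i)) , n ,
            arm (reverse p) t (subst₂ (λ j k → Ext b (f j) (f k)) (sym (n∸n≡0 n)) (sym (trans (∸-pred {n} {suc n} ≤-refl) (cong suc (n∸n≡0 n)))) h) ,
            (suc n ∸ i , m∸n≤m (suc n) i , trans (cong f (m∸[m∸n]≡n le)) e)

  -- Arms as components of the graph, at most one of each sign.

  arm-≢c : ∀ {b x n} → Arm b x n → ∀ {v} → Mem x n v → v ≢ c
  arm-≢c A (i , le , refl) e = Arm.inj A z<s (s≤s le) (trans (Arm.x0 A) (sym e))

  -- The twins apart from an inner vertex, and the extreme vertex next to the tip, leave no room for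
  -- a neighbour off the arm.
  arm-closed : ∀ {b x n} → Arm b x n → ∀ {v w} → Mem x n v → Edge v w → Mem x n w
  arm-closed {b} {x} {n} A {v} {w} (i , le , refl) e with m≤n⇒m<n∨m≡n le
  ... | inj₂ refl with w ≟ x (suc n)
  ...   | yes refl = n , n≤1+n n , refl
  ...   | no w≢ = ⊥-elim (edge-no-ext b e (inj ≤-refl ≤-refl) (≢-sym w≢) λ a _ d → tip a d)
    where open Arm A
  arm-closed {b} {x} {n} A {v} {w} (i , le , refl) e | inj₁ lt with w ≟ x (suc (suc i)) | w ≟ x i
  ... | yes refl | _ = suc i , lt , refl
  ... | no n₁ | no n₂ = ⊥-elim (edge-no-twins e (Arm.tws A i (s≤s lt)) (≢-sym n₂) (≢-sym n₁))
  arm-closed A (zero , le , refl) e | inj₁ lt | no _ | yes refl = ⊥-elim (Edge.y≢c e (Arm.x0 A))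
  arm-closed A (suc i , le , refl) e | inj₁ lt | no _ | yes refl = i , ≤-trans (n≤1+n i) le , refl

  private
    down : ∀ {P : ℕ → Set} k → (∀ i → i ≤ k → P (suc i) → P i) → P (suc k) → ∀ i → i ≤ suc k → P i
    down k f p i le with m≤n⇒m<n∨m≡n le
    ... | inj₂ refl = p
    down zero f p zero le | inj₁ _ = f 0 z≤n p
    down zero f p (suc i) le | inj₁ (s≤s ())
    down (suc k) f p i le | inj₁ (s≤s lt) = down k (λ i le → f i (≤-trans le (n≤1+n k))) (f (suc k) ≤-refl p) i lt

    up : ∀ {P : ℕ → Set} k → (∀ i → i ≤ k → P i → P (suc i)) → ∀ d i → d + i ≤ suc k → P i → P (d + i)
    up k f zero i le p = p
    up k f (suc d) i le p = f (d + i) (≤-pred le) (up k f d i (<⇒≤ le) p)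

  arm-⊆ : ∀ {b x n b' y k} → Arm b x n → Arm b' y k → Mem x n (y (suc (suc k))) → ∀ {v} → Mem y k v → Mem x n v
  arm-⊆ {x = x} {n} {y = y} {k} A B h (i , le , refl) =
    down {λ i → Mem x n (y (suc i))} k (λ i le h → arm-closed A h (edge-sym (Arm.edges B i le))) h i le

  module _ {b x n b' y k} (A : Arm b x n) (B : Arm b' y k) where

    private
      module A = Arm A
      module B = Arm B
      τ τ' α α' : Fin m
      τ = x (suc (suc n))
      τ' = y (suc (suc k))
      α = x (suc n)
      α' = y (suc k)
      τα : Edge τ α
      τα = edge-sym (A.edges n ≤-refl)
      τα' : Edge τ' α'
      τα' = edge-sym (B.edges k ≤-refl)

    -- The vertex next to the tip is the only neighbour of the tip, and it dominates all the other vertices or none.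
    same-tips : b ≡ b' → τ' ≡ τ × α' ≡ α
    same-tips refl with τ ≟ τ' | α ≟ α'
    ... | yes e | yes e' = sym e , sym e'
    ... | yes e | no ne = ⊥-elim (edge-no-ext {v = α} b τα' (λ e' → Edge.x≢y τα (trans e (sym e'))) ne λ p _ q → A.tip (λ e' → p (trans e' e)) q)
    ... | no ne | yes e = ⊥-elim (not-ext A.tip (Edge.x≢y τα) (trans (cong (λ v → T v τ) e) (B.tip ne (λ e' → Edge.x≢y τα (trans e' (sym e))))))
    ... | no ne | no ne' with α' ≟ τ | α ≟ τ'
    ...   | yes e | no n₂ = ⊥-elim (edge-no-ext {v = α} b τα' n₂ ne' λ {u} p q r → A.tip (λ e' → q (trans e' (sym e))) r)
    ...   | no n₁ | yes e = ⊥-elim (edge-no-ext {v = α'} b τα n₁ (≢-sym ne') λ {u} p q r → B.tip (λ e' → q (trans e' (sym e))) r)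
    ...   | no n₁ | no n₂ = ⊥-elim (b≢notb {b} (trans (sym (B.tip n₂ ne')) (opp ne' (A.tip n₁ (≢-sym ne')))))
    ...   | yes e | yes e' = ⊥-elim (not-ext B.tip (Edge.x≢y τα')
              (trans (cong₂ T e (sym e')) (ext-back A.tip (Edge.x≢y τα))))

    -- Such a twin would dominate everything or nothing in the indecomposable complement of `τ'` and
    -- `α'`.
    no-twin-of-α' : ∀ {r} → ¬ Tw τ' α' r
    no-twin-of-α' (twins _ τ'≢r α'≢r t) = edge-no-ext b' τα' (≢-sym τ'≢r) (≢-sym α'≢r) λ p q r → trans (sym (t p q r)) (B.tip p q)

    -- If `τ'` were the tip of the first arm, `α` and `α'` would coincide and have both signs. If it
    -- were an earlier vertex, its neighbour `α'` would be one of the twins apart from `τ'`.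
    opposite-tip : b' ≡ not b → ¬ Mem x n τ'
    opposite-tip b'≡ (i , le , e) with m≤n⇒m<n∨m≡n le
    ... | inj₂ refl with α ≟ α'
    ...   | no ne = edge-no-ext b (subst (λ v → Edge v α') (sym e) τα') (≢-sym (Edge.x≢y τα)) ne λ p _ q → A.tip p q
    ...   | yes eα with fresh τ α τ α
    ...     | r , r1 , r2 , _ = b≢notb {b} (trans (sym (A.tip r1 r2)) (trans (cong (λ v → T v r) eα)
                (trans (B.tip (λ e' → r1 (trans e' (sym e))) (λ e' → r2 (trans e' (sym eα)))) b'≡)))
    opposite-tip b'≡ (i , le , e) | inj₁ lt with x i ≟ α' | x (suc (suc i)) ≟ α'
    ... | no n₁ | no n₂ = edge-no-twins (subst (λ v → Edge v α') (sym e) τα') (A.tws i (s≤s lt)) n₁ n₂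
    ... | yes e' | _ = no-twin-of-α' (subst₂ (λ p q → Tw p q (x (suc (suc i)))) e e' (A.tws i (s≤s lt)))
    ... | no _ | yes e' = no-twin-of-α' (subst₂ (λ p q → Tw p q (x i)) e e' (tw-sym (A.tws i (s≤s lt))))

    arm-unique : b ≡ b' → ∀ {v} → Mem y k v → Mem x n v
    arm-unique e = arm-⊆ A B (subst (Mem x n) (sym (proj₁ (same-tips e))) (suc n , ≤-refl , refl))

    arm-disjoint : b' ≡ not b → ∀ {v} → Mem x n v → ¬ Mem y k v
    arm-disjoint e h (i , le , refl) = opposite-tip e (subst (λ j → Mem x n (y (suc j))) (m∸n+n≡m le)
      (up {λ i → Mem x n (y (suc i))} k (λ i le h → arm-closed A h (B.edges i le)) (suc k ∸ i) i
        (subst (_≤ suc k) (sym (m∸n+n≡m le)) ≤-refl) h))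

  -- Arcs within an arm and arcs leaving it.

  module Facts {b : Bool} {x : ℕ → Fin m} {n : ℕ} (A : Arm b x n) where
    open Arm A public
    open Zigzag {x} {suc (suc n)} tws inj public

    mem? : ∀ v → Dec (Mem x n v)
    mem? = on? (λ i → x (suc i)) (suc n)

    mem : ∀ i → i ≤ suc n → Mem x n (x (suc i))
    mem i le = i , le , refl

    mem-≢c : ∀ {v} → Mem x n v → v ≢ c
    mem-≢c = arm-≢c A

    ≢c : ∀ i → i ≤ suc n → x (suc i) ≢ c
    ≢c i le = mem-≢c (mem i le)

    not-on : ∀ {z} → ¬ Mem x n z → z ≢ c → ¬ On x (suc (suc n)) z
    not-on nm z≢c (zero , _ , e) = z≢c (trans (sym e) x0)
    not-on nm z≢c (suc i , s≤s le , e) = nm (i , le , e)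

    off : ∀ {z} → ¬ Mem x n z → ∀ i → i ≤ suc n → x (suc i) ≢ z
    off nm i le refl = nm (mem i le)

    first : T (x 0) (x 1) ≡ not b
    first = trans (sym (adjacent (suc n) ≤-refl))
      (opp (≢-sym (inj ≤-refl ≤-refl)) (ext-back tip (≢-sym (inj ≤-refl ≤-refl))))

    mixed : ∀ {i j} → i < j → j ≤ suc (suc n) → ev j ≡ not (ev i) → T (x i) (x j) ≡ not b
    mixed {i} lt le e = trans (arc lt le) (trans (cong (bit (ev i)) e) (trans (bit-opp (ev i)) first))

    -- The bit for this parity is read off at `x (suc n)`, all of whose arcs are known from `tip`
    -- except the one to the tip itself.
    tip-arc : ∀ {i j} → i < j → j ≤ suc (suc n) → ev i ≡ ev (suc n) → ev j ≡ ev (suc n) → T (x i) (x j) ≡ not b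
    tip-arc {i} {j} lt le ei ej = trans (arc lt le) (trans (cong₂ bit ei ej) (trans (sym (trans (arc i<n (n≤1+n _)) (cong (λ p → bit p (ev (suc n))) ei)))
      (opp (≢-sym (inj i<n (n≤1+n _))) (tip (inj (≤-trans i<n (n≤1+n _)) ≤-refl) (inj i<n (n≤1+n _))))))
      where
      j<L : j < suc (suc n)
      j<L = ≤∧≢⇒< le λ { refl → b≢notb (trans (ev-not n) (cong not (sym ej))) }
      i<n : i < suc n
      i<n = ≤-trans lt (≤-pred j<L)

    out-tip : ∀ {z} → ¬ Mem x n z → z ≢ c → ∀ i → i ≤ suc (suc n) → ev i ≡ ev (suc n) → T (x i) z ≡ b
    out-tip {z} nm z≢c i le e = trans (outside nz i le) (trans (cong (λ p → if p then T (x 0) z else T (x 1) z) e)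
      (trans (sym (outside nz (suc n) (n≤1+n _))) (tip (≢-sym (off nm (suc n) ≤-refl)) (≢-sym (off nm n (n≤1+n n))))))
      where
      nz : ¬ On x (suc (suc n)) z
      nz = not-on nm z≢c

    out-same : ∀ {z} → ¬ Mem x n z → z ≢ c → ∀ i j → i ≤ suc (suc n) → j ≤ suc (suc n) → ev i ≡ ev j → T (x i) z ≡ T (x j) z
    out-same {z} nm z≢c i j le le' e = trans (outside nz i le) (trans (cong (λ p → if p then T (x 0) z else T (x 1) z) e) (sym (outside nz j le')))
      where
      nz : ¬ On x (suc (suc n)) z
      nz = not-on nm z≢c

    -- The index 0 of `c` has the parity of the vertex next to the tip, which fixes the arcs at `c`.
    -- The bit `s` between odd indices remains: `not b` gives a linear side, `b` a side like U.
    module OddArm (od : ev (suc n) ≡ true) where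

      s : Bool
      s = bit false false

      free : ∀ {i j} → i < j → j ≤ suc (suc n) → ev i ≡ false → ev j ≡ false → T (x i) (x j) ≡ s
      free lt le ei ej = trans (arc lt le) (cong₂ bit ei ej)

      even-arc : ∀ {i j} → i < j → j ≤ suc (suc n) → ev j ≡ true → T (x i) (x j) ≡ not b
      even-arc {i} lt le ej with ev i in ei
      ... | true = tip-arc lt le (trans ei (sym od)) (trans ej (sym od))
      ... | false = mixed lt le (trans ej (cong not (sym ei)))

      even-arc′ : ∀ {i j} → i < j → j ≤ suc (suc n) → ev i ≡ true → T (x i) (x j) ≡ not b
      even-arc′ {i} {j} lt le ei with ev j in ej
      ... | true = tip-arc lt le (trans ei (sym od)) (trans ej (sym od))
      ... | false = mixed lt le (trans ej (cong not (sym ei)))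

      c-in : ∀ {v} → Mem x n v → T v c ≡ b
      c-in {v} (i , le , refl) = subst (λ u → T (x (suc i)) u ≡ b) x0
        (opp′ (inj z<s (s≤s le)) (even-arc′ {0} {suc i} z<s (s≤s le) refl))

      c-out : ∀ {z} → ¬ Mem x n z → z ≢ c → T c z ≡ b
      c-out {z} nm z≢c = subst (λ u → T u z ≡ b) x0 (out-tip nm z≢c 0 z≤n (sym od))

      even-out : ∀ {z} → ¬ Mem x n z → z ≢ c → ∀ i → i ≤ suc (suc n) → ev i ≡ true → T (x i) z ≡ b
      even-out nm z≢c i le e = out-tip nm z≢c i le (trans e (sym od))

      -- The vertices of the 3-cycle other than c lie on different sides of the arm.
      module Cycle {u z : Fin m} (C : Cyc b u z) where
        open Cyc C

        u∈ : Mem x n u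
        u∈ with mem? u
        ... | yes h = h
        ... | no nu = ⊥-elim (b≢notb (trans (sym uc) (opp (≢-sym u≢c) (c-out nu u≢c))))

        z∉ : ¬ Mem x n z
        z∉ h = b≢notb (trans (sym cz) (opp z≢c (c-in h)))

        odd-z : ∀ i → i ≤ suc (suc n) → ev i ≡ false → T (x i) z ≡ not b
        odd-z i le ei with u∈
        ... | j , le' , refl with ev (suc j) in ej
        ...   | true = ⊥-elim (b≢notb (trans (sym zu) (opp u≢z (even-out z∉ z≢c (suc j) (s≤s le') ej))))
        ...   | false = trans (out-same z∉ z≢c i (suc j) le (s≤s le') (trans ei (sym ej))) (opp (≢-sym u≢z) zu)

    -- Here `c` has the other parity: the vertices of even index look like `c` from outside, and `s`
    -- is the bit among them and `c`. With `s ≡ b` the vertices `c`, `x 1`, `x 2` form a 3-cycle;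
    -- with `not b` the arm is linear.
    module EvenArm (od : ev (suc n) ≡ false) where

      s : Bool
      s = bit true true

      free : ∀ {i j} → i < j → j ≤ suc (suc n) → ev i ≡ true → ev j ≡ true → T (x i) (x j) ≡ s
      free lt le ei ej = trans (arc lt le) (cong₂ bit ei ej)

      odd-arc : ∀ {i j} → i < j → j ≤ suc (suc n) → ev i ≡ false → T (x i) (x j) ≡ not b
      odd-arc {i} {j} lt le ei with ev j in ej
      ... | false = tip-arc lt le (trans ei (sym od)) (trans ej (sym od))
      ... | true = mixed lt le (trans ej (cong not (sym ei)))

      odd-out : ∀ {z} → ¬ Mem x n z → z ≢ c → ∀ i → i ≤ suc (suc n) → ev i ≡ false → T (x i) z ≡ b
      odd-out nm z≢c i le e = out-tip nm z≢c i le (trans e (sym od))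

      like-c : ∀ {z} → ¬ Mem x n z → z ≢ c → ∀ i → i ≤ suc (suc n) → ev i ≡ true → T (x i) z ≡ T c z
      like-c {z} nm z≢c i le e = trans (out-same nm z≢c i 0 le z≤n e) (cong (λ u → T u z) x0)

      c-two : T c (x 2) ≡ s
      c-two = cong (λ v → T v (x 2)) (sym x0)

      wrong-cycle : s ≡ b → Cyc b (x 1) (x 2)
      wrong-cycle e = cyc (≢c 0 z≤n) (≢c 1 z<s) (inj ≤-refl (s≤s z<s))
        (opp′ (≢-sym (≢c 0 z≤n)) (trans (cong (λ v → T v (x 1)) (sym x0)) first))
        (trans c-two e) (opp′ (inj ≤-refl (s≤s z<s)) (odd-arc {1} {2} ≤-refl (s≤s z<s) refl))

      module Right (r : s ≡ not b) where

        all-arc : ∀ {i j} → i < j → j ≤ suc (suc n) → T (x i) (x j) ≡ not b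
        all-arc {i} {j} lt le with ev i in ei
        ... | false = odd-arc lt le ei
        ... | true with ev j in ej
        ...   | true = trans (free lt le ei ej) r
        ...   | false = mixed lt le (trans ej (cong not (sym ei)))

        c-in : ∀ {v} → Mem x n v → T v c ≡ b
        c-in {v} (i , le , refl) = subst (λ u → T (x (suc i)) u ≡ b) x0
          (opp′ (inj z<s (s≤s le)) (all-arc {0} {suc i} z<s (s≤s le)))

        all-out : ∀ {z} → ¬ Mem x n z → z ≢ c → T c z ≡ b → ∀ i → i ≤ suc (suc n) → T (x i) z ≡ b
        all-out nm z≢c cz i le with ev i in ei
        ... | true = trans (like-c nm z≢c i le ei) cz
        ... | false = odd-out nm z≢c i le ei

        module Cycle {u z : Fin m} (C : Cyc b u z) where
          open Cyc C

          z∉ : ¬ Mem x n z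
          z∉ h = b≢notb (trans (sym cz) (opp z≢c (c-in h)))

          u∉ : ¬ Mem x n u
          u∉ (i , le , e) = b≢notb (trans (sym zu) (opp u≢z (subst (λ u → T u z ≡ b) e (all-out z∉ z≢c cz (suc i) (s≤s le)))))

  -- Existence of an arm of the opposite sign.

  other-arm : ∀ {b x n} → Arm b x n → ∀ {β u z} → Cyc β u z → ∀ {v} → v ≢ c → v ≢ u → v ≢ z → ¬ Mem x n v →
    ∃₂ λ y k → Arm (not b) y k
  other-arm {b} A C v≢c v≢u v≢z nm with FromCycle.neighbour C v≢c v≢u v≢z
  ... | w , e with arm-at e
  ... | b' , y , k , B , h with ≡b∨≡not b' b
  ...   | inj₁ eq = ⊥-elim (nm (arm-unique A B (sym eq) h))
  ...   | inj₂ refl = y , k , B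

  -- Otherwise `T` consists of `c`, the arm and at most two more vertices of a 3-cycle. Then in
  -- `T − c` the vertex `x 1` dominates everything or nothing, or is a twin of `z`.
  second-arm : ∀ {b x n} → Arm b x n → ∃₂ λ y k → Arm (not b) y k
  second-arm {b} {x} {n} A = go (ev (suc n)) refl
    where
    open Facts A
    go : ∀ p → ev (suc n) ≡ p → ∃₂ λ y k → Arm (not b) y k
    go true od with cyc-exists b
    ... | u , z , C with any? (λ v → ¬? (v ≟ c) ×-dec ¬? (mem? v) ×-dec ¬? (v ≟ z))
    ...   | yes (v , v≢c , nm , v≢z) = other-arm A C v≢c (λ { refl → nm (OddArm.Cycle.u∈ od C) }) v≢z nm
    ...   | no none = ⊥-elim (contra (≡b∨≡not s b))
      where
      open OddArm od
      open Cycle C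
      open Cyc C
      data In (w : Fin m) : Set where
        here : ∀ i → i ≤ suc n → x (suc i) ≡ w → In w
        isz  : w ≡ z → In w
      cover : ∀ {w} → w ≢ c → In w
      cover {w} w≢c with mem? w | w ≟ z
      ... | yes (i , le , e) | _ = here i le e
      ... | no _ | yes e = isz e
      ... | no nm | no w≢z = ⊥-elim (none (w , w≢c , nm , w≢z))
      z≢ : ∀ i → i ≤ suc n → z ≢ x (suc i)
      z≢ i le = ≢-sym (off z∉ i le)
      z1 : T (x 1) z ≡ not b
      z1 = odd-z 1 z<s refl
      contra : s ≡ b ⊎ s ≡ not b → ⊥
      contra (inj₂ e) = constant⊥ indc {x 1} {x 2} {z} (≢c 0 z≤n) (≢c 1 z<s) z≢c (≢-sym (z≢ 1 z<s))
          (≢-sym (inj ≤-refl (s≤s z<s))) (z≢ 0 z≤n)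
          λ w≢c w'≢c n₁ n₁' → trans (at (cover w≢c) n₁) (sym (at (cover w'≢c) n₁'))
        where
        at : ∀ {w} → In w → w ≢ x 1 → T (x 1) w ≡ not b
        at (isz refl) _ = z1
        at (here zero _ refl) n₁ = ⊥-elim (n₁ refl)
        at (here (suc i) le refl) _ with ev i in ei
        ... | true = even-arc (s≤s z<s) (s≤s le) ei
        ... | false = trans (free (s≤s z<s) (s≤s le) refl ei) e
      contra (inj₁ e) = twins⊥ indc {x 1} {z} {x 2} (≢-sym (z≢ 0 z≤n)) (≢c 0 z≤n) z≢c (≢c 1 z<s)
          (≢-sym (inj ≤-refl (s≤s z<s))) (≢-sym (z≢ 1 z<s)) λ w≢c → at (cover w≢c)
        where
        at : ∀ {w} → In w → w ≢ x 1 → w ≢ z → T (x 1) w ≡ T z w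
        at (isz refl) _ n₂ = ⊥-elim (n₂ refl)
        at (here zero _ refl) n₁ _ = ⊥-elim (n₁ refl)
        at (here (suc i) le refl) _ _ with ev i in ei
        ... | true = trans (even-arc (s≤s z<s) (s≤s le) ei)
                (sym (opp (≢-sym (z≢ (suc i) le)) (even-out z∉ z≢c (suc (suc i)) (s≤s le) ei)))
        ... | false = trans (free (s≤s z<s) (s≤s le) refl ei) (trans e
                (sym (opp′ (≢-sym (z≢ (suc i) le)) (odd-z (suc (suc i)) (s≤s le) ei))))
    go false od with ≡b∨≡not (EvenArm.s od) b
    ... | inj₁ wrong with any? (λ v → ¬? (v ≟ c) ×-dec ¬? (mem? v))
    ...   | yes (v , v≢c , nm) = other-arm A (EvenArm.wrong-cycle od wrong) v≢c (λ { refl → nm (mem 0 z≤n) }) (λ { refl → nm (mem 1 z<s) }) nm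
    ...   | no none with fresh c (x 1) (x 2) (x 2)
    ...     | r , r≢c , r≢1 , r≢2 , _ = ⊥-elim (constant⊥ indc {x 1} {x 2} {r} (≢c 0 z≤n) (≢c 1 z<s) r≢c (≢-sym r≢2)
                (≢-sym (inj ≤-refl (s≤s z<s))) r≢1 λ w≢c w'≢c n₁ n₁' → trans (at w≢c n₁) (sym (at w'≢c n₁')))
      where
      open EvenArm od
      at : ∀ {w} → w ≢ c → w ≢ x 1 → T (x 1) w ≡ not b
      at {w} w≢c n₁ with mem? w
      ... | no nm = ⊥-elim (none (w , w≢c , nm))
      ... | yes (zero , _ , e) = ⊥-elim (n₁ (sym e))
      ... | yes (suc i , le , refl) = odd-arc (s≤s z<s) (s≤s le) refl
    go false od | inj₂ r with cyc-exists b
    ... | u , z , C with any? (λ v → ¬? (v ≟ c) ×-dec ¬? (mem? v) ×-dec ¬? (v ≟ u) ×-dec ¬? (v ≟ z))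
    ...   | yes (v , v≢c , nm , v≢u , v≢z) = other-arm A C v≢c v≢u v≢z nm
    ...   | no none = ⊥-elim (twins⊥ indc {x 1} {z} {x 2} (off z∉ 0 z≤n) (≢c 0 z≤n) z≢c (≢c 1 z<s)
              (≢-sym (inj ≤-refl (s≤s z<s))) (off z∉ 1 z<s) at)
      where
      open EvenArm od
      open Right r
      open Cycle C
      open Cyc C
      at : ∀ {w} → w ≢ c → w ≢ x 1 → w ≢ z → T (x 1) w ≡ T z w
      at {w} w≢c n₁ n₂ with mem? w | w ≟ u
      ... | yes (zero , _ , e) | _ = ⊥-elim (n₁ (sym e))
      ... | yes (suc i , le , refl) | _ = trans (all-arc (s≤s z<s) (s≤s le))
              (sym (opp (off z∉ (suc i) le) (all-out z∉ z≢c cz (suc (suc i)) (s≤s le))))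
      ... | no _ | yes refl = trans (odd-out u∉ u≢c 1 z<s refl) (sym zu)
      ... | no nm | no w≢u = ⊥-elim (none (w , w≢c , nm , w≢u , n₂))

  -- From arms to sides of the listed tournaments.

  module _ {b : Bool} {x : ℕ → Fin m} {n : ℕ} (A : Arm b x n) (od : ev (suc n) ≡ true) where
    open Facts A
    open OddArm od

    -- Number `i` of the side is index `i + 1` of the arm, so the odd indices, among which the free
    -- bit lives, become the even numbers.
    flat-side : ∀ t → s ≡ sgn b (not t) → ∀ {i j} → j < i → i ≤ suc n →
      x (suc i) ≢ x (suc j) × T (x (suc j)) (x (suc i)) ≡ sgn (not b) (sideArc (flat t) i j)
    flat-side t e {i} {j} lt le = ≢-sym (inj (s≤s lt) (s≤s le)) , go t e
      where
      go : ∀ t → s ≡ sgn b (not t) → T (x (suc j)) (x (suc i)) ≡ sgn (not b) (sideArc (flat t) i j)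
      go t e with ev j in ej | ev i in ei
      go true e | false | _ rewrite <ᵇ-true lt = even-arc′ (s≤s lt) (s≤s le) (ev-suc-true {j} ej)
      go true e | true | false rewrite <ᵇ-true lt = even-arc (s≤s lt) (s≤s le) (ev-suc-true {i} ei)
      go true e | true | true rewrite <ᵇ-true lt = trans (free (s≤s lt) (s≤s le) (ev-suc-false {j} ej) (ev-suc-false {i} ei)) e
      go false e | false | p rewrite <ᵇ-true lt | ej | ei | ∧-comm p false = even-arc′ (s≤s lt) (s≤s le) (ev-suc-true {j} ej)
      go false e | true | false rewrite <ᵇ-true lt | ej | ei = even-arc (s≤s lt) (s≤s le) (ev-suc-true {i} ei)
      go false e | true | true rewrite <ᵇ-true lt | ej | ei =
        trans (free (s≤s lt) (s≤s le) (ev-suc-false {j} ej) (ev-suc-false {i} ei)) (trans e (sym (not-involutive b)))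

  module _ {b : Bool} {x : ℕ → Fin m} {n : ℕ} (A : Arm b x n) (od : ev (suc n) ≡ false) where
    open Facts A
    open EvenArm od

    -- An even arm lacks one vertex for a side. The vertex `a` takes the exceptional number 0, so
    -- that numbers and indices on the arm agree.
    V-side : s ≡ not b → ∀ {a} → ¬ Mem x n a → a ≢ c → T c a ≡ not b → ∀ {i j} → j < i → i ≤ suc (suc n) →
      (a ◂ λ i → x (suc i)) i ≢ (a ◂ λ i → x (suc i)) j ×
      T ((a ◂ λ i → x (suc i)) j) ((a ◂ λ i → x (suc i)) i) ≡ sgn (not b) (sideArc V i j)
    V-side r {a} a∉ a≢c ca {suc i} {zero} lt (s≤s le) = off a∉ i le , go
      where
      go : T a (x (suc i)) ≡ sgn (not b) (not (ev (suc i)))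
      go with ev (suc i) in ei
      ... | true = opp (off a∉ i le) (trans (like-c a∉ a≢c (suc i) (s≤s le) ei) ca)
      ... | false = opp (off a∉ i le) (odd-out a∉ a≢c (suc i) (s≤s le) ei)
    V-side r a∉ a≢c ca {suc i} {suc j} (s≤s lt) le rewrite <ᵇ-true lt =
      ≢-sym (inj (s≤s lt) le) , Right.all-arc r (s≤s lt) le

  module TwoArms {b b' : Bool} {x y : ℕ → Fin m} {n k : ℕ} (A : Arm b x n) (B : Arm b' y k) (b'≡ : b' ≡ not b) where

    private
      module A = Facts A
      module B = Facts B

    not-b' : not b' ≡ b
    not-b' = trans (cong not b'≡) (not-involutive b)

    oppB : ∀ {u v} → u ≢ v → T u v ≡ b' → T v u ≡ b
    oppB n e = trans (opp n e) not-b'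

    disjoint : ∀ {v} → Mem x n v → ¬ Mem y k v
    disjoint = arm-disjoint A B b'≡

    disjoint′ : ∀ {v} → Mem y k v → ¬ Mem x n v
    disjoint′ h h' = disjoint h' h

    x≢y : ∀ {i j} → i ≤ suc n → j ≤ suc k → x (suc i) ≢ y (suc j)
    x≢y {i} {j} le le' = A.off (disjoint′ (B.mem j le')) i le

    x∉ : ∀ i → i ≤ suc n → ¬ Mem y k (x (suc i))
    x∉ i le = disjoint (A.mem i le)

    y∉ : ∀ i → i ≤ suc k → ¬ Mem x n (y (suc i))
    y∉ i le = disjoint′ (B.mem i le)

    abstract
      -- A vertex off the cycle has a neighbour and hence lies on an arm, and each sign belongs to
      -- only one arm.
      member : ∀ {β u z} → Cyc β u z → ∀ {v} → v ≢ c → v ≢ u → v ≢ z → Mem x n v ⊎ Mem y k v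
      member C v≢c v≢u v≢z with FromCycle.neighbour C v≢c v≢u v≢z
      ... | w , e with arm-at e
      ... | b″ , x″ , n″ , D , h with ≡b∨≡not b″ b
      ...   | inj₁ eq = inj₁ (arm-unique A D (sym eq) h)
      ...   | inj₂ eq = inj₂ (arm-unique B D (trans b'≡ (sym eq)) h)

    module OddOdd (od : ev (suc n) ≡ true) (od' : ev (suc k) ≡ true) where

      private
        module AO = A.OddArm od
        module BO = B.OddArm od'

      -- For a vertex off both arms, the arc from `c` would have both signs.
      cover : ∀ {v} → v ≢ c → Mem x n v ⊎ Mem y k v
      cover {v} v≢c with A.mem? v | B.mem? v
      ... | yes h | _ = inj₁ h
      ... | no _ | yes h = inj₂ h
      ... | no nx | no ny = ⊥-elim (b≢notb (trans (sym (AO.c-out nx v≢c)) (trans (BO.c-out ny v≢c) b'≡)))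

      cross : ∀ i j → i ≤ suc n → j ≤ suc k → (ev i ∧ ev j) ≡ false → T (x (suc i)) (y (suc j)) ≡ b
      cross i j le le' e with ev i in ei | ev j in ej
      ... | false | _ = AO.even-out (y∉ j le') (B.≢c j le') (suc i) (s≤s le) (ev-suc-true {i} ei)
      ... | true | false = oppB (≢-sym (x≢y le le')) (BO.even-out (x∉ i le) (A.≢c i le) (suc j) (s≤s le') (ev-suc-true {j} ej))

      cross-same : ∀ i j → i ≤ suc n → j ≤ suc k → ev i ≡ true → ev j ≡ true → T (x (suc i)) (y (suc j)) ≡ T (x 1) (y 1)
      cross-same i j le le' ei ej = trans (A.out-same (y∉ j le') (B.≢c j le') (suc i) 1 (s≤s le) z<s (ev-suc-false {i} ei))
        (flip (≢-sym (x≢y z≤n le')) (≢-sym (x≢y z≤n z≤n))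
          (B.out-same (x∉ 0 z≤n) (A.≢c 0 z≤n) (suc j) 1 (s≤s le') z<s (ev-suc-false {j} ej)))

      -- With the other value the whole first arm would be an interval: it already looks uniform
      -- from `c` and from the other pairs of parities.
      cross-odd : ∀ i j → i ≤ suc n → j ≤ suc k → ev i ≡ true → ev j ≡ true → T (x (suc i)) (y (suc j)) ≡ not b
      cross-odd i j le le' ei ej with ≡b∨≡not (T (x 1) (y 1)) b
      ... | inj₂ e = trans (cross-same i j le le' ei ej) e
      ... | inj₁ e = ⊥-elim (nontrivial⊥ indT (Mem x n) A.mem? (λ _ _ _ Pa Pb nw → trans (eq Pa nw) (sym (eq Pb nw)))
              (A.inj ≤-refl (s≤s z<s)) tt tt tt (A.mem 0 z≤n) (A.mem 1 z<s) (λ h → A.mem-≢c h refl))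
        where
        eq : ∀ {a w} → Mem x n a → ¬ Mem x n w → T a w ≡ b
        eq {w = w} h nw with w ≟ c
        ... | yes refl = AO.c-in h
        ... | no w≢c with cover w≢c
        ...   | inj₁ h' = ⊥-elim (nw h')
        eq (i , le , refl) nw | no w≢c | inj₂ (j , le' , refl) with ev i in ei | ev j in ej
        ...     | true | true = trans (cross-same i j le le' ei ej) e
        ...     | false | _ = cross i j le le' (cong (_∧ ev j) ei)
        ...     | true | false = cross i j le le' (trans (cong₂ _∧_ ei ej) refl)

      -- The first vertices of the two arms would be twins in `T − c`; the same pair refutes the
      -- cases of `O⊥` and `wrong⊥`.
      UU⊥ : AO.s ≡ b → BO.s ≡ b' → ⊥
      UU⊥ e e' = twins⊥ indc {x 1} {y 1} {x 2} (x≢y z≤n z≤n) (A.≢c 0 z≤n) (B.≢c 0 z≤n) (A.≢c 1 z<s)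
          (≢-sym (A.inj ≤-refl (s≤s z<s))) (x≢y z<s z≤n) λ w≢c → at (cover w≢c)
        where
        at : ∀ {w} → Mem x n w ⊎ Mem y k w → w ≢ x 1 → w ≢ y 1 → T (x 1) w ≡ T (y 1) w
        at (inj₁ (zero , _ , refl)) n₁ _ = ⊥-elim (n₁ refl)
        at (inj₂ (zero , _ , refl)) _ n₂ = ⊥-elim (n₂ refl)
        at (inj₁ (suc i , le , refl)) _ _ with ev i in ei
        ... | true = trans (AO.even-arc (s≤s z<s) (s≤s le) ei)
                (sym (opp (x≢y le z≤n) (cross (suc i) 0 le z≤n (trans (∧-comm (ev (suc i)) true) (ev-suc-false {i} ei)))))
        ... | false = trans (AO.free (s≤s z<s) (s≤s le) refl ei)
                (trans e (sym (opp′ (x≢y le z≤n) (cross-odd (suc i) 0 le z≤n (ev-suc-true {i} ei) refl))))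
        at (inj₂ (suc j , le , refl)) _ _ with ev j in ej
        ... | true = trans (cross 0 (suc j) z≤n le (ev-suc-false {j} ej))
                (sym (trans (BO.even-arc (s≤s z<s) (s≤s le) ej) not-b'))
        ... | false = trans (cross-odd 0 (suc j) z≤n le refl (ev-suc-true {j} ej))
                (sym (trans (BO.free (s≤s z<s) (s≤s le) refl ej) (trans e' b'≡)))

      model : ∀ t t' → AO.s ≡ sgn b (not t) → BO.s ≡ sgn b' (not t') → SomeModel (orient b T) (flat t) (flat t') c
      model t t' e e' with suc≡dbl n od | suc≡dbl k od'
      ... | p , eqp | q , eqq = p , q , mk-model tour b (flat t) (flat t') p q (λ i → x (suc i)) (λ j → y (suc j))
            (λ lt le → flat-side A od t e lt (toA le))
            (λ {i} {j} lt le → let (d , a) = flat-side B od' t' e' lt (toB le)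
                               in d , subst (λ β → T (y (suc j)) (y (suc i)) ≡ sgn β (sideArc (flat t') i j)) not-b' a)
            (λ {i} le → A.≢c i (toA le) , AO.c-in (A.mem i (toA le)))
            (λ {j} le → B.≢c j (toB le) , oppB (B.≢c j (toB le)) (BO.c-in (B.mem j (toB le))))
            (λ le le' → x≢y (toA le) (toB le') , pq (toA le) (toB le'))
            cov
        where
        toA : ∀ {i} → i ≤ dbl (suc p) → i ≤ suc n
        toA {i} = subst (i ≤_) (sym eqp)
        toB : ∀ {i} → i ≤ dbl (suc q) → i ≤ suc k
        toB {i} = subst (i ≤_) (sym eqq)
        pq : ∀ {i j} → i ≤ suc n → j ≤ suc k → T (x (suc i)) (y (suc j)) ≡ sgn b (not (special (flat t) i ∧ special (flat t') j))
        pq {i} {j} le le' rewrite special-flat t i | special-flat t' j with ev i in ei | ev j in ej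
        ... | true | true = cross-odd i j le le' ei ej
        ... | true | false = cross i j le le' (cong₂ _∧_ ei ej)
        ... | false | _ = cross i j le le' (cong (_∧ ev j) ei)
        cov : ∀ v → v ≢ c → (∃ λ i → i ≤ dbl (suc p) × x (suc i) ≡ v) ⊎ (∃ λ j → j ≤ dbl (suc q) × y (suc j) ≡ v)
        cov v v≢c with cover v≢c
        ... | inj₁ (i , le , e) = inj₁ (i , subst (i ≤_) eqp le , e)
        ... | inj₂ (i , le , e) = inj₂ (i , subst (i ≤_) eqq le , e)

    module OddEven (od : ev (suc n) ≡ true) (od' : ev (suc k) ≡ false) where

      private
        module AO = A.OddArm od
        module BE = B.EvenArm od'

      c-y : ∀ j → j ≤ suc k → T c (y (suc j)) ≡ b
      c-y j le = AO.c-out (y∉ j le) (B.≢c j le)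

      -- The odd arm determines the arc from `c` to `y 2`, and this is the free bit of the even arm.
      right : BE.s ≡ not b'
      right = trans (sym BE.c-two) (trans (c-y 1 z<s) (sym not-b'))

      cross : ∀ i j → i ≤ suc n → j ≤ suc k → T (x (suc i)) (y (suc j)) ≡ b
      cross i j le le' with ev j in ej
      ... | true = oppB (≢-sym (x≢y le le')) (BE.odd-out (x∉ i le) (A.≢c i le) (suc j) (s≤s le') (ev-suc-false {j} ej))
      ... | false = opp′ (≢-sym (x≢y le le')) (trans (BE.like-c (x∉ i le) (A.≢c i le) (suc j) (s≤s le') (ev-suc-true {j} ej))
              (opp (A.≢c i le) (AO.c-in (A.mem i le))))

      module _ {u z : Fin m} (C : Cyc b u z) where
        open Cyc C
        open AO.Cycle C

        -- All arcs from the even arm to `u` have the value `not b`, whereas the arc from `z` has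
        -- `b`. So `z` lies on neither arm, and it becomes the exceptional vertex of the V-shaped
        -- side.
        z∉B : ¬ Mem y k z
        z∉B (j , le , e) = b≢notb (trans (sym zu) (bad e))
          where
          bad : y (suc j) ≡ z → T z u ≡ not b
          bad refl with ev j in ej
          ... | true = trans (BE.odd-out (disjoint u∈) u≢c (suc j) (s≤s le) (ev-suc-false {j} ej)) b'≡
          ... | false = trans (BE.like-c (disjoint u∈) u≢c (suc j) (s≤s le) (ev-suc-true {j} ej)) (opp u≢c uc)

        y-z : ∀ j → j ≤ suc k → T (y (suc j)) z ≡ sgn b (not (ev j))
        y-z j le with ev j in ej
        ... | true = trans (BE.odd-out z∉B z≢c (suc j) (s≤s le) (ev-suc-false {j} ej)) b'≡
        ... | false = trans (BE.like-c z∉B z≢c (suc j) (s≤s le) (ev-suc-true {j} ej)) cz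

        x-z : ∀ i → i ≤ suc n → T (x (suc i)) z ≡ sgn b (not (ev i))
        x-z i le with ev i in ei
        ... | true = odd-z (suc i) (s≤s le) (ev-suc-false {i} ei)
        ... | false = AO.even-out z∉ z≢c (suc i) (s≤s le) (ev-suc-true {i} ei)

        data In (w : Fin m) : Set where
          inX : ∀ i → i ≤ suc n → x (suc i) ≡ w → In w
          inY : ∀ j → j ≤ suc k → y (suc j) ≡ w → In w
          isz : z ≡ w → In w

        cover : ∀ {v} → v ≢ c → In v
        cover {v} v≢c with v ≟ z | A.mem? v
        ... | yes e | _ = isz (sym e)
        ... | no _ | yes (i , le , e) = inX i le e
        ... | no v≢z | no nx with member C v≢c (λ { refl → nx u∈ }) v≢z
        ...   | inj₁ (i , le , e) = inX i le e
        ...   | inj₂ (i , le , e) = inY i le e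

        O⊥ : AO.s ≡ not b → ⊥
        O⊥ e = twins⊥ indc {x 1} {y 1} {x 2} (x≢y z≤n z≤n) (A.≢c 0 z≤n) (B.≢c 0 z≤n) (A.≢c 1 z<s)
            (≢-sym (A.inj ≤-refl (s≤s z<s))) (x≢y z<s z≤n) λ w≢c → at (cover w≢c)
          where
          at : ∀ {w} → In w → w ≢ x 1 → w ≢ y 1 → T (x 1) w ≡ T (y 1) w
          at (inX zero _ refl) n₁ _ = ⊥-elim (n₁ refl)
          at (inY zero _ refl) _ n₂ = ⊥-elim (n₂ refl)
          at (isz refl) _ _ = trans (x-z 0 z≤n) (sym (y-z 0 z≤n))
          at (inX (suc i) le refl) _ _ with ev i in ei
          ... | true = trans (AO.even-arc (s≤s z<s) (s≤s le) ei) (sym (opp (x≢y le z≤n) (cross (suc i) 0 le z≤n)))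
          ... | false = trans (AO.free (s≤s z<s) (s≤s le) refl ei)
                  (trans e (sym (opp (x≢y le z≤n) (cross (suc i) 0 le z≤n))))
          at (inY (suc j) le refl) _ _ = trans (cross 0 (suc j) z≤n le)
            (sym (trans (BE.odd-arc (s≤s z<s) (s≤s le) refl) not-b'))

        model : AO.s ≡ b → SomeModel (orient b T) U V c
        model e with suc≡dbl n od | sucsuc≡dbl k od'
        ... | p , eqp | q , eqq = p , q , mk-model tour b U V p q (λ i → x (suc i)) (z ◂ λ j → y (suc j))
              (λ lt le → flat-side A od false e lt (toA le))
              (λ {i} {j} lt le → let (d , a) = V-side B od' right z∉B z≢c (trans cz (sym not-b')) lt (toB le)
                                 in d , subst (λ β → T ((z ◂ λ j → y (suc j)) j) ((z ◂ λ j → y (suc j)) i) ≡ sgn β (sideArc V i j)) not-b' a)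
              (λ {i} le → A.≢c i (toA le) , AO.c-in (A.mem i (toA le)))
              (λ { {zero} _ → z≢c , cz ; {suc j} le → B.≢c j (≤-pred (toB le)) , c-y j (≤-pred (toB le)) })
              (λ { {i} {zero} le _ → A.off z∉ i (toA le) , trans (x-z i (toA le)) (cong (λ p → sgn b (not p)) (sym (∧-comm (ev i) true)))
                 ; {i} {suc j} le le' → x≢y (toA le) (≤-pred (toB le')) ,
                     trans (cross i j (toA le) (≤-pred (toB le'))) (cong (λ p → sgn b (not p)) (sym (∧-comm (ev i) false))) })
              cov
          where
          toA : ∀ {i} → i ≤ dbl (suc p) → i ≤ suc n
          toA {i} = subst (i ≤_) (sym eqp)
          toB : ∀ {i} → i ≤ dbl (suc q) → i ≤ suc (suc k)
          toB {i} = subst (i ≤_) (sym eqq)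
          cov : ∀ v → v ≢ c → (∃ λ i → i ≤ dbl (suc p) × x (suc i) ≡ v) ⊎ (∃ λ j → j ≤ dbl (suc q) × (z ◂ λ j → y (suc j)) j ≡ v)
          cov v v≢c with cover v≢c
          ... | inX i le e = inj₁ (i , subst (i ≤_) eqp le , e)
          ... | inY i le e = inj₂ (suc i , subst (suc i ≤_) eqq (s≤s le) , e)
          ... | isz e = inj₂ (0 , z≤n , e)

    module EvenEven (od : ev (suc n) ≡ false) (od' : ev (suc k) ≡ false) where

      private
        module AE = A.EvenArm od
        module BE = B.EvenArm od'

      -- Each of `x 2` and `y 2` looks like `c` from the other arm, so both bits are read off the
      -- arc between them, in opposite directions.
      bits : BE.s ≡ not AE.s
      bits = trans (sym BE.c-two) (trans (sym (AE.like-c (y∉ 1 z<s) (B.≢c 1 z<s) 2 (s≤s z<s) refl))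
        (opp (≢-sym (x≢y z<s z<s)) (trans (BE.like-c (x∉ 1 z<s) (A.≢c 1 z<s) 2 (s≤s z<s) refl) AE.c-two)))

      wrong⊥ : AE.s ≡ b → ⊥
      wrong⊥ e = twins⊥ indc {x 1} {y 1} {x 2} (x≢y z≤n z≤n) (A.≢c 0 z≤n) (B.≢c 0 z≤n) (A.≢c 1 z<s)
          (≢-sym (A.inj ≤-refl (s≤s z<s))) (x≢y z<s z≤n) at
        where
        at : ∀ {w} → w ≢ c → w ≢ x 1 → w ≢ y 1 → T (x 1) w ≡ T (y 1) w
        in-x : ∀ {w} → Mem x n w → w ≢ x 1 → T (x 1) w ≡ T (y 1) w
        in-x (zero , _ , refl) n₁ = ⊥-elim (n₁ refl)
        in-x (suc i , le , refl) _ = trans (AE.odd-arc (s≤s z<s) (s≤s le) refl)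
          (sym (trans (BE.odd-out (x∉ (suc i) le) (A.≢c (suc i) le) 1 z<s refl) b'≡))
        in-y : ∀ {w} → Mem y k w → w ≢ y 1 → T (x 1) w ≡ T (y 1) w
        in-y (zero , _ , refl) n₂ = ⊥-elim (n₂ refl)
        in-y (suc j , le , refl) _ = trans (AE.odd-out (y∉ (suc j) le) (B.≢c (suc j) le) 1 z<s refl)
          (sym (trans (BE.odd-arc (s≤s z<s) (s≤s le) refl) not-b'))
        at {w} w≢c n₁ n₂ with w ≟ x 2
        ... | yes refl = in-x (A.mem 1 z<s) n₁
        ... | no n₃ with member (AE.wrong-cycle e) w≢c n₁ n₃
        ...   | inj₁ h = in-x h n₁
        ...   | inj₂ h = in-y h n₂

      module _ (r : AE.s ≡ not b) {u z : Fin m} (C : Cyc b u z) where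
        open Cyc C

        r' : BE.s ≡ not b'
        r' = trans bits (trans (cong not r) (trans (not-involutive b) (sym not-b')))

        C' : Cyc b' z u
        C' = subst (λ β → Cyc β z u) (sym b'≡) (cyc-flip C)

        open AE.Right r
        open AE.Right.Cycle r C
        private
          module BR = BE.Right r'
          module BC = BE.Right.Cycle r' C'

        cu : T c u ≡ not b
        cu = opp u≢c uc

        xy : ∀ i j → i ≤ suc n → j ≤ suc k → T (x (suc i)) (y (suc j)) ≡ b
        xy i j le le' = all-out (y∉ j le') (B.≢c j le') (oppB (B.≢c j le') (BR.c-in (B.mem j le'))) (suc i) (s≤s le)

        uy : ∀ j → j ≤ suc k → T u (y (suc j)) ≡ b
        uy j le = oppB (B.off BC.z∉ j le) (BR.all-out BC.z∉ u≢c (trans cu (sym b'≡)) (suc j) (s≤s le))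

        hP hQ : ℕ → Fin m
        hP = u ◂ λ i → x (suc i)
        hQ = z ◂ λ j → y (suc j)

        model : SomeModel (orient b T) V V c
        model with sucsuc≡dbl n od | sucsuc≡dbl k od'
        ... | p , eqp | q , eqq = p , q , mk-model tour b V V p q hP hQ
              (λ lt le → V-side A od r u∉ u≢c cu lt (toA le))
              (λ {i} {j} lt le → let (d , a) = V-side B od' r' BC.u∉ z≢c (trans cz (sym not-b')) lt (toB le)
                                 in d , subst (λ β → T (hQ j) (hQ i) ≡ sgn β (sideArc V i j)) not-b' a)
              (λ { {zero} _ → u≢c , uc ; {suc i} le → A.≢c i (≤-pred (toA le)) , c-in (A.mem i (≤-pred (toA le))) })
              (λ { {zero} _ → z≢c , cz
                 ; {suc j} le → B.≢c j (≤-pred (toB le)) , oppB (B.≢c j (≤-pred (toB le))) (BR.c-in (B.mem j (≤-pred (toB le)))) })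
              (λ { {zero} {zero} _ _ → u≢z , opp (≢-sym u≢z) zu
                 ; {zero} {suc j} _ le' → ≢-sym (B.off BC.z∉ j (≤-pred (toB le'))) , uy j (≤-pred (toB le'))
                 ; {suc i} {zero} le _ → A.off z∉ i (≤-pred (toA le)) , all-out z∉ z≢c cz (suc i) (toA le)
                 ; {suc i} {suc j} le le' → x≢y (≤-pred (toA le)) (≤-pred (toB le')) , xy i j (≤-pred (toA le)) (≤-pred (toB le')) })
              cov
          where
          toA : ∀ {i} → i ≤ dbl (suc p) → i ≤ suc (suc n)
          toA {i} = subst (i ≤_) (sym eqp)
          toB : ∀ {i} → i ≤ dbl (suc q) → i ≤ suc (suc k)
          toB {i} = subst (i ≤_) (sym eqq)
          cov : ∀ v → v ≢ c → (∃ λ i → i ≤ dbl (suc p) × hP i ≡ v) ⊎ (∃ λ j → j ≤ dbl (suc q) × hQ j ≡ v)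
          cov v v≢c with v ≟ u | v ≟ z
          ... | yes e | _ = inj₁ (0 , z≤n , sym e)
          ... | no _ | yes e = inj₂ (0 , z≤n , sym e)
          ... | no v≢u | no v≢z with member C v≢c v≢u v≢z
          ...   | inj₁ (i , le , e) = inj₁ (suc i , subst (suc i ≤_) eqp (s≤s le) , e)
          ...   | inj₂ (i , le , e) = inj₂ (suc i , subst (suc i ≤_) eqq (s≤s le) , e)

  fits-odd-even : ∀ {b b' x y n k} → Arm b x n → Arm b' y k → b' ≡ not b → ev (suc n) ≡ true → ev (suc k) ≡ false → Fits T c
  fits-odd-even {b} {n = n} A B b'≡ od od' with cyc-exists b
  ... | u , z , C with ≡b∨≡not (Facts.OddArm.s A od) b
  ...   | inj₁ e = inj₂ (inj₂ (b , inj₂ (TwoArms.OddEven.model A B b'≡ od od' C e)))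
  ...   | inj₂ e = ⊥-elim (TwoArms.OddEven.O⊥ A B b'≡ od od' C e)

  fits : ∀ {x y n k} → Arm true x n → Arm false y k → Fits T c
  fits {n = n} {k} A B with ev (suc n) in od | ev (suc k) in od'
  ... | true | false = fits-odd-even A B refl od od'
  ... | false | true = fits-odd-even B A refl od' od
  ... | false | false with cyc-exists true | ≡b∨≡not (Facts.EvenArm.s A od) true
  ...   | _ | inj₁ e = ⊥-elim (TwoArms.EvenEven.wrong⊥ A B refl od od' e)
  ...   | u , z , C | inj₂ r = inj₂ (inj₁ (TwoArms.EvenEven.model A B refl od od' r C))
  fits {n = n} {k} A B | true | true with Facts.OddArm.s A od in es | Facts.OddArm.s B od' in es'
  ... | false | true = inj₁ (TwoArms.OddOdd.model A B refl od od' true true es es')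
  ... | true | true = inj₂ (inj₂ (true , inj₁ (TwoArms.OddOdd.model A B refl od od' false true es es')))
  -- The arm shaped like U always becomes `P`; here its sign is `false`, so the dual is fitted.
  ... | false | false = inj₂ (inj₂ (false , inj₁ (TwoArms.OddOdd.model B A refl od' od false true es' es)))
  ... | true | false = ⊥-elim (TwoArms.OddOdd.UU⊥ A B refl od od' es es')

  first-arm : ∃ λ b → ∃₂ λ x n → Arm b x n
  first-arm with cyc-exists true
  ... | u , z , C with fresh c u z z
  ... | v , v≢c , v≢u , v≢z , _ with FromCycle.neighbour C v≢c v≢u v≢z
  ... | w , e with arm-at e
  ... | b , x , n , A , _ = b , x , n , A

  classification : Fits T c
  classification with first-arm
  ... | true , x , n , A = fits A (proj₂ (proj₂ (second-arm A)))
  ... | false , x , n , A = fits (proj₂ (proj₂ (second-arm A))) A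

-- Indecomposability and criticality in the listed tournaments

swapNode : Node → Node
swapNode (inP i) = inQ i
swapNode mid = mid
swapNode (inQ j) = inP j

swapNode-involutive : ∀ x → swapNode (swapNode x) ≡ x
swapNode-involutive (inP i) = refl
swapNode-involutive mid = refl
swapNode-involutive (inQ j) = refl

≡ᵇ-comm : ∀ i j → (i ≡ᵇ j) ≡ (j ≡ᵇ i)
≡ᵇ-comm zero zero = refl
≡ᵇ-comm zero (suc j) = refl
≡ᵇ-comm (suc i) zero = refl
≡ᵇ-comm (suc i) (suc j) = ≡ᵇ-comm i j

-- Transfers statements about `P` to `Q`: pass to the dual and rename.
swap-arc : ∀ τ σ x y → nodeArc σ τ (swapNode x) (swapNode y) ≡ nodeArc τ σ y x
swap-arc τ σ (inP i) (inP j) rewrite ≡ᵇ-comm i j = refl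
swap-arc τ σ (inP i) mid = refl
swap-arc τ σ (inP i) (inQ j) = ∧-comm (special σ j) (special τ i)
swap-arc τ σ mid (inP j) = refl
swap-arc τ σ mid mid = refl
swap-arc τ σ mid (inQ j) = refl
swap-arc τ σ (inQ i) (inP j) = cong not (∧-comm (special σ i) (special τ j))
swap-arc τ σ (inQ i) mid = refl
swap-arc τ σ (inQ i) (inQ j) rewrite ≡ᵇ-comm i j = refl

Indec-dual : {V : Set} {T : V → V → Bool} {X : V → Set} → Tour T → Indec T X → Indec (λ x y → T y x) X
Indec-dual {T = T} tour ind I iv = ind I λ Xa Xb Xx Ia Ib Ix →
  Core.unflip tour (λ { refl → clash Ia Ix }) (λ { refl → clash Ib Ix }) (iv Xa Xb Xx Ia Ib Ix)

Indec-swap : ∀ {τ σ} {X X' : Node → Set} → (∀ {x} → X x → X' (swapNode x)) → (∀ {x} → X' x → X (swapNode x)) →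
  Indec (nodeArc τ σ) X → Indec (nodeArc σ τ) X'
Indec-swap {τ} {σ} f g ind = Indec-map swapNode f (λ {x} h → swapNode x , g h , swapNode-involutive x)
  (λ {x} {y} _ _ → swap-arc τ σ x y) (Indec-dual (node-tour τ σ) ind)

region-swap : ∀ {K p q} x → Region K p q x → Region K q p (swapNode x)
region-swap (inP i) h = h
region-swap mid h = h
region-swap (inQ j) h = h

ev-dbl : ∀ d → ev (dbl d) ≡ true
ev-dbl zero = refl
ev-dbl (suc d) = ev-dbl d

ev-suc-dbl : ∀ d → ev (suc (dbl d)) ≡ false
ev-suc-dbl zero = refl
ev-suc-dbl (suc d) = ev-suc-dbl d

odd-arc : ∀ τ {i j} → ev i ≡ false → j < i → sideArc τ i j ≡ true
odd-arc O e lt = <ᵇ-true lt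
odd-arc U e lt rewrite <ᵇ-true lt | e = refl
odd-arc V {suc i} {zero} e lt rewrite e = refl
odd-arc V {suc i} {suc j} e (s≤s lt) = <ᵇ-true lt

odd-nonspecial : ∀ τ {i} → ev i ≡ false → special τ i ≡ false
odd-nonspecial O e = e
odd-nonspecial U e = e
odd-nonspecial V {suc i} e = refl

-- The numbers whose neighbours in the numbering look alike; number 1 of a V-shaped side is not one of them,
-- since number 0 is exceptional there.
data Inner : Shape → ℕ → Set where
  innerO : ∀ {i} → Inner O (suc i)
  innerU : ∀ {i} → Inner U (suc i)
  innerV : ∀ {i} → Inner V (suc (suc i))

inner-below : ∀ τ {i j} → Inner τ i → suc j < i → sideArc τ (suc i) j ≡ sideArc τ (pred i) j
inner-below .O {suc i} innerO (s≤s lt) = trans (<ᵇ-true (≤-trans lt (≤-trans (n≤1+n i) (n≤1+n _)))) (sym (<ᵇ-true lt))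
inner-below .U {suc i} {j} innerU (s≤s lt) rewrite <ᵇ-true {j} {suc (suc i)} (≤-trans lt (≤-trans (n≤1+n i) (n≤1+n _))) | <ᵇ-true lt = refl
inner-below .V {suc (suc i)} {zero} innerV lt = refl
inner-below .V {suc (suc i)} {suc j} innerV (s≤s (s≤s lt)) =
  trans (<ᵇ-true (≤-trans lt (≤-trans (n≤1+n i) (n≤1+n _)))) (sym (<ᵇ-true lt))

inner-above : ∀ τ {i j} → Inner τ i → suc i < j → sideArc τ (suc i) j ≡ sideArc τ (pred i) j
inner-above .O {suc i} {j} innerO lt = trans (<ᵇ-false (≤-trans (n≤1+n _) lt)) (sym (<ᵇ-false {j} {i} (≤-trans (n≤1+n i) (≤-trans (n≤1+n _) (≤-trans (n≤1+n _) lt)))))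
inner-above .U {suc i} {j} innerU lt
  rewrite <ᵇ-false {j} {suc (suc i)} (≤-trans (n≤1+n _) lt) | <ᵇ-false {j} {i} (≤-trans (n≤1+n i) (≤-trans (n≤1+n _) (≤-trans (n≤1+n _) lt))) = refl
inner-above .V {suc (suc i)} {suc j} innerV (s≤s lt) =
  trans (<ᵇ-false (≤-trans (n≤1+n _) lt)) (sym (<ᵇ-false {j} {i} (≤-trans (n≤1+n i) (≤-trans (n≤1+n _) (≤-trans (n≤1+n _) lt)))))

inner-special : ∀ τ {i} → Inner τ i → special τ (suc i) ≡ special τ (pred i)
inner-special .O innerO = refl
inner-special .U innerU = refl
inner-special .V innerV = refl

module _ (τ σ : Shape) where

  private
    M : Node → Node → Bool
    M = nodeArc τ σ

  open Tour (node-tour τ σ) using () renaming (_≟_ to _≟ᴺ_)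
  open Core (node-tour τ σ)

  inP-≢ : ∀ {i j} → i ≢ j → inP i ≢ inP j
  inP-≢ n refl = n refl

  P-arc : ∀ {i j} → i ≢ j → M (inP i) (inP j) ≡ sideArc τ i j
  P-arc n = loopless-≢ (sideArc τ) n

  inner-twins : ∀ {i} → Inner τ i → ∀ {y} → y ≢ inP (pred i) → y ≢ inP i → y ≢ inP (suc i) →
    M (inP (suc i)) y ≡ M (inP (pred i)) y
  inner-twins {i} h {mid} _ _ _ = refl
  inner-twins {i} h {inQ j} _ _ _ = cong (λ p → not (p ∧ special σ j)) (inner-special τ h)
  inner-twins {zero} () {inP j} n₁ n₂ n₃
  inner-twins {suc i} h {inP j} n₁ n₂ n₃ with <-cmp j (suc i)
  ... | tri≈ _ refl _ = ⊥-elim (n₂ refl)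
  ... | tri< lt _ _ = trans (P-arc λ e → n₃ (cong inP (sym e))) (trans (inner-below τ h (s≤s (≤∧≢⇒< (≤-pred lt) λ e → n₁ (cong inP e))))
          (sym (P-arc λ e → n₁ (cong inP (sym e)))))
  ... | tri> _ _ lt = trans (P-arc λ e → n₃ (cong inP (sym e))) (trans (inner-above τ h (≤∧≢⇒< lt λ e → n₃ (cong inP (sym e))))
          (sym (P-arc λ e → n₁ (cong inP (sym e)))))

  -- Common to the three shapes: an odd number dominates whatever lies further in, the middle vertex
  -- and the other side.
  odd-dominates : ∀ {i y} → ev i ≡ false → (∀ {j} → y ≡ inP j → j < i) → M (inP i) y ≡ true
  odd-dominates {i} {inP j} e lt = trans (P-arc (≢-sym (<⇒≢ (lt refl)))) (odd-arc τ e (lt refl))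
  odd-dominates {i} {mid} e lt = refl
  odd-dominates {i} {inQ j} e lt rewrite odd-nonspecial τ {i} e = refl

  -- The odd vertex dominates the whole region, hence is global; the even vertex after it is a twin
  -- of `u`, and the odd one separates these two. That is what `grow` asks for.
  module Step {K : Set} {r q : ℕ} {u : Node} (ind : Indec M (Region K (dbl r) q)) (t3 : Three (Region K (dbl r) q))
    (hv : Has (Region K (dbl r) q) (inP (suc (suc (dbl r)))) (twin u))
    (uw : M u (inP (suc (dbl r))) ≡ false) where

    d : ℕ
    d = dbl r
    Y : Node → Set
    Y = Region K d q

    w-global : ∀ {y} → Y y → M (inP (suc d)) y ≡ true
    w-global {y} h = odd-dominates (ev-suc-dbl r) (lt h)
      where
      lt : ∀ {y} → Y y → ∀ {j} → y ≡ inP j → j < suc d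
      lt h refl = s≤s h

    vw : M (inP (suc (suc d))) (inP (suc d)) ≡ true
    vw = trans (P-arc (λ e → <⇒≢ ≤-refl (sym e))) (go τ)
      where
      go : ∀ τ → sideArc τ (suc (suc d)) (suc d) ≡ true
      go O = <ᵇ-true {suc d} ≤-refl
      go U rewrite <ᵇ-true {d} ≤-refl | ev-dbl r | ev-suc-dbl r = refl
      go V = <ᵇ-true {d} ≤-refl

    grown : Indec M (Region K (suc (suc d)) q)
    grown = Indec-resp to from (Over.grow ind t3 {inP (suc (suc d))} {inP (suc d)}
      (λ le → <-irrefl refl (<⇒≤ le)) (<-irrefl refl) (inP-≢ (λ e → <-irrefl (sym e) ≤-refl)) (twin u) hv
      (λ h → Over.global-twin⊥ ind t3 {inP (suc d)} (λ {y} {y'} h h' → trans (w-global {y} h) (sym (w-global {y'} h'))) h)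
      λ h → true≢false (trans (sym vw) (trans (proj₂ h (inj₂ refl) λ { refl → <-irrefl refl (proj₁ hv) }) uw)))
      where
      to : ∀ {z} → (Y ⊹ inP (suc (suc d)) ⊹ inP (suc d)) z → Region K (suc (suc d)) q z
      to {inP i} (inj₁ (inj₁ h)) = ≤-trans h (≤-trans (n≤1+n _) (n≤1+n _))
      to {mid} (inj₁ (inj₁ h)) = h
      to {inQ j} (inj₁ (inj₁ h)) = h
      to (inj₁ (inj₂ refl)) = ≤-refl
      to (inj₂ refl) = n≤1+n _
      from : ∀ {z} → Region K (suc (suc d)) q z → (Y ⊹ inP (suc (suc d)) ⊹ inP (suc d)) z
      from {mid} h = inj₁ (inj₁ h)
      from {inQ j} h = inj₁ (inj₁ h)
      from {inP i} h with m≤n⇒m<n∨m≡n h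
      ... | inj₂ refl = inj₁ (inj₂ refl)
      ... | inj₁ lt with m≤n⇒m<n∨m≡n (≤-pred lt)
      ...   | inj₂ refl = inj₂ refl
      ...   | inj₁ lt' = inj₁ (inj₁ (≤-pred lt'))

  inner-step : ∀ {K r q} → Inner τ (suc (dbl r)) → Indec M (Region K (dbl r) q) → Three (Region K (dbl r) q) →
    Indec M (Region K (dbl (suc r)) q)
  inner-step {K} {r} {q} inn ind t3 = Step.grown {u = inP (dbl r)} ind t3 (≤-refl , hv)
      (trans (P-arc (λ e → <-irrefl e ≤-refl)) (go τ inn))
    where
    hv : ∀ {y} → Region K (dbl r) q y → y ≢ inP (dbl r) → M (inP (suc (suc (dbl r)))) y ≡ M (inP (dbl r)) y
    hv h n = inner-twins inn n (λ { refl → <-irrefl refl h }) (λ { refl → <-irrefl refl (≤-trans (n≤1+n _) h) })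
    go : ∀ τ → Inner τ (suc (dbl r)) → sideArc τ (dbl r) (suc (dbl r)) ≡ false
    go O _ = <ᵇ-false {suc (dbl r)} {dbl r} (n≤1+n _)
    go U _ rewrite <ᵇ-false (n≤1+n (dbl r)) | ev-dbl r | ev-suc-dbl r = refl
    go V inn with dbl r | inn
    ... | suc d | innerV = <ᵇ-false {suc d} {d} (n≤1+n d)

-- In a V-shaped side the vertex number 2 is first a twin of the middle vertex.
grow-P : ∀ τ σ {r q} → Indec (nodeArc τ σ) (Region ⊤ (dbl r) q) → Indec (nodeArc τ σ) (Region ⊤ (dbl (suc r)) q)
grow-P τ σ {r} {q} ind = go τ r ind
  where
  t3 : ∀ {p} → Three (Region ⊤ p q)
  t3 = three {a = inP 0} {mid} {inQ 0} z≤n tt z≤n (λ ()) (λ ()) (λ ())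
  go : ∀ τ r → Indec (nodeArc τ σ) (Region ⊤ (dbl r) q) → Indec (nodeArc τ σ) (Region ⊤ (dbl (suc r)) q)
  go O r ind = inner-step O σ innerO ind t3
  go U r ind = inner-step U σ innerU ind t3
  go V (suc r) ind = inner-step V σ innerV ind t3
  go V zero ind = Step.grown V σ {u = mid} ind t3 (tt , hv) refl
    where
    hv : ∀ {y} → Region ⊤ 0 q y → y ≢ mid → nodeArc V σ (inP 2) y ≡ nodeArc V σ mid y
    hv {inP zero} _ _ = refl
    hv {mid} _ n = ⊥-elim (n refl)
    hv {inQ j} _ _ = refl

-- Number 2 of a V-shaped side was added as a twin of the middle vertex. With that vertex gone the
-- growth starts beyond number 2, where all shapes behave alike.
grow-P′ : ∀ τ σ {r q} → Indec (nodeArc τ σ) (Region ⊥ (dbl (suc r)) (suc (suc q))) →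
  Indec (nodeArc τ σ) (Region ⊥ (dbl (suc (suc r))) (suc (suc q)))
grow-P′ τ σ {r} {q} ind = go τ ind
  where
  t3 : ∀ {p} → Three (Region ⊥ p (suc (suc q)))
  t3 = three {a = inP 0} {inQ 1} {inQ 0} z≤n z<s z≤n (λ ()) (λ ()) (λ ())
  go : ∀ τ → Indec (nodeArc τ σ) (Region ⊥ (dbl (suc r)) (suc (suc q))) →
    Indec (nodeArc τ σ) (Region ⊥ (dbl (suc (suc r))) (suc (suc q)))
  go O ind = inner-step O σ innerO ind t3
  go U ind = inner-step U σ innerU ind t3
  go V ind = inner-step V σ innerV ind t3

flip-region : ∀ {K τ σ p q} → Indec (nodeArc τ σ) (Region K p q) → Indec (nodeArc σ τ) (Region K q p)
flip-region = Indec-swap (λ {x} → region-swap x) (λ {x} → region-swap x)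

grow-Ps : ∀ τ σ r {q} → Indec (nodeArc τ σ) (Region ⊤ 0 q) → Indec (nodeArc τ σ) (Region ⊤ (dbl r) q)
grow-Ps τ σ zero ind = ind
grow-Ps τ σ (suc r) ind = grow-P τ σ {r} (grow-Ps τ σ r ind)

grow-Ps′ : ∀ τ σ r {q} → Indec (nodeArc τ σ) (Region ⊥ 2 (dbl (suc q))) → Indec (nodeArc τ σ) (Region ⊥ (dbl (suc r)) (dbl (suc q)))
grow-Ps′ τ σ zero ind = ind
grow-Ps′ τ σ (suc r) ind = grow-P′ τ σ {r} (grow-Ps′ τ σ r ind)

-- The start is the 3-cycle of `mid` and the numbers 0, which are special in every shape.
nodes-indec : ∀ τ σ k k' → Indec (nodeArc τ σ) (Region ⊤ (dbl k) (dbl k'))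
nodes-indec τ σ k k' = grow-Ps τ σ k (flip-region (grow-Ps σ τ k' (Indec-resp to from base)))
  where
  open Core (node-tour σ τ)
  sp : ∀ τ → special τ 0 ≡ true
  sp O = refl
  sp U = refl
  sp V = refl
  base : Indec (nodeArc σ τ) ((λ v → v ≡ mid) ⊹ inP 0 ⊹ inQ 0)
  base = triangle {true} (λ ()) (λ ()) (λ ()) refl refl (cong₂ _∧_ (sp σ) (sp τ))
  to : ∀ {z} → ((λ v → v ≡ mid) ⊹ inP 0 ⊹ inQ 0) z → Region ⊤ 0 0 z
  to (inj₁ (inj₁ refl)) = tt
  to (inj₁ (inj₂ refl)) = z≤n
  to (inj₂ refl) = z≤n
  from : ∀ {z} → Region ⊤ 0 0 z → ((λ v → v ≡ mid) ⊹ inP 0 ⊹ inQ 0) z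
  from {inP zero} _ = inj₁ (inj₂ refl)
  from {mid} _ = inj₁ (inj₁ refl)
  from {inQ zero} _ = inj₂ refl

-- Indecomposability of small tournaments by exhaustive search.

anyᵇ : ∀ {n} → (Fin n → Bool) → Bool
anyᵇ {zero} f = false
anyᵇ {suc n} f = f zero ∨ anyᵇ (λ i → f (suc i))

anyᵇ-sound : ∀ {n} (f : Fin n → Bool) → anyᵇ f ≡ true → ∃ λ i → f i ≡ true
anyᵇ-sound {suc n} f e with f zero in e₀
... | true = zero , e₀
... | false with anyᵇ-sound (λ i → f (suc i)) e
...   | i , e' = suc i , e'

anyᵇ-complete : ∀ {n} (f : Fin n → Bool) i → f i ≡ true → anyᵇ f ≡ true
anyᵇ-complete f zero e rewrite e = refl
anyᵇ-complete f (suc i) e with f zero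
... | true = refl
... | false = anyᵇ-complete (λ i → f (suc i)) i e

allVec : ∀ n → (Vec Bool n → Bool) → Bool
allVec zero f = f []
allVec (suc n) f = allVec n (λ v → f (true ∷ v)) ∧ allVec n (λ v → f (false ∷ v))

∧-true : ∀ {a b} → (a ∧ b) ≡ true → a ≡ true × b ≡ true
∧-true {true} {true} _ = refl , refl

∨-true : ∀ {a b} → (a ∨ b) ≡ true → a ≡ true ⊎ b ≡ true
∨-true {true} _ = inj₁ refl
∨-true {false} e = inj₂ e

allVec-sound : ∀ n f → allVec n f ≡ true → ∀ v → f v ≡ true
allVec-sound zero f e [] = e
allVec-sound (suc n) f e (true ∷ v) = allVec-sound n (λ v → f (true ∷ v)) (proj₁ (∧-true e)) v
allVec-sound (suc n) f e (false ∷ v) = allVec-sound n (λ v → f (false ∷ v)) (proj₂ (∧-true {allVec n (λ v → f (true ∷ v))} e)) v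

-- `check` accepts a subset that is no interval, or that has fewer than two members or no
-- non-member. Everything is Boolean so that the search runs by evaluation.
module Search {n : ℕ} (R : Fin n → Fin n → Bool) where

  violated : Vec Bool n → Bool
  violated v = anyᵇ λ a → lookup v a ∧ anyᵇ λ b → lookup v b ∧ anyᵇ λ x → not (lookup v x) ∧ (R a x xor R b x)

  proper : Vec Bool n → Bool
  proper v = anyᵇ (λ x → not (lookup v x)) ∧
    anyᵇ λ a → lookup v a ∧ anyᵇ λ b → lookup v b ∧ not (isYes (a Fin.≟ b))

  check : Vec Bool n → Bool
  check v = violated v ∨ not (proper v)

  xor-true : ∀ {a b} → (a xor b) ≡ true → a ≢ b
  xor-true {true} {true} () refl
  xor-true {false} {false} () refl

  not-true : ∀ {a} → not a ≡ true → a ≡ false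
  not-true {false} _ = refl

  search : allVec n check ≡ true → Indec R All
  search e I iv {p} {q} {r} p≢q _ _ _ Ip Iq Ir = go (∨-true (allVec-sound n check e v))
    where
    v : Vec Bool n
    v = tabulate I
    at : ∀ {i b} → lookup v i ≡ b → I i ≡ b
    at {i} e = trans (sym (lookup∘tabulate I i)) e
    to : ∀ {i b} → I i ≡ b → lookup v i ≡ b
    to {i} e = trans (lookup∘tabulate I i) e
    both : ∀ {a b} → a ≡ true → b ≡ true → (a ∧ b) ≡ true
    both refl refl = refl
    isProper : proper v ≡ true
    isProper = both (anyᵇ-complete (λ x → not (lookup v x)) r (cong not (to Ir)))
      (anyᵇ-complete _ p (both (to Ip) (anyᵇ-complete _ q (both (to Iq) neq))))
      where
      neq : not (isYes (p Fin.≟ q)) ≡ true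
      neq with p Fin.≟ q
      ... | yes e = ⊥-elim (p≢q e)
      ... | no _ = refl
    go : violated v ≡ true ⊎ not (proper v) ≡ true → ⊥
    go (inj₂ e) = clash isProper (not-true e)
    go (inj₁ e) with anyᵇ-sound (λ a → lookup v a ∧ _) e
    ... | a , ea with anyᵇ-sound _ (proj₂ (∧-true {lookup v a} ea))
    ... | b , eb with anyᵇ-sound _ (proj₂ (∧-true {lookup v b} eb))
    ... | x , ex = xor-true (proj₂ (∧-true {not (lookup v x)} ex))
          (iv tt tt tt (at (proj₁ (∧-true ea))) (at (proj₁ (∧-true eb))) (at (not-true (proj₁ (∧-true ex)))))

six : Fin 6 → Node
six zero = inP 0
six (suc zero) = inP 1
six (suc (suc zero)) = inP 2
six (suc (suc (suc zero))) = inQ 0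
six (suc (suc (suc (suc zero)))) = inQ 1
six (suc (suc (suc (suc (suc zero))))) = inQ 2

-- The smallest case of `T − c`, three vertices on each side, with 64 subsets to check.
six-indec : ∀ τ σ → allVec 6 (Search.check (λ i j → nodeArc τ σ (six i) (six j))) ≡ true →
  Indec (nodeArc τ σ) (Region ⊥ 2 2)
six-indec τ σ e = Indec-map six im sur (λ _ _ → refl) (Search.search _ e)
  where
  im : ∀ {i} → ⊤ → Region ⊥ 2 2 (six i)
  im {zero} _ = z≤n
  im {suc zero} _ = z<s
  im {suc (suc zero)} _ = s≤s z<s
  im {suc (suc (suc zero))} _ = z≤n
  im {suc (suc (suc (suc zero)))} _ = z<s
  im {suc (suc (suc (suc (suc zero))))} _ = s≤s z<s
  sur : ∀ {x} → Region ⊥ 2 2 x → ∃ λ i → ⊤ × six i ≡ x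
  sur {inP 0} _ = zero , tt , refl
  sur {inP 1} _ = suc zero , tt , refl
  sur {inP 2} _ = suc (suc zero) , tt , refl
  sur {inQ 0} _ = suc (suc (suc zero)) , tt , refl
  sur {inQ 1} _ = suc (suc (suc (suc zero))) , tt , refl
  sur {inQ 2} _ = suc (suc (suc (suc (suc zero)))) , tt , refl
  sur {inP (suc (suc (suc _)))} (s≤s (s≤s ()))
  sur {inQ (suc (suc (suc _)))} (s≤s (s≤s ()))

-- For `O` with `V`, and for `U` with `U`, the tournament `T − c` is decomposable, see `O⊥` and
-- `UU⊥`. The pairs `O U` and `V U` are duals of listed ones.
data Listed : Shape → Shape → Set where
  OO : Listed O O
  UO : Listed U O
  UV : Listed U V
  VV : Listed V V

listed-six : ∀ {τ σ} → Listed τ σ → Indec (nodeArc τ σ) (Region ⊥ 2 2)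
listed-six OO = six-indec O O refl
listed-six UO = six-indec U O refl
listed-six UV = six-indec U V refl
listed-six VV = six-indec V V refl

nodes-without-mid-indec : ∀ {τ σ} → Listed τ σ → ∀ k k' → Indec (nodeArc τ σ) (Region ⊥ (dbl (suc k)) (dbl (suc k')))
nodes-without-mid-indec {τ} {σ} l k k' = grow-Ps′ τ σ k (flip-region (grow-Ps′ σ τ k' (flip-region (listed-six l))))

-- Without an inner number, the numbers before and after it are twins. Without the outermost one,
-- the odd number before it dominates everything. Without the one next to `mid`, the following one
-- is a twin of `mid`. Without the exceptional vertex, a V-shaped side is linear and its outermost
-- vertex dominates everything.
critical-P : ∀ τ σ {p q i} → ev p ≡ true → 2 ≤ p → i ≤ p →
  ¬ Indec (nodeArc τ σ) (λ x → Region ⊤ p q x × x ≢ inP i)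
critical-P τ σ {p} {q} {i} ep 2≤p i≤p ind = go τ ind
  where
  Rest : Node → Set
  Rest x = Region ⊤ p q x × x ≢ inP i
  inner : ∀ τ {i} → Inner τ i → i < p → ¬ Indec (nodeArc τ σ) (λ x → Region ⊤ p q x × x ≢ inP i)
  inner τ {zero} () lt ind
  inner τ {suc i} inn lt ind = Core.twins⊥ (node-tour τ σ) ind {inP (suc (suc i))} {inP i} {mid}
    (λ ()) (lt , λ ()) (≤-trans (n≤1+n i) (≤-trans (n≤1+n _) lt) , λ ()) (tt , λ ()) (λ ()) (λ ())
    λ (_ , n) n₁ n₂ → inner-twins τ σ inn n₂ n n₁
  top : ∀ τ → ¬ Indec (nodeArc τ σ) (λ x → Region ⊤ p q x × x ≢ inP p)
  top τ ind = at p ep 2≤p ind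
    where
    at : ∀ p → ev p ≡ true → 2 ≤ p → ¬ Indec (nodeArc τ σ) (λ x → Region ⊤ p q x × x ≢ inP p)
    at (suc (suc p)) ep _ ind = Core.constant⊥ (node-tour τ σ) ind {inP (suc p)} {mid} {inQ 0}
      (n≤1+n _ , λ ()) (tt , λ ()) (z≤n , λ ()) (λ ()) (λ ()) (λ ())
      λ h h' n n' → trans (dom h n) (sym (dom h' n'))
      where
      lt : ∀ {w} → Region ⊤ (suc (suc p)) q w × w ≢ inP (suc (suc p)) → w ≢ inP (suc p) → ∀ {j} → w ≡ inP j → j < suc p
      lt (h , n) n' refl = ≤∧≢⇒< (≤-pred (≤∧≢⇒< h λ { refl → n refl })) λ { refl → n' refl }
      dom : ∀ {w} → Region ⊤ (suc (suc p)) q w × w ≢ inP (suc (suc p)) → w ≢ inP (suc p) → nodeArc τ σ (inP (suc p)) w ≡ true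
      dom h n = odd-dominates τ σ (trans (ev-suc p) (cong not ep)) (lt h n)
  next-to-mid : ∀ τ {i} → special τ (suc i) ≡ false → suc i ≤ p →
    (∀ {j} → j ≤ p → j ≢ i → j ≢ suc i → sideArc τ (suc i) j ≡ false) →
    ¬ Indec (nodeArc τ σ) (λ x → Region ⊤ p q x × x ≢ inP i)
  next-to-mid τ {i} ns le below ind = Core.twins⊥ (node-tour τ σ) ind {inP (suc i)} {mid} {inQ 0}
    (λ ()) (le , λ ()) (tt , λ ()) (z≤n , λ ()) (λ ()) (λ ()) same
    where
    same : ∀ {w} → Region ⊤ p q w × w ≢ inP i → w ≢ inP (suc i) → w ≢ mid → nodeArc τ σ (inP (suc i)) w ≡ nodeArc τ σ mid w
    same {inP j} (h , n) n₁ _ = trans (P-arc τ σ λ e → n₁ (cong inP (sym e))) (below h (λ e → n (cong inP e)) (λ e → n₁ (cong inP e)))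
    same {mid} _ _ n = ⊥-elim (n refl)
    same {inQ j} _ _ _ rewrite ns = refl
  exceptional : ¬ Indec (nodeArc V σ) (λ x → Region ⊤ p q x × x ≢ inP 0)
  exceptional ind = at p 2≤p ind
    where
    at : ∀ p → 2 ≤ p → ¬ Indec (nodeArc V σ) (λ x → Region ⊤ p q x × x ≢ inP 0)
    at (suc p) _ ind = Core.constant⊥ (node-tour V σ) ind {inP (suc p)} {mid} {inQ 0}
      (≤-refl , λ ()) (tt , λ ()) (z≤n , λ ()) (λ ()) (λ ()) (λ ())
      λ h h' n n' → trans (dom h n) (sym (dom h' n'))
      where
      dom : ∀ {w} → Region ⊤ (suc p) q w × w ≢ inP 0 → w ≢ inP (suc p) → nodeArc V σ (inP (suc p)) w ≡ true
      dom {inP zero} (_ , n) _ = ⊥-elim (n refl)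
      dom {inP (suc j)} (h , _) n = trans (P-arc V σ {suc p} {suc j} λ { refl → n refl }) (<ᵇ-true (≤∧≢⇒< (≤-pred h) λ { refl → n refl }))
      dom {mid} _ _ = refl
      dom {inQ j} _ _ = refl
  pos : ∀ {j i} → j ≢ i → j ≢ suc i → i ≡ 0 → suc i ≤ j
  pos {zero} n _ refl = ⊥-elim (n refl)
  pos {suc j} _ _ refl = z<s
  go : ∀ τ → ¬ Indec (nodeArc τ σ) Rest
  go τ ind with m≤n⇒m<n∨m≡n i≤p
  ... | inj₂ refl = top τ ind
  ... | inj₁ lt = below τ i lt ind
    where
    below : ∀ τ i → i < p → ¬ Indec (nodeArc τ σ) (λ x → Region ⊤ p q x × x ≢ inP i)
    below O (suc i) lt ind = inner O innerO lt ind
    below U (suc i) lt ind = inner U innerU lt ind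
    below V (suc (suc i)) lt ind = inner V innerV lt ind
    below O zero lt ind = next-to-mid O refl lt (λ _ n n' → <ᵇ-false (pos n n' refl)) ind
    below U zero lt ind = next-to-mid U refl lt (λ {j} _ n n' → u j (pos n n' refl)) ind
      where
      u : ∀ j → 1 ≤ j → sideArc U 1 j ≡ false
      u j le rewrite <ᵇ-false {j} {1} le = refl
    below V zero lt ind = exceptional ind
    below V (suc zero) lt ind = next-to-mid V refl lt v ind
      where
      v : ∀ {j} → j ≤ p → j ≢ 1 → j ≢ 2 → sideArc V 2 j ≡ false
      v {zero} _ _ _ = refl
      v {suc zero} _ n _ = ⊥-elim (n refl)
      v {suc (suc j)} _ _ _ = refl

critical-node : ∀ τ σ {p q} → ev p ≡ true → 2 ≤ p → ev q ≡ true → 2 ≤ q → ∀ {x} → Region ⊤ p q x → x ≢ mid →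
  ¬ Indec (nodeArc τ σ) (λ y → Region ⊤ p q y × y ≢ x)
critical-node τ σ ep 2≤p eq 2≤q {inP i} h _ = critical-P τ σ ep 2≤p h
critical-node τ σ ep 2≤p eq 2≤q {mid} h n _ = n refl
critical-node τ σ ep 2≤p eq 2≤q {inQ j} h _ ind = critical-P σ τ eq 2≤q h
  (Indec-swap (λ {x} (a , b) → region-swap x a , λ e → b (trans (sym (swapNode-involutive x)) (cong swapNode e)))
              (λ {x} (a , b) → region-swap x a , λ e → b (trans (sym (swapNode-involutive x)) (cong swapNode e))) ind)

-- Comparison with the definitions by subsets

IsTournament⇒Tour : ∀ {m} {T : Arcs m} → IsTournament T → Tour T
IsTournament⇒Tour (irr , anti) = record { _≟_ = Fin._≟_ ; irr = irr ; anti = λ {x} {y} n → anti x y n }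

module _ {m : ℕ} {T : Arcs m} {X : Subset m} where

  IndecomposableOn⇒Indec : IndecomposableOn T X → Indec T (_∈ X)
  IndecomposableOn⇒Indec ind I iv {p} {q} {r} p≢q Xp Xq Xr Ip Iq Ir = trivial⊥ (ind J (J⊆X , J-iv))
    where
    J : Subset m
    J = tabulate (λ v → I v ∧ lookup X v)
    to : ∀ {v} → I v ≡ true → v ∈ X → v ∈ J
    to {v} Iv Xv = lookup⇒[]= v J (trans (lookup∘tabulate _ v) (cong₂ _∧_ Iv ([]=⇒lookup Xv)))
    from : ∀ {v} → v ∈ J → I v ≡ true × v ∈ X
    from {v} Jv with ∧-true {I v} (trans (sym (lookup∘tabulate _ v)) ([]=⇒lookup Jv))
    ... | Iv , Xv = Iv , lookup⇒[]= v X Xv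
    J⊆X : ∀ {v} → v ∈ J → v ∈ X
    J⊆X h = proj₂ (from h)
    J-iv : ∀ a b x → a ∈ J → b ∈ J → x ∈ X → x ∉ J → T a x ≡ T b x
    J-iv a b x Ja Jb Xx nJx with I x in e
    ... | true = ⊥-elim (nJx (to e Xx))
    ... | false = iv (proj₂ (from Ja)) (proj₂ (from Jb)) Xx (proj₁ (from Ja)) (proj₁ (from Jb)) e
    trivial⊥ : ¬ TrivialIn X J
    trivial⊥ (inj₁ e) = ∉⊥ (subst (p ∈_) e (to Ip Xp))
    trivial⊥ (inj₂ (inj₁ (x , _ , e))) = p≢q (trans (x∈⁅y⁆⇒x≡y x (subst (p ∈_) e (to Ip Xp))) (sym (x∈⁅y⁆⇒x≡y x (subst (q ∈_) e (to Iq Xq)))))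
    trivial⊥ (inj₂ (inj₂ e)) = clash (proj₁ (from (subst (r ∈_) (sym e) Xr))) Ir

  Indec⇒IndecomposableOn : Indec T (_∈ X) → IndecomposableOn T X
  Indec⇒IndecomposableOn ind J (J⊆X , J-iv) with any? (λ p → p ∈? J)
  ... | no none = inj₁ (Empty-unique none)
  ... | yes (p , Jp) with any? (λ q → (q ∈? J) ×-dec ¬? (q Fin.≟ p))
  ...   | no none = inj₂ (inj₁ (p , J⊆X Jp , ⊆-antisym sub (λ h → subst (_∈ J) (sym (x∈⁅y⁆⇒x≡y p h)) Jp)))
    where
    sub : ∀ {q} → q ∈ J → q ∈ ⁅ p ⁆
    sub {q} Jq with q Fin.≟ p
    ... | yes refl = x∈⁅x⁆ p
    ... | no n = ⊥-elim (none (q , Jq , n))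
  ...   | yes (q , Jq , q≢p) with any? (λ r → (r ∈? X) ×-dec ¬? (r ∈? J))
  ...     | yes (r , Xr , nJr) = ⊥-elim (ind (lookup J)
              (λ {a} {b} {x} _ _ Xx Ja Jb Jx → J-iv a b x (lookup⇒[]= a J Ja) (lookup⇒[]= b J Jb) Xx
                λ h → clash ([]=⇒lookup h) Jx)
              q≢p (J⊆X Jq) (J⊆X Jp) Xr ([]=⇒lookup Jq) ([]=⇒lookup Jp) out)
    where
    out : lookup J r ≡ false
    out with lookup J r in e
    ... | false = refl
    ... | true = ⊥-elim (nJr (lookup⇒[]= r J e))
  ...     | no none = inj₂ (inj₂ (⊆-antisym J⊆X sub))
    where
    sub : ∀ {r} → r ∈ X → r ∈ J
    sub {r} Xr with r ∈? J
    ... | yes h = h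
    ... | no n = ⊥-elim (none (r , Xr , n))

x∉p-x : ∀ {n} (p : Subset n) x → x ∉ p - x
x∉p-x (true ∷ p) zero ()
x∉p-x (false ∷ p) zero ()
x∉p-x (_ ∷ p) (suc x) (there h) = x∉p-x p x h

∈whole-x : ∀ {n} {x v : Fin n} → v ≢ x → v ∈ whole - x
∈whole-x {x = x} n = x∈p∧x∉q⇒x∈p─q ∈⊤ (λ h → n (x∈⁅y⁆⇒x≡y x h))

∈whole-x⁻ : ∀ {n} {x v : Fin n} → v ∈ whole - x → v ≢ x
∈whole-x⁻ h refl = x∉p-x whole _ h

module _ {m : ℕ} {T : Arcs m} where

  Indec-without : ∀ {x} → IndecomposableOn T (whole - x) → Indec T (_≢ x)
  Indec-without ind = Indec-resp ∈whole-x⁻ ∈whole-x (IndecomposableOn⇒Indec ind)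

  IndecomposableOn-without : ∀ {x} → Indec T (_≢ x) → IndecomposableOn T (whole - x)
  IndecomposableOn-without ind = Indec⇒IndecomposableOn (Indec-resp ∈whole-x ∈whole-x⁻ ind)

  -- `NonCritical` is a double negation; it can be removed because `Indec` ends in `⊥`.
  NonCritical⇒Indec : ∀ {x} → NonCritical T x → Indec T (_≢ x)
  NonCritical⇒Indec nc I iv p≢q Xp Xq Xr Ip Iq Ir = nc λ ind → Indec-without ind I iv p≢q Xp Xq Xr Ip Iq Ir

  MinusOneCritical⇒MinusOne : Tour T → MinusOneCritical T → ∃ (MinusOne T)
  MinusOneCritical⇒MinusOne tour (5≤m , ind , c , nc , unique) = c , record
    { tour = tour ; 5≤m = 5≤m
    ; indT = Indec-resp (λ _ → tt) (λ _ → ∈⊤) (IndecomposableOn⇒Indec ind)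
    ; indc = NonCritical⇒Indec nc
    ; crit = λ {x} x≢c i → x≢c (unique x λ crit → crit (IndecomposableOn-without i)) }

  MinusOne⇒MinusOneCritical : ∀ {c} → MinusOne T c → MinusOneCritical T
  MinusOne⇒MinusOneCritical {c} H = 5≤m , Indec⇒IndecomposableOn (Indec-resp (λ _ → ∈⊤) (λ _ → tt) indT) ,
    c , (λ crit → crit (IndecomposableOn-without indc)) , unique
    where
    open MinusOne H
    unique : ∀ y → NonCritical T y → y ≡ c
    unique y nc with y Fin.≟ c
    ... | yes e = e
    ... | no n = ⊥-elim (crit n (NonCritical⇒Indec nc))

-- Transfer from nodes to tournaments that have a model.

module _ {m : ℕ} {T : Arcs m} {τ σ : Shape} {k k' : ℕ} {c : Fin m} (D : Model T τ σ k k' c) where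
  open Model D

  private
    M : Node → Node → Bool
    M = nodeArc τ σ

    Ok : Node → Set
    Ok = Region ⊤ (dbl (suc k)) (dbl (suc k'))

  open Tour (node-tour τ σ) renaming (_≟_ to _≟ᴺ_; irr to irrᴺ; anti to antiᴺ)

  node : Fin m → Node
  node v = proj₁ (cover v)

  node-ok : ∀ v → Ok (node v)
  node-ok v = proj₁ (proj₂ (cover v))

  h-node : ∀ v → h (node v) ≡ v
  h-node v = proj₂ (proj₂ (cover v))

  node-arc : ∀ u v → M (node u) (node v) ≡ T u v
  node-arc u v = trans (sym (arcs {node u} {node v} (node-ok u) (node-ok v))) (cong₂ T (h-node u) (h-node v))

  model-tour : Tour T
  model-tour = record { _≟_ = Fin._≟_ ; irr = λ v → trans (sym (node-arc v v)) (irrᴺ (node v))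
    ; anti = λ {u} {v} n → trans (sym (node-arc v u)) (trans (antiᴺ λ e → n (trans (sym (h-node u)) (trans (cong h e) (h-node v))))
               (cong not (node-arc u v))) }

  -- Distinct nodes are joined by an arc in one direction, equal images in neither.
  h-injective : ∀ {x y} → Ok x → Ok y → h x ≡ h y → x ≡ y
  h-injective {x} {y} ox oy e with x ≟ᴺ y
  ... | yes e' = e'
  ... | no n = ⊥-elim (true≢false (trans (sym (trans (antiᴺ {x} {y} n) (cong not loop))) loop'))
    where
    loop : M x y ≡ false
    loop = trans (sym (arcs {x} {y} ox oy)) (trans (cong (λ v → T v (h y)) e) (Tour.irr model-tour (h y)))
    loop' : M y x ≡ false
    loop' = trans (sym (arcs {y} {x} oy ox)) (trans (cong (T (h y)) e) (Tour.irr model-tour (h y)))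

  node-h : ∀ {x} → Ok x → node (h x) ≡ x
  node-h {x} ox = h-injective (node-ok (h x)) ox (h-node (h x))

  model-indec : Indec T All
  model-indec = Indec-map {X = Ok} h (λ _ → tt) (λ {v} _ → node v , node-ok v , h-node v) (λ {x} {y} → arcs {x} {y})
    (nodes-indec τ σ (suc k) (suc k'))

  model-noncritical : Listed τ σ → Indec T (_≢ c)
  model-noncritical l = Indec-map {X = Region ⊥ (dbl (suc k)) (dbl (suc k'))} h (λ {x} → im {x})
      (λ {v} n → node v , sur (node v) (node-ok v) (λ e → n (trans (sym (h-node v)) (trans (cong h e) h-mid))) , h-node v)
      (λ {x} {y} ox oy → arcs {x} {y} (ok x ox) (ok y oy))
      (nodes-without-mid-indec l k k')
    where
    ok : ∀ x → Region ⊥ (dbl (suc k)) (dbl (suc k')) x → Ok x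
    ok (inP i) h = h
    ok (inQ j) h = h
    im : ∀ {x} → Region ⊥ (dbl (suc k)) (dbl (suc k')) x → h x ≢ c
    im {inP i} o e with h-injective {inP i} {mid} o tt (trans e (sym h-mid))
    ... | ()
    im {inQ i} o e with h-injective {inQ i} {mid} o tt (trans e (sym h-mid))
    ... | ()
    sur : ∀ x → Ok x → x ≢ mid → Region ⊥ (dbl (suc k)) (dbl (suc k')) x
    sur (inP i) h _ = h
    sur mid _ n = n refl
    sur (inQ j) h _ = h

  model-critical : ∀ {v} → v ≢ c → ¬ Indec T (_≢ v)
  model-critical {v} v≢c ind = critical-node τ σ (ev-dbl (suc k)) (s≤s z<s) (ev-dbl (suc k')) (s≤s z<s)
    {node v} (node-ok v) (λ e → v≢c (trans (sym (h-node v)) (trans (cong h e) h-mid)))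
    (Indec-map {X = _≢ v} node (λ {u} n → node-ok u , λ e → n (trans (sym (h-node u)) (trans (cong h e) (h-node v))))
      (λ {x} (o , n) → h x , (λ e → n (trans (sym (node-h o)) (cong node e))) , node-h o)
      (λ {u} {w} _ _ → node-arc u w) ind)

Indec-orient : ∀ {m} {T : Arcs m} {X : Fin m → Set} b → Tour T → Indec T X → Indec (orient b T) X
Indec-orient true t ind = ind
Indec-orient false t ind = Indec-dual t ind

Indec-orient⁻ : ∀ {m} {T : Arcs m} {X : Fin m → Set} b → Tour T → Indec (orient b T) X → Indec T X
Indec-orient⁻ true t ind = ind
Indec-orient⁻ false t ind = Indec-dual (orient-tour false t) ind

orient-tour⁻ : ∀ {m} {T : Arcs m} b → Tour (orient b T) → Tour T
orient-tour⁻ true t = t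
orient-tour⁻ false t = record { _≟_ = Tour._≟_ t ; irr = Tour.irr t ; anti = λ n → Tour.anti t (≢-sym n) }

model⇒MinusOne : ∀ {m} {T : Arcs m} {b τ σ k k' c} → 5 ≤ m → Listed τ σ → Model (orient b T) τ σ k k' c → MinusOne T c
model⇒MinusOne {b = b} 5≤m l D = record
  { tour = t ; 5≤m = 5≤m ; indT = Indec-orient⁻ b t (model-indec D) ; indc = Indec-orient⁻ b t (model-noncritical D l)
  ; crit = λ n ind → model-critical D n (Indec-orient b t ind) }
  where
  t = orient-tour⁻ b (model-tour D)

model-iso : ∀ {m m'} {T : Arcs m} {X : Arcs m'} {τ σ k k' c c'} → Model T τ σ k k' c → Model X τ σ k k' c' → T ≅ X
model-iso {T = T} {X} D D' = mk↔ₛ′ (λ v → Model.h D' (node D v)) (λ w → Model.h D (node D' w))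
    (λ w → trans (cong (Model.h D') (node-h D (node-ok D' w))) (h-node D' w))
    (λ v → trans (cong (Model.h D) (node-h D' (node-ok D v))) (h-node D v)) ,
  λ u v → trans (sym (node-arc D u v)) (sym (Model.arcs D' {node D u} {node D v} (node-ok D u) (node-ok D v)))

≅-orient : ∀ {m m'} {T : Arcs m} {X : Arcs m'} b → orient b T ≅ X → T ≅ orient b X
≅-orient true i = i
≅-orient false (f , e) = f , λ x y → e y x

orient-≅ : ∀ {m m'} {T : Arcs m} {X : Arcs m'} b → T ≅ X → orient b T ≅ orient b X
orient-≅ true i = i
orient-≅ false (f , e) = f , λ x y → e y x

model-≅ : ∀ {m m'} {T : Arcs m} {X : Arcs m'} {τ σ k k' c} → (i : T ≅ X) → Model X τ σ k k' c →
  Model T τ σ k k' (Inverse.from (proj₁ i) c)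
model-≅ {T = T} {X} {τ} {σ} {k} {k'} (f , e) D = record
  { h = λ x → from (h x) ; h-mid = cong from h-mid
  ; arcs = λ {x} {y} ox oy → trans (e (from (h x)) (from (h y)))
      (trans (cong₂ X (strictlyInverseˡ (h x)) (strictlyInverseˡ (h y))) (arcs {x} {y} ox oy))
  ; cover = λ v → node D (to v) , node-ok D (to v) , trans (cong from (h-node D (to v))) (strictlyInverseʳ v) }
  where
  open Model D
  open Inverse f

-- Positions of the nodes in the numbering of the paper

even≡ev : ∀ i → even i ≡ ev i
even≡ev zero = refl
even≡ev (suc zero) = refl
even≡ev (suc (suc i)) = even≡ev i

module _ (c : ℕ) (pArc qArc qp : ℕ → ℕ → Bool) where

  private
    g : ℕ → ℕ → Bool
    g = glue c pArc qArc qp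

  glue-PP : ∀ {i j} → i < c → j < c → i ≢ j → g i j ≡ pArc i j
  glue-PP i<c j<c n rewrite ≡ᵇ-false n | ≡ᵇ-false (<⇒≢ i<c) | ≡ᵇ-false (<⇒≢ j<c) | <ᵇ-true i<c | <ᵇ-true j<c = refl

  glue-Pc : ∀ {i} → i < c → g i c ≡ true
  glue-Pc i<c rewrite ≡ᵇ-false (<⇒≢ i<c) | ≡ᵇ-refl c = <ᵇ-true i<c

  glue-cP : ∀ {j} → j < c → g c j ≡ false
  glue-cP {j} j<c rewrite ≡ᵇ-false (≢-sym (<⇒≢ j<c)) | ≡ᵇ-refl c = <ᵇ-false (<⇒≤ j<c)

  glue-cc : g c c ≡ false
  glue-cc rewrite ≡ᵇ-refl c = refl

  glue-ii : ∀ i → g i i ≡ false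
  glue-ii i rewrite ≡ᵇ-refl i = refl

  glue-cQ : ∀ {j} → c < j → g c j ≡ true
  glue-cQ {j} c<j rewrite ≡ᵇ-false (<⇒≢ c<j) | ≡ᵇ-refl c = <ᵇ-true c<j

  glue-Qc : ∀ {i} → c < i → g i c ≡ false
  glue-Qc {i} c<i rewrite ≡ᵇ-false (≢-sym (<⇒≢ c<i)) | ≡ᵇ-refl c = <ᵇ-false (<⇒≤ c<i)

  glue-PQ : ∀ {i j} → i < c → c < j → g i j ≡ not (qp j i)
  glue-PQ {i} {j} i<c c<j rewrite ≡ᵇ-false (<⇒≢ (≤-trans i<c (<⇒≤ c<j))) | ≡ᵇ-false (<⇒≢ i<c) | ≡ᵇ-false (≢-sym (<⇒≢ c<j))
    | <ᵇ-true i<c | <ᵇ-false (<⇒≤ c<j) = refl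

  glue-QP : ∀ {i j} → c < i → j < c → g i j ≡ qp i j
  glue-QP {i} {j} c<i j<c rewrite ≡ᵇ-false (≢-sym (<⇒≢ (≤-trans j<c (<⇒≤ c<i)))) | ≡ᵇ-false (≢-sym (<⇒≢ c<i)) | ≡ᵇ-false (<⇒≢ j<c)
    | <ᵇ-false (<⇒≤ c<i) | <ᵇ-true j<c = refl

  glue-QQ : ∀ {i j} → c < i → c < j → i ≢ j → g i j ≡ qArc i j
  glue-QQ {i} {j} c<i c<j n rewrite ≡ᵇ-false n | ≡ᵇ-false (≢-sym (<⇒≢ c<i)) | ≡ᵇ-false (≢-sym (<⇒≢ c<j))
    | <ᵇ-false (<⇒≤ c<i) | <ᵇ-false (<⇒≤ c<j) = refl

module _ (a : ℕ) where

  reflect-< : ∀ {i j} → i ≤ a → j ≤ a → (a ∸ i <ᵇ a ∸ j) ≡ (j <ᵇ i)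
  reflect-< {i} {j} i≤ j≤ with <-cmp i j
  ... | tri< lt _ _ rewrite <ᵇ-false (<⇒≤ lt) = <ᵇ-false (<⇒≤ (∸-monoʳ-< lt j≤))
  ... | tri≈ _ refl _ rewrite <ᵇ-false (≤-refl {i}) = <ᵇ-false (≤-refl {a ∸ i})
  ... | tri> _ _ lt rewrite <ᵇ-true lt = <ᵇ-true (∸-monoʳ-< lt i≤)

  reflect-≢ : ∀ {i j} → i ≤ a → j ≤ a → i ≢ j → a ∸ i ≢ a ∸ j
  reflect-≢ {i} {j} i≤ j≤ n e with <-cmp i j
  ... | tri< lt _ _ = <⇒≢ (∸-monoʳ-< lt j≤) (sym e)
  ... | tri≈ _ e' _ = n e'
  ... | tri> _ _ lt = <⇒≢ (∸-monoʳ-< lt i≤) e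

ev-reflect : ∀ a {i} → ev a ≡ true → i ≤ a → ev (a ∸ i) ≡ ev i
ev-reflect a {zero} e _ = e
ev-reflect (suc a) {suc zero} e _ = trans (ev-not a) (cong not e)
ev-reflect (suc (suc a)) {suc (suc i)} e (s≤s (s≤s le)) = ev-reflect a e le

O-P : ∀ a {i j} → i ≤ a → j ≤ a → ltArc (a ∸ i) (a ∸ j) ≡ sideArc O i j
O-P = reflect-<

U-P : ∀ a → ev a ≡ true → ∀ {i j} → i ≤ a → j ≤ a → uArc (a ∸ i) (a ∸ j) ≡ sideArc U i j
U-P a e {i} {j} i≤ j≤ rewrite reflect-< a i≤ j≤ | even≡ev (a ∸ i) | even≡ev (a ∸ j) | ev-reflect a e i≤ | ev-reflect a e j≤
  = cong (λ p → if j <ᵇ i then p else ev i ∧ ev j) (demorgan (ev i) (ev j))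
  where
  demorgan : ∀ p q → (not p ∨ not q) ≡ not (p ∧ q)
  demorgan true q = refl
  demorgan false q = refl

V-P : ∀ a → ev a ≡ true → ∀ {i j} → i ≤ a → j ≤ a → i ≢ j → vArc a (a ∸ i) (a ∸ j) ≡ sideArc V i j
V-P a e {zero} {j} i≤ j≤ n rewrite ≡ᵇ-refl a = trans (even≡ev (a ∸ j)) (ev-reflect a e j≤)
V-P a e {suc i} {zero} i≤ j≤ n rewrite ≡ᵇ-false (reflect-≢ a i≤ j≤ n) | ≡ᵇ-refl a =
  cong not (trans (even≡ev (a ∸ suc i)) (ev-reflect a e i≤))
V-P a e {suc i} {suc j} i≤ j≤ n
  rewrite ≡ᵇ-false (reflect-≢ a {suc i} {zero} i≤ z≤n (λ ())) | ≡ᵇ-false (reflect-≢ a {suc j} {zero} j≤ z≤n (λ ())) = reflect-< a i≤ j≤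

-- Abstracts from the two placements of `Q`: flat sides keep their order, while V-shaped sides put
-- number 0 at the last label `2n`.
record QPosition (a q : ℕ) (posQ : ℕ → ℕ) : Set where
  field
    above : ∀ {j} → j ≤ q → suc a < posQ j
    top   : ∀ {j} → j ≤ q → posQ j ≤ suc (suc (a + q))
    distinct : ∀ {i j} → i ≤ q → j ≤ q → i ≢ j → posQ i ≢ posQ j
    onto  : ∀ d → d ≤ q → ∃ λ j → j ≤ q × posQ j ≡ suc (suc (a + d))

flatPos : ℕ → ℕ → ℕ
flatPos a j = suc (suc (a + j))

vPos : ℕ → ℕ → ℕ → ℕ
vPos a q zero = suc (suc (a + q))
vPos a q (suc j) = suc (suc (a + j))

flat-position : ∀ a q → QPosition a q (flatPos a)
flat-position a q = record
  { above = λ {j} _ → s≤s (s≤s (m≤m+n a j)) ; top = λ le → s≤s (s≤s (+-monoʳ-≤ a le))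
  ; distinct = λ {i} {j} _ _ n e → n (+-cancelˡ-≡ a i j (suc-injective (suc-injective e)))
  ; onto = λ d le → d , le , refl }

v-position : ∀ a q → QPosition a q (vPos a q)
v-position a q = record { above = λ {j} → above {j} ; top = λ {j} → top {j} ; distinct = λ {i} {j} → distinct {i} {j} ; onto = onto }
  where
  above : ∀ {j} → j ≤ q → suc a < vPos a q j
  above {zero} _ = s≤s (s≤s (m≤m+n a q))
  above {suc j} _ = s≤s (s≤s (m≤m+n a j))
  top : ∀ {j} → j ≤ q → vPos a q j ≤ suc (suc (a + q))
  top {zero} _ = ≤-refl
  top {suc j} le = s≤s (s≤s (+-monoʳ-≤ a (<⇒≤ le)))
  distinct : ∀ {i j} → i ≤ q → j ≤ q → i ≢ j → vPos a q i ≢ vPos a q j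
  distinct {zero} {zero} _ _ n _ = n refl
  distinct {zero} {suc j} _ le n e = <⇒≢ le (sym (+-cancelˡ-≡ a q j (suc-injective (suc-injective e))))
  distinct {suc i} {zero} le _ n e = <⇒≢ le (+-cancelˡ-≡ a i q (suc-injective (suc-injective e)))
  distinct {suc i} {suc j} _ _ n e = n (cong suc (+-cancelˡ-≡ a i j (suc-injective (suc-injective e))))
  onto : ∀ d → d ≤ q → ∃ λ j → j ≤ q × vPos a q j ≡ suc (suc (a + d))
  onto d le with m≤n⇒m<n∨m≡n le
  ... | inj₁ lt = suc d , lt , refl
  ... | inj₂ refl = 0 , z≤n , refl

+-<ᵇ : ∀ a i j → (a + i <ᵇ a + j) ≡ (i <ᵇ j)
+-<ᵇ zero i j = refl
+-<ᵇ (suc a) i j = +-<ᵇ a i j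

ev-+ : ∀ a j → ev a ≡ true → ev (a + j) ≡ ev j
ev-+ zero j _ = refl
ev-+ (suc (suc a)) j e = ev-+ a j e

ev-flatPos : ∀ a j → ev a ≡ true → even (flatPos a j) ≡ ev j
ev-flatPos a j e = trans (even≡ev (a + j)) (ev-+ a j e)

O-Q : ∀ a i j → ltArc (flatPos a i) (flatPos a j) ≡ sideArc O j i
O-Q a i j = +-<ᵇ a i j

vPos-top : ∀ a q {j} → suc j ≤ q → (flatPos a j ≡ᵇ suc (suc (a + q))) ≡ false
vPos-top a q {j} le = ≡ᵇ-false {flatPos a j} {suc (suc (a + q))} (QPosition.distinct (v-position a q) {suc j} {zero} le z≤n (λ ()))

V-Q : ∀ a q → ev a ≡ true → ∀ {i j} → i ≤ q → j ≤ q → i ≢ j →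
  vArc (suc (suc (a + q))) (vPos a q i) (vPos a q j) ≡ sideArc V j i
V-Q a q e {zero} {zero} _ _ n = ⊥-elim (n refl)
V-Q a q e {zero} {suc j} _ _ n rewrite ≡ᵇ-refl (a + q) = trans (ev-flatPos a j e) (ev-not j)
V-Q a q e {suc i} {zero} le _ n rewrite vPos-top a q le | ≡ᵇ-refl (a + q) = trans (cong not (ev-flatPos a i e)) (sym (ev-suc i))
V-Q a q e {suc i} {suc j} le le' n rewrite vPos-top a q le | vPos-top a q le' = +-<ᵇ a i j

module Positions (a q : ℕ) (pArc qArc qp : ℕ → ℕ → Bool) (τ σ : Shape) (posQ : ℕ → ℕ) (Q : QPosition a q posQ)
  (PP : ∀ {i j} → i ≤ a → j ≤ a → i ≢ j → pArc (a ∸ i) (a ∸ j) ≡ sideArc τ i j)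
  (QQ : ∀ {i j} → i ≤ q → j ≤ q → i ≢ j → qArc (posQ i) (posQ j) ≡ sideArc σ j i)
  (QP : ∀ {i j} → i ≤ q → j ≤ a → qp (posQ i) (a ∸ j) ≡ special τ j ∧ special σ i)
  where
  open QPosition Q

  pos : Node → ℕ
  pos (inP i) = a ∸ i
  pos mid = suc a
  pos (inQ j) = posQ j

  private
    g : ℕ → ℕ → Bool
    g = glue (suc a) pArc qArc qp
    low : ∀ i → a ∸ i < suc a
    low i = s≤s (m∸n≤m a i)

  pos-arc : ∀ x y → Region ⊤ a q x → Region ⊤ a q y → g (pos x) (pos y) ≡ nodeArc τ σ x y
  pos-arc (inP i) (inP j) i≤ j≤ with i ≟ⁿ j
  ... | yes refl = trans (glue-ii (suc a) pArc qArc qp (a ∸ i)) (sym (loopless-irr (sideArc τ) i))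
  ... | no n = trans (glue-PP (suc a) pArc qArc qp (low i) (low j) (reflect-≢ a i≤ j≤ n))
                 (trans (PP i≤ j≤ n) (sym (loopless-≢ (sideArc τ) n)))
  pos-arc (inP i) mid _ _ = glue-Pc (suc a) pArc qArc qp (low i)
  pos-arc (inP i) (inQ j) i≤ j≤ = trans (glue-PQ (suc a) pArc qArc qp (low i) (above j≤)) (cong not (QP j≤ i≤))
  pos-arc mid (inP j) _ _ = glue-cP (suc a) pArc qArc qp (low j)
  pos-arc mid mid _ _ = glue-cc (suc a) pArc qArc qp
  pos-arc mid (inQ j) _ j≤ = glue-cQ (suc a) pArc qArc qp (above j≤)
  pos-arc (inQ i) (inP j) i≤ j≤ = trans (glue-QP (suc a) pArc qArc qp (above i≤) (low j)) (QP i≤ j≤)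
  pos-arc (inQ i) mid i≤ _ = glue-Qc (suc a) pArc qArc qp (above i≤)
  pos-arc (inQ i) (inQ j) i≤ j≤ with i ≟ⁿ j
  ... | yes refl = trans (glue-ii (suc a) pArc qArc qp (posQ i)) (sym (loopless-irr (λ i j → sideArc σ j i) i))
  ... | no n = trans (glue-QQ (suc a) pArc qArc qp (above i≤) (above j≤) (distinct i≤ j≤ n))
                 (trans (QQ i≤ j≤ n) (sym (loopless-≢ (λ i j → sideArc σ j i) n)))

  pos-top : ∀ x → Region ⊤ a q x → pos x ≤ suc (suc (a + q))
  pos-top (inP i) _ = ≤-trans (m∸n≤m a i) (≤-trans (m≤m+n a q) (≤-trans (n≤1+n _) (n≤1+n _)))
  pos-top mid _ = s≤s (≤-trans (m≤m+n a q) (n≤1+n _))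
  pos-top (inQ j) h = top h

  pos-onto : ∀ t → t ≤ suc (suc (a + q)) → ∃ λ x → Region ⊤ a q x × pos x ≡ t
  pos-onto t t≤ with <-cmp t (suc a)
  ... | tri≈ _ e _ = mid , tt , sym e
  ... | tri< lt _ _ = inP (a ∸ t) , m∸n≤m a t , m∸[m∸n]≡n (≤-pred lt)
  ... | tri> _ _ gt with onto (t ∸ suc (suc a)) d≤
    where
    d≤ : t ∸ suc (suc a) ≤ q
    d≤ = subst (t ∸ suc (suc a) ≤_) (m+n∸m≡n (suc (suc a)) q) (∸-monoˡ-≤ (suc (suc a)) t≤)
  ...   | j , j≤ , e = inQ j , j≤ , trans e (m+[n∸m]≡n gt)

  module InFin (N : ℕ) (N≡ : N ≡ suc (suc (a + q))) (k k' : ℕ) (a≡ : a ≡ dbl (suc k)) (q≡ : q ≡ dbl (suc k')) where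

    -- The minimum only makes the function total: it is pos x on the relevant nodes.
    place : Node → Fin (suc N)
    place x = fromℕ< (s≤s (m⊓n≤n (pos x) N))

    region : ∀ x → Region ⊤ (dbl (suc k)) (dbl (suc k')) x → Region ⊤ a q x
    region x = subst₂ (λ p r → Region ⊤ p r x) (sym a≡) (sym q≡)

    region⁻ : ∀ x → Region ⊤ a q x → Region ⊤ (dbl (suc k)) (dbl (suc k')) x
    region⁻ x = subst₂ (λ p r → Region ⊤ p r x) a≡ q≡

    place-pos : ∀ x → Region ⊤ a q x → toℕ (place x) ≡ pos x
    place-pos x h = trans (toℕ-fromℕ< _) (m≤n⇒m⊓n≡m (subst (pos x ≤_) (sym N≡) (pos-top x h)))

    model : Model {suc N} (lift g) τ σ k k' (place mid)
    model = record
      { h = place ; h-mid = refl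
      ; arcs = λ {x} {y} ox oy → trans (cong₂ g (place-pos x (region x ox)) (place-pos y (region y oy)))
                 (pos-arc x y (region x ox) (region y oy))
      ; cover = co }
      where
      co : ∀ v → ∃ λ x → Region ⊤ (dbl (suc k)) (dbl (suc k')) x × place x ≡ v
      co v with pos-onto (toℕ v) (subst (toℕ v ≤_) N≡ (≤-pred (toℕ<n v)))
      ... | x , ox , e = x , region⁻ x ox , toℕ-injective (trans (place-pos x ox) e)

-- Parameters of the families and the assembly of both directions.

dbl≡2* : ∀ k → dbl k ≡ 2 * k
dbl≡2* zero = refl
dbl≡2* (suc k) = trans (cong (λ n → suc (suc n)) (dbl≡2* k)) (sym (*-suc 2 k))

family : ∀ {τ σ} → Listed τ σ → (n k : ℕ) → Arcs (suc (2 * n))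
family OO = E
family UO = F
family UV = G
family VV = H

module _ (k k' : ℕ) where

  -- This is `n` for sides of `2(k + 1) + 1` and `2(k' + 1) + 1` vertices, which with the middle
  -- vertex give `2n + 1`. The parameter of the family is `suc k`, and its admissible range
  -- corresponds to arbitrary natural numbers `k` and `k'`.
  size : ℕ
  size = suc (suc k + suc k')

  private
    a q N : ℕ
    a = 2 * suc k
    q = 2 * suc k'
    N = 2 * size

    ev-a : ev a ≡ true
    ev-a = trans (cong ev (sym (dbl≡2* (suc k)))) (ev-dbl (suc k))

    N≡ : N ≡ suc (suc (a + q))
    N≡ = trans (*-suc 2 (suc k + suc k')) (cong (λ n → suc (suc n)) (*-distribˡ-+ 2 (suc k) (suc k')))

    vN : ∀ {i j} → i ≤ q → j ≤ q → i ≢ j → vArc N (vPos a q i) (vPos a q j) ≡ sideArc V j i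
    vN {i} {j} le le' n = trans (cong (λ t → vArc t (vPos a q i) (vPos a q j)) N≡) (V-Q a q ev-a le le' n)

    even-even : ∀ {i j} → j ≤ a → (even (flatPos a i) ∧ even (a ∸ j)) ≡ ev j ∧ ev i
    even-even {i} {j} le = trans (cong₂ _∧_ (ev-flatPos a i ev-a) (trans (even≡ev (a ∸ j)) (ev-reflect a ev-a le))) (∧-comm (ev i) (ev j))

    at-top : ∀ {i} → i ≤ q → (vPos a q i ≡ᵇ N) ≡ special V i
    at-top {zero} _ = trans (cong (vPos a q zero ≡ᵇ_) N≡) (≡ᵇ-refl (a + q))
    at-top {suc i} le = trans (cong (vPos a q (suc i) ≡ᵇ_) N≡) (vPos-top a q le)

    at-end : ∀ {j} → j ≤ a → (a ∸ j ≡ᵇ a) ≡ special V j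
    at-end {zero} _ = ≡ᵇ-refl a
    at-end {suc j} le = ≡ᵇ-false (reflect-≢ a {suc j} {zero} le z≤n (λ ()))

    a≡ : a ≡ dbl (suc k)
    a≡ = sym (dbl≡2* (suc k))
    q≡ : q ≡ dbl (suc k')
    q≡ = sym (dbl≡2* (suc k'))

  family-model : ∀ {τ σ} (l : Listed τ σ) → ∃ λ c → toℕ c ≡ suc (2 * suc k) × Model (family l size (suc k)) τ σ k k' c
  family-model OO = I.place mid , I.place-pos mid tt , I.model
    where
    module I = Positions.InFin a q ltArc ltArc (λ x y → even x ∧ even y) O O (flatPos a) (flat-position a q)
      (λ i≤ j≤ _ → O-P a i≤ j≤) (λ {i} {j} _ _ _ → O-Q a i j) (λ {i} _ j≤ → even-even {i} j≤) N N≡ k k' a≡ q≡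
  family-model UO = I.place mid , I.place-pos mid tt , I.model
    where
    module I = Positions.InFin a q uArc ltArc (λ x y → even x ∧ even y) U O (flatPos a) (flat-position a q)
      (λ i≤ j≤ _ → U-P a ev-a i≤ j≤) (λ {i} {j} _ _ _ → O-Q a i j) (λ {i} _ j≤ → even-even {i} j≤) N N≡ k k' a≡ q≡
  family-model UV = I.place mid , I.place-pos mid tt , I.model
    where
    module I = Positions.InFin a q uArc (vArc N) (λ x y → (x ≡ᵇ N) ∧ even y) U V (vPos a q) (v-position a q)
      (λ i≤ j≤ _ → U-P a ev-a i≤ j≤) vN
      (λ {i} {j} i≤ j≤ → trans (cong₂ _∧_ (at-top i≤) (trans (even≡ev (a ∸ j)) (ev-reflect a ev-a j≤))) (∧-comm (special V i) (ev j)))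
      N N≡ k k' a≡ q≡
  family-model VV = I.place mid , I.place-pos mid tt , I.model
    where
    module I = Positions.InFin a q (vArc a) (vArc N) (λ x y → (x ≡ᵇ N) ∧ (y ≡ᵇ a)) V V (vPos a q) (v-position a q)
      (V-P a ev-a) vN
      (λ {i} {j} i≤ j≤ → trans (cong₂ _∧_ (at-top i≤) (at-end j≤)) (∧-comm (special V i) (special V j)))
      N N≡ k k' a≡ q≡

  size-admissible : Admissible size (suc k)
  size-admissible = s≤s (s≤s (≤-trans z<s (≤-reflexive (sym (+-suc k k'))))) , z<s ,
    ≤-trans (≤-reflexive (+-comm (suc k) 2)) (s≤s (s≤s (subst (suc k ≤_) (sym (+-suc k k')) (s≤s (m≤m+n k k')))))

admissible-size : ∀ {n k} → Admissible n k → ∃₂ λ p q → n ≡ size p q × k ≡ suc p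
admissible-size {n} {suc k} (_ , _ , le) = k , n ∸ (suc k + 2) , eq , refl
  where
  eq : n ≡ size k (n ∸ (suc k + 2))
  eq = trans (sym (m+[n∸m]≡n le)) (cong suc (trans (+-assoc k 2 _) (trans (+-suc k _) (cong suc refl))))

oneOfSix-orient : ∀ {n k X} → OneOfSix n k X → ∃₂ λ τ σ → Σ (Listed τ σ) λ l → ∃ λ b → X ≡ orient b (family l n k)
oneOfSix-orient (inj₁ e) = O , O , OO , true , e
oneOfSix-orient (inj₂ (inj₁ e)) = U , O , UO , true , e
oneOfSix-orient (inj₂ (inj₂ (inj₁ e))) = U , O , UO , false , e
oneOfSix-orient (inj₂ (inj₂ (inj₂ (inj₁ e)))) = U , V , UV , true , e
oneOfSix-orient (inj₂ (inj₂ (inj₂ (inj₂ (inj₁ e))))) = U , V , UV , false , e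
oneOfSix-orient (inj₂ (inj₂ (inj₂ (inj₂ (inj₂ e))))) = V , V , VV , true , e

orient-back : ∀ {m} {X Y : Arcs m} b → X ≡ orient b Y → orient b X ≡ Y
orient-back true refl = refl
orient-back false refl = refl

oneOfSix-model : ∀ {n k X} → Admissible n k → OneOfSix n k X →
  ∃₂ λ τ σ → Listed τ σ × ∃₂ λ b p → ∃₂ λ q c → toℕ c ≡ suc (2 * k) × Model (orient b X) τ σ p q c
oneOfSix-model {n} {k} adm six with admissible-size {n} {k} adm | oneOfSix-orient {n} {k} six
... | p , q , refl , refl | τ , σ , l , b , e with family-model p q l
...   | c , ec , D = τ , σ , l , b , p , q , c , ec , subst (λ Y → Model Y τ σ p q c) (sym (orient-back b e)) D

5≤size : ∀ {n k} → Admissible n k → 5 ≤ suc (2 * n)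
5≤size (3≤n , _) = ≤-trans (s≤s (s≤s (s≤s (s≤s z<s)))) (s≤s (*-monoʳ-≤ 2 3≤n))

classify : ∀ {m} {T : Arcs m} → Tour T → MinusOneCritical T →
  Σ ℕ λ n → Σ ℕ λ k → Admissible n k × Σ (Arcs (suc (2 * n))) λ X → OneOfSix n k X × (T ≅ X)
classify {T = T} tour crit with MinusOneCritical⇒MinusOne tour crit
... | c , H with Critical-structure.classification H
... | inj₁ (p , q , D) = size p q , suc p , size-admissible p q , E (size p q) (suc p) , inj₁ refl ,
        model-iso D (proj₂ (proj₂ (family-model p q OO)))
... | inj₂ (inj₁ (p , q , D)) = size p q , suc p , size-admissible p q , H′ , inj₂ (inj₂ (inj₂ (inj₂ (inj₂ refl)))) ,
        model-iso D (proj₂ (proj₂ (family-model p q VV)))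
  where
  H′ = family VV (size p q) (suc p)
... | inj₂ (inj₂ (b , inj₁ (p , q , D))) = size p q , suc p , size-admissible p q , orient b F′ , which b ,
        ≅-orient b (model-iso D (proj₂ (proj₂ (family-model p q UO))))
  where
  F′ = family UO (size p q) (suc p)
  which : ∀ b → OneOfSix (size p q) (suc p) (orient b F′)
  which true = inj₂ (inj₁ refl)
  which false = inj₂ (inj₂ (inj₁ refl))
... | inj₂ (inj₂ (b , inj₂ (p , q , D))) = size p q , suc p , size-admissible p q , orient b G′ , which b ,
        ≅-orient b (model-iso D (proj₂ (proj₂ (family-model p q UV))))
  where
  G′ = family UV (size p q) (suc p)
  which : ∀ b → OneOfSix (size p q) (suc p) (orient b G′)
  which true = inj₂ (inj₂ (inj₂ (inj₁ refl)))
  which false = inj₂ (inj₂ (inj₂ (inj₂ (inj₁ refl))))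

theorem1p3 :
    (∀ (m : ℕ) (T : Arcs m) → IsTournament T →
      (MinusOneCritical T ⇔
        Σ ℕ λ n → Σ ℕ λ k → Admissible n k ×
          Σ (Arcs (suc (2 * n))) λ X → OneOfSix n k X × (T ≅ X)))
    ×
    (∀ (n k : ℕ) (adm : Admissible n k) (X : Arcs (suc (2 * n))) → OneOfSix n k X →
      (c : Fin (suc (2 * n))) → toℕ c ≡ suc (2 * k) →
      NonCritical X c × (∀ y → y ≢ c → Critical X y))
theorem1p3 = (λ m T isT → mk⇔ (classify (IsTournament⇒Tour isT)) back) , unique
  where
  back : ∀ {m} {T : Arcs m} → (Σ ℕ λ n → Σ ℕ λ k → Admissible n k × Σ (Arcs (suc (2 * n))) λ X → OneOfSix n k X × (T ≅ X)) →
    MinusOneCritical T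
  back (n , k , adm , X , six , i) with oneOfSix-model {n} {k} adm six
  ... | τ , σ , l , b , p , q , c , _ , D = MinusOne⇒MinusOneCritical
    (model⇒MinusOne {b = b} (subst (5 ≤_) (sym (↔⇒≡ (proj₁ i))) (5≤size {n} {k} adm)) l (model-≅ (orient-≅ b i) D))
  unique : ∀ n k (adm : Admissible n k) X → OneOfSix n k X → (c : Fin (suc (2 * n))) → toℕ c ≡ suc (2 * k) →
    NonCritical X c × (∀ y → y ≢ c → Critical X y)
  unique n k adm X six c ec with oneOfSix-model {n} {k} adm six
  ... | τ , σ , l , b , p , q , c' , ec' , D with toℕ-injective {i = c} {c'} (trans ec (sym ec'))
  ...   | refl = (λ crit → crit (IndecomposableOn-without indc)) , λ y y≢c ind → crit y≢c (Indec-without ind)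
    where open MinusOne (model⇒MinusOne {T = X} {b} (5≤size {n} {k} adm) l D)
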